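{- Let $n,k,r$ be positive integers and let $T$ be a tree of order $n$ with $k$ pendent paths of length $r$ having minimum Mostar index among all such trees. (i) If $k=1$ and $2\le r\le n-3$, then $T\cong A^1_{n,1,2}$. (ii) If $k=2$ and $1\le r\le n-2$, then $T\cong P_n$. (iii) If $k\ge 3$ and $1\le r\le \frac{n-2}{k}$, then $T\cong A^r_{n,\lceil\frac{k}{2}\rceil,\lfloor\frac{k}{2}\rfloor}$.
   Context: For a connected simple graph $G$, the Mostar index is $Mo(G)=\sum_{uv\in E(G)}|n_u-n_v|$, where for an edge $e=uv$, $n_u$ is the number of vertices of $G$ closer (in graph distance) to $u$ than to $v$, and $n_v$ is the number of vertices closer to $v$ than to $u$. The order of a graph is its number of vertices. $P_m$ is the path on $m$ vertices. A path $u_0u_1\cdots u_r$ with $r\ge1$ in a graph $G$ is called a pendent path of length $r$ at $u_r$ if $d_G(u_0)=1$, $d_G(u_r)\ge 2$ and, when $r\ge 2$, $d_G(u_i)=2$ for $1\le i\le r-1$. (Note that $u_r$ may have degree exactly $2$; e.g. $P_n$ has two pendent paths of length $r$ for each $2\le r\le n-2$.) "With $k$ pendent paths of length $r$" means that the number of pendent paths of length $r$ is exactly $k$. For positive integers $n,r,a,b$ with $(a+b)r\le n-2$, $A^r_{n,a,b}$ is the $n$-vertex tree obtained from the path $P_m=v_1v_2\dots v_m$ with $m=n-(a+b)r$ by attaching $a$ paths of length $r$ at $v_1$ and $b$ paths of length $r$ at $v_m$ (each attached path contributes $r$ new vertices). -}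

module Defs where

open import Data.Bool using (if_then_else_)
open import Data.Fin as Fin using (Fin; toℕ; inject₁)
import Data.Fin.Properties as Fin
open import Data.List using (List; length; map; filter; allFin; cartesianProduct)
open import Data.List.Membership.Propositional using (_∈_)
open import Data.List.Relation.Unary.Unique.Propositional using () renaming (Unique to UniqueList)
open import Data.Nat
open import Data.Nat.ListAction using (sum)
open import Data.Nat.Properties as ℕ using ()
open import Data.Product using (Σ; ∃; _×_; _,_)
open import Data.Sum using (_⊎_; inj₁; inj₂; swap)
import Data.Sum.Properties as Sum
open import Data.Vec as Vec using (Vec; lookup; head)
open import Data.Vec.Relation.Unary.Unique.Propositional using (Unique)
open import Function.Bundles using (_⇔_; _↔_; Inverse)
open import Level using (0ℓ)
open import Relation.Binary.Core using (Rel)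
open import Relation.Binary.Definitions using (Symmetric; Decidable; DecidableEquality)
open import Relation.Binary.PropositionalEquality using (_≡_; sym)
open import Relation.Nullary using (¬_; Dec; does)
open import Relation.Nullary.Decidable using (_×-dec_; _⊎-dec_)
import Relation.Unary as U

-- A simple graph with vertex type V.  Decidability of adjacency is no
-- restriction classically; it is what makes degrees and distances computable.
record Graph (V : Set) : Set₁ where
  infix 4 _~_ _~?_
  field
    _~_     : Rel V 0ℓ
    _~?_    : Decidable _~_
    ~-sym   : Symmetric _~_
    ~-irrefl : ∀ {v} → ¬ (v ~ v)

infix 4 _≅_

_≅_ : {V W : Set} → Graph V → Graph W → Set
_≅_ {V} {W} G H =
  Σ (V ↔ W) λ f → ∀ u v →
    (Graph._~_ G u v) ⇔ (Graph._~_ H (Inverse.to f u) (Inverse.to f v))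

-- The least i < b with P i, and b if there is none.
least : {P : ℕ → Set} → U.Decidable P → ℕ → ℕ
least P? zero    = zero
least P? (suc b) = if does (P? zero) then zero else suc (least (λ i → P? (suc i)) b)

HasExactly : ℕ → {A : Set} → (A → Set) → Set
HasExactly k {A} P =
  ∃ λ (xs : List A) → UniqueList xs × length xs ≡ k × (∀ x → x ∈ xs ⇔ P x)

module _ {n : ℕ} (G : Graph (Fin n)) where
  open Graph G

  degree : Fin n → ℕ
  degree u = length (filter (u ~?_) (allFin n))

  Walk : ℕ → Fin n → Fin n → Set
  Walk zero    u v = u ≡ v
  Walk (suc ℓ) u v = ∃ λ w → u ~ w × Walk ℓ w v

  walk? : ∀ u v → U.Decidable (λ ℓ → Walk ℓ u v)
  walk? u v zero    = u Fin.≟ v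
  walk? u v (suc ℓ) = Fin.any? λ w → (u ~? w) ×-dec walk? w v ℓ

  Connected : Set
  Connected = ∀ u v → ∃ λ ℓ → Walk ℓ u v

  -- Length of a shortest walk.  Two vertices joined by a walk are joined by one
  -- of length < n, so the bound n is only attained when there is no walk.
  dist : Fin n → Fin n → ℕ
  dist u v = least (walk? u v) n

  record IsPath {r : ℕ} (p : Vec (Fin n) (suc r)) : Set where
    field
      distinct : Unique p
      adjacent : ∀ (i : Fin r) → lookup p (inject₁ i) ~ lookup p (Fin.suc i)

  record IsCycle {r : ℕ} (p : Vec (Fin n) (suc r)) : Set where
    field
      isPath : IsPath p
      long   : 2 ≤ r
      closed : Vec.last p ~ head p

  record IsTree : Set where
    field
      connected : Connected
      acyclic   : ∀ {r} (p : Vec (Fin n) (suc r)) → ¬ IsCycle p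

  record IsPendentPath {r : ℕ} (p : Vec (Fin n) (suc r)) : Set where
    field
      positive : 1 ≤ r
      isPath   : IsPath p
      start    : degree (head p) ≡ 1
      end      : 2 ≤ degree (Vec.last p)
      inner    : ∀ (i : Fin (suc r)) → 1 ≤ toℕ i → toℕ i < r → degree (lookup p i) ≡ 2

  -- Each undirected edge occurs once, with its smaller endpoint first.
  edges : List (Fin n × Fin n)
  edges = filter (λ (u , v) → (u Fin.<? v) ×-dec (u ~? v))
                 (cartesianProduct (allFin n) (allFin n))

  closer : Fin n → Fin n → ℕ
  closer u v = length (filter (λ w → dist w u <? dist w v) (allFin n))

  Mo : ℕ
  Mo = sum (map (λ (u , v) → ∣ closer u v - closer v u ∣) edges)

-- Vertex sequences of pendent paths are counted; a pendent path determines its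
-- sequence, because only its initial vertex has degree 1.
record IsTreeWithPendentPaths (n k r : ℕ) (T : Graph (Fin n)) : Set where
  field
    isTree  : IsTree T
    pendent : HasExactly k (IsPendentPath T {r})

record HasMinimumMo (n k r : ℕ) (T : Graph (Fin n)) : Set₁ where
  field
    member  : IsTreeWithPendentPaths n k r T
    minimum : ∀ (T′ : Graph (Fin n)) → IsTreeWithPendentPaths n k r T′ → Mo T ≤ Mo T′

Consecutive : ∀ {m} → Rel (Fin m) 0ℓ
Consecutive i j = suc (toℕ i) ≡ toℕ j ⊎ suc (toℕ j) ≡ toℕ i

consecutive? : ∀ {m} → Decidable (Consecutive {m})
consecutive? i j = (suc (toℕ i) ℕ.≟ toℕ j) ⊎-dec (suc (toℕ j) ℕ.≟ toℕ i)

consecutive-irrefl : ∀ {m} {i : Fin m} → ¬ Consecutive i i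
consecutive-irrefl (inj₁ e) = ℕ.1+n≢n e
consecutive-irrefl (inj₂ e) = ℕ.1+n≢n e

P : ∀ m → Graph (Fin m)
P m = record
  { _~_      = Consecutive
  ; _~?_     = consecutive?
  ; ~-sym    = swap
  ; ~-irrefl = consecutive-irrefl
  }

-- The path v₁ … v_m, m = n ∸ (a + b) * r, is the first summand, so that v₁ has
-- index 0 and v_m index m - 1.  The vertex (l , s) of the second summand is the
-- s-th new vertex of the attached path l, s = 0 being the one joined to the path;
-- the labels l in Fin a are attached at v₁, those in Fin b at v_m.
-- This is the intended tree, of order n, when a, b, r ≥ 1 and (a + b) * r + 2 ≤ n.
module Double (n r a b : ℕ) where
  m : ℕ
  m = n ∸ (a + b) * r

  Leg : Set
  Leg = Fin a ⊎ Fin b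

  Vertex : Set
  Vertex = Fin m ⊎ (Leg × Fin r)

  AttachedAt : Leg → Fin m → Set
  AttachedAt (inj₁ _) i = toℕ i ≡ 0
  AttachedAt (inj₂ _) i = suc (toℕ i) ≡ m

  Adj : Rel Vertex 0ℓ
  Adj (inj₁ i)       (inj₁ j)        = Consecutive i j
  Adj (inj₁ i)       (inj₂ (l , s))  = AttachedAt l i × toℕ s ≡ 0
  Adj (inj₂ (l , s)) (inj₁ i)        = AttachedAt l i × toℕ s ≡ 0
  Adj (inj₂ (l , s)) (inj₂ (l′ , t)) = l ≡ l′ × Consecutive s t

  attachedAt? : ∀ l i → Dec (AttachedAt l i)
  attachedAt? (inj₁ _) i = toℕ i ℕ.≟ 0
  attachedAt? (inj₂ _) i = suc (toℕ i) ℕ.≟ m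

  _≟L_ : DecidableEquality Leg
  _≟L_ = Sum.≡-dec Fin._≟_ Fin._≟_

  adj? : Decidable Adj
  adj? (inj₁ i)       (inj₁ j)        = consecutive? i j
  adj? (inj₁ i)       (inj₂ (l , s))  = attachedAt? l i ×-dec (toℕ s ℕ.≟ 0)
  adj? (inj₂ (l , s)) (inj₁ i)        = attachedAt? l i ×-dec (toℕ s ℕ.≟ 0)
  adj? (inj₂ (l , s)) (inj₂ (l′ , t)) = (l ≟L l′) ×-dec consecutive? s t

  adj-sym : Symmetric Adj
  adj-sym {inj₁ _} {inj₁ _} e       = swap e
  adj-sym {inj₁ _} {inj₂ _} e       = e
  adj-sym {inj₂ _} {inj₁ _} e       = e
  adj-sym {inj₂ _} {inj₂ _} (e , c) = sym e , swap c

  adj-irrefl : ∀ {v} → ¬ Adj v v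
  adj-irrefl {inj₁ i} e             = consecutive-irrefl {i = i} e
  adj-irrefl {inj₂ (_ , s)} (_ , c) = consecutive-irrefl {i = s} c

A : ∀ n r a b → Graph (Double.Vertex n r a b)
A n r a b = record
  { _~_      = Adj
  ; _~?_     = adj?
  ; ~-sym    = λ {u} {v} → adj-sym {u} {v}
  ; ~-irrefl = λ {v} → adj-irrefl {v}
  }
  where open Double n r a b

{-# OPTIONS --safe #-}

-- In a tree on n vertices an edge with sides of sizes x + y = n contributes |x − y| = n − 2 min(x, y)
-- to the Mostar index, so that minimizing Mo means maximizing the sum over s ≥ 1 of
-- N s = #{edges with both sides of size ≥ s}.  Root the tree at a vertex of degree ≥ 3; the edges are
-- then the nonroot vertices v, with sides the set of descendants of v and its complement.  Let the tree
-- have k pendent paths of length r, and split k = j + j′ with j = ⌊k/2⌋, j′ = ⌈k/2⌉.  If N s > 0, then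
--   N s + k min(s − 1, r) + 1 ≤ n,   N s + 2s ≤ n + 1,   and   N s + j′ r + s ≤ n   for s > r:
-- by the edges inside the pendent paths; because two extreme edges cut off disjoint sets of ≥ s vertices
-- inside which no other edge is counted; and because every edge has a side with at most j of the paths.
-- A(n, r, j′, j) reaches the least of the three bounds for every s, so an optimal tree does too.
-- Equality at s = jr + 1 and, for odd k, at s = jr + 2 forces the vertices outside the pendent paths
-- to form a path with all pendent paths attached at its ends.  For k = 1 the same argument runs with
-- r = 1 and three leaves, which every tree other than a path has.

module Submission where

open import Defs
import Data.Nat.Properties as ℕ
open import Algebra.Properties.Semiring.Sum ℕ.+-*-semiring
  using (sum-syntax; sum-cong-≗; ∑-distrib-+; ∑-comm; sum-replicate-zero; *-distribˡ-sum; *-distribʳ-sum)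
  renaming (sum to Σᶠ)
open import Data.Empty using (⊥; ⊥-elim)
open import Data.Fin using (Fin; toℕ; inject₁; fromℕ<)
import Data.Fin as Fin
import Data.Fin.Induction as Fin
import Data.Fin.Properties as Fin
open import Data.List using (List; []; _∷_; _++_; length; map; filter; allFin; tabulate; upTo;
  cartesianProduct)
import Data.List as List
import Data.List.Properties as List
open import Data.List.Membership.Propositional using (_∈_)
open import Data.List.Membership.Propositional.Properties
open import Data.List.Relation.Unary.All as All using (All; []; _∷_)
import Data.List.Relation.Unary.All.Properties as All
open import Data.List.Relation.Unary.AllPairs using ([]; _∷_)
open import Data.List.Relation.Unary.Any as Any using (here; there)
import Data.List.Relation.Unary.Any.Properties as Any
open import Data.List.Relation.Unary.Unique.Propositional using () renaming (Unique to UniqueList)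
import Data.List.Relation.Unary.Unique.Propositional.Properties as Unique
open import Data.Nat using (ℕ; zero; suc; z≤n; s≤s; z<s; s<s; s≤s⁻¹; _+_; _*_; _∸_; pred; _⊔_; _≤_; _<_; _≟_;
  _≤?_; _<?_; ∣_-_∣; ⌈_/2⌉; ⌊_/2⌋)
open import Data.Nat.Induction using (<-wellFounded)
open import Data.Nat.ListAction using (sum)
open import Data.Nat.ListAction.Properties using (sum-++)
open import Data.Nat.Tactic.RingSolver using (solve-∀)
import Data.Product
open import Data.Product using (∃; ∃₂; _×_; _,_; proj₁; proj₂; uncurry)
open import Data.Product.Function.NonDependent.Propositional using (_×-↔_)
open import Data.Sum using (_⊎_; inj₁; inj₂; [_,_])
import Data.Sum as Sum
open import Data.Sum.Properties using (inj₁-injective; inj₂-injective)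
open import Data.Sum.Function.Propositional using (_⊎-↔_)
open import Data.Unit using (⊤; tt)
open import Data.Vec using (Vec; []; _∷_; lookup; head)
import Data.Vec as Vec
import Data.Vec.Properties as Vec
open import Data.Vec.Relation.Unary.All as VecAll using ([]; _∷_)
open import Data.Vec.Relation.Unary.AllPairs using ([]; _∷_)
open import Data.Vec.Relation.Unary.Unique.Propositional using () renaming (Unique to UniqueVec)
import Data.Vec.Relation.Unary.Unique.Propositional.Properties as UniqueVec
open import Function using (_∘_; id; case_of_)
open import Function.Bundles using (_↔_; mk⇔; mk↔ₛ′; Equivalence; Inverse)
open import Function.Properties.Inverse using (↔-refl; ↔-sym; ↔-trans)
open import Induction.WellFounded using (Acc; acc)
open import Relation.Binary.Definitions using (tri<; tri≈; tri>)
open import Relation.Binary.PropositionalEquality hiding ([_])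
open import Relation.Nullary using (¬_; Dec; yes; no; contradiction)
open import Relation.Nullary.Decidable using (_×-dec_; _⊎-dec_; ¬?; map′)
open import Relation.Unary using (Decidable)

-- Counting on Fin n

-- The constants jr + 1 and jr + 2 are read off the extremal tree. Call the vertices outside the
-- pendent paths the spine: an end edge of the spine cuts off one spine vertex and the j paths
-- attached to it, that is jr + 1 vertices. So at s = jr + 1 every spine edge still counts, and at s
-- = jr + 2 exactly one fails if k is odd. The least of the three bounds is never formed. They are
-- carried as conditions on a number X, both in the lower bound for the extremal tree and in the
-- equality hypothesis of the rigidity argument. A root of degree at least 3 cannot be interior to a
-- pendent path, so all pendent paths climb toward it. A tree without such a vertex has exactly two
-- pendent paths of length r, which excludes it unless k = 2. For k = 1 the number of leaves of a
-- competitor is unknown, but three suffice: the optimal tree among all those with at least three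
-- leaves, a path with two leaves added at one end, happens to have a single pendent path of length
-- r whenever 2 ≤ r ≤ n - 3. For k = 2 a tree with three leaves already loses to the path at s = 2.

χ : {Q : Set} → Dec Q → ℕ
χ (yes _) = 1
χ (no _)  = 0

χ-cong : {Q R : Set} (q : Dec Q) (r : Dec R) → (Q → R) → (R → Q) → χ q ≡ χ r
χ-cong (yes _) (yes _) _ _ = refl
χ-cong (yes q) (no ¬r) f _ = contradiction (f q) ¬r
χ-cong (no ¬q) (yes r) _ g = contradiction (g r) ¬q
χ-cong (no _)  (no _)  _ _ = refl

∑-mono : ∀ {n} {f g : Fin n → ℕ} → (∀ i → f i ≤ g i) → ∑[ i < n ] f i ≤ ∑[ i < n ] g i
∑-mono {zero}  f≤g = z≤n
∑-mono {suc n} f≤g = ℕ.+-mono-≤ (f≤g Fin.zero) (∑-mono (f≤g ∘ Fin.suc))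

∑-replicate : ∀ n x → ∑[ i < n ] x ≡ n * x
∑-replicate zero    x = refl
∑-replicate (suc n) x = cong (x +_) (∑-replicate n x)

∑-select : ∀ {n} (v : Fin n) (f : Fin n → ℕ) (dec : ∀ i → Dec (i ≡ v)) →
  ∑[ i < n ] (χ (dec i) * f i) ≡ f v
∑-select {suc n} Fin.zero f dec with dec Fin.zero
... | no 0≢0 = contradiction refl 0≢0
... | yes _  = begin
  1 * f Fin.zero + ∑[ i < n ] (χ (dec (Fin.suc i)) * f (Fin.suc i))
    ≡⟨ cong₂ _+_ (ℕ.*-identityˡ _) (trans (sum-cong-≗ λ i → zeros i) (sum-replicate-zero n)) ⟩
  f Fin.zero + 0 ≡⟨ ℕ.+-identityʳ _ ⟩
  f Fin.zero ∎
  where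
  open ≡-Reasoning
  zeros : ∀ i → χ (dec (Fin.suc i)) * f (Fin.suc i) ≡ 0
  zeros i with dec (Fin.suc i)
  ... | no _ = refl
∑-select {suc n} (Fin.suc v) f dec with dec Fin.zero
... | no _ = trans
  (sum-cong-≗ λ i → cong (_* f (Fin.suc i)) (χ-cong (dec (Fin.suc i)) (i Fin.≟ v) Fin.suc-injective (cong Fin.suc)))
  (∑-select v (f ∘ Fin.suc) (Fin._≟ v))

∑-tight : ∀ {n} {f g : Fin n → ℕ} → (∀ i → f i ≤ g i) → ∑[ i < n ] g i ≤ ∑[ i < n ] f i →
  ∀ i → g i ≤ f i
∑-tight {suc n} {f} {g} f≤g ∑g≤∑f Fin.zero = ℕ.+-cancelʳ-≤ (∑[ i < n ] f (Fin.suc i)) _ _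
  (ℕ.≤-trans (ℕ.+-monoʳ-≤ (g Fin.zero) (∑-mono (f≤g ∘ Fin.suc))) ∑g≤∑f)
∑-tight {suc n} {f} {g} f≤g ∑g≤∑f (Fin.suc i) = ∑-tight (f≤g ∘ Fin.suc)
  (ℕ.+-cancelˡ-≤ (f Fin.zero) _ _ (ℕ.≤-trans (ℕ.+-monoˡ-≤ _ (f≤g Fin.zero)) ∑g≤∑f)) i

count : ∀ {n} {Q : Fin n → Set} → Decidable Q → ℕ
count {n} Q? = ∑[ w < n ] χ (Q? w)

count-cong : ∀ {n} {Q R : Fin n → Set} (Q? : Decidable Q) (R? : Decidable R) →
  (∀ {w} → Q w → R w) → (∀ {w} → R w → Q w) → count Q? ≡ count R?
count-cong Q? R? f g = sum-cong-≗ λ w → χ-cong (Q? w) (R? w) f g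

length-filter-tabulate : ∀ {n} {V : Set} {Q : V → Set} (Q? : Decidable Q) (f : Fin n → V) →
  length (filter Q? (tabulate f)) ≡ ∑[ i < n ] χ (Q? (f i))
length-filter-tabulate {zero}  Q? f = refl
length-filter-tabulate {suc n} Q? f with Q? (f Fin.zero)
... | yes _ = cong suc (length-filter-tabulate Q? (f ∘ Fin.suc))
... | no _  = length-filter-tabulate Q? (f ∘ Fin.suc)

length-filter-allFin : ∀ {n} {Q : Fin n → Set} (Q? : Decidable Q) →
  length (filter Q? (allFin n)) ≡ count Q?
length-filter-allFin Q? = length-filter-tabulate Q? id

sum-filter-allFin : ∀ {n} {V : Set} {Q : V → Set} (Q? : Decidable Q) (h : V → ℕ) (f : Fin n → V) →
  sum (map h (filter Q? (tabulate f))) ≡ ∑[ i < n ] (χ (Q? (f i)) * h (f i))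
sum-filter-allFin {zero}  Q? h f = refl
sum-filter-allFin {suc n} Q? h f with Q? (f Fin.zero)
... | yes _ = cong₂ _+_ (sym (ℕ.+-identityʳ _)) (sum-filter-allFin Q? h (f ∘ Fin.suc))
... | no _  = sum-filter-allFin Q? h (f ∘ Fin.suc)

sum-filter-cartesianProduct : ∀ {m n} {U V : Set} {Q : U × V → Set} (Q? : Decidable Q) (h : U × V → ℕ)
  (f : Fin m → U) (g : Fin n → V) →
  sum (map h (filter Q? (cartesianProduct (tabulate f) (tabulate g)))) ≡
  ∑[ i < m ] ∑[ j < n ] (χ (Q? (f i , g j)) * h (f i , g j))
sum-filter-cartesianProduct {zero}  Q? h f g = refl
sum-filter-cartesianProduct {suc m} {n} Q? h f g = begin
  sum (map h (filter Q? (row ++ rest)))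
    ≡⟨ cong (sum ∘ map h) (List.filter-++ Q? row rest) ⟩
  sum (map h (filter Q? row ++ filter Q? rest))
    ≡⟨ cong sum (List.map-++ h (filter Q? row) (filter Q? rest)) ⟩
  sum (map h (filter Q? row) ++ map h (filter Q? rest))
    ≡⟨ sum-++ (map h (filter Q? row)) (map h (filter Q? rest)) ⟩
  sum (map h (filter Q? row)) + sum (map h (filter Q? rest))
    ≡⟨ cong (λ xs → sum (map h (filter Q? xs)) + sum (map h (filter Q? rest))) (List.map-tabulate g (f Fin.zero ,_)) ⟩
  sum (map h (filter Q? (tabulate λ j → f Fin.zero , g j))) + sum (map h (filter Q? rest))
    ≡⟨ cong₂ _+_ (sum-filter-allFin Q? h (λ j → f Fin.zero , g j)) (sum-filter-cartesianProduct Q? h (f ∘ Fin.suc) g) ⟩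
  ∑[ j < n ] (χ (Q? (f Fin.zero , g j)) * h (f Fin.zero , g j)) +
  ∑[ i < m ] ∑[ j < n ] (χ (Q? (f (Fin.suc i) , g j)) * h (f (Fin.suc i) , g j)) ∎
  where
  open ≡-Reasoning
  row  = map (f Fin.zero ,_) (tabulate g)
  rest = cartesianProduct (tabulate (f ∘ Fin.suc)) (tabulate g)

count-mono : ∀ {n} {Q R : Fin n → Set} (Q? : Decidable Q) (R? : Decidable R) →
  (∀ {w} → Q w → R w) → count Q? ≤ count R?
count-mono Q? R? Q⊆R = ∑-mono λ w → lem (Q? w) (R? w) Q⊆R
  where
  lem : ∀ {Q R : Set} (q : Dec Q) (r : Dec R) → (Q → R) → χ q ≤ χ r
  lem (yes q) (yes r) f = ℕ.≤-refl
  lem (yes q) (no ¬r) f = contradiction (f q) ¬r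
  lem (no _)  r       f = z≤n

count-⊎ : ∀ {n} {Q R : Fin n → Set} (Q? : Decidable Q) (R? : Decidable R) →
  (∀ {w} → Q w → R w → ⊥) → count (λ w → Q? w ⊎-dec R? w) ≡ count Q? + count R?
count-⊎ {n} Q? R? disjoint = trans
  (sum-cong-≗ λ w → lem (Q? w) (R? w) disjoint)
  (∑-distrib-+ (λ w → χ (Q? w)) (λ w → χ (R? w)))
  where
  lem : ∀ {Q R : Set} (q : Dec Q) (r : Dec R) → (Q → R → ⊥) → χ (q ⊎-dec r) ≡ χ q + χ r
  lem (yes q) (yes r) f = ⊥-elim (f q r)
  lem (yes _) (no _)  f = refl
  lem (no _)  (yes _) f = refl
  lem (no _)  (no _)  f = refl

count-¬ : ∀ {n} {Q : Fin n → Set} (Q? : Decidable Q) → count Q? + count (λ w → ¬? (Q? w)) ≡ n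
count-¬ {n} Q? = begin
  count Q? + count (λ w → ¬? (Q? w)) ≡⟨ ∑-distrib-+ (λ w → χ (Q? w)) (λ w → χ (¬? (Q? w))) ⟨
  ∑[ w < n ] (χ (Q? w) + χ (¬? (Q? w))) ≡⟨ sum-cong-≗ (λ w → lem (Q? w)) ⟩
  ∑[ w < n ] 1                       ≡⟨ ∑-replicate n 1 ⟩
  n * 1                              ≡⟨ ℕ.*-identityʳ n ⟩
  n ∎
  where
  open ≡-Reasoning
  lem : ∀ {Q : Set} (q : Dec Q) → χ q + χ (¬? q) ≡ 1
  lem (yes _) = refl
  lem (no _)  = refl

lookup-injective : ∀ {V : Set} {xs : List V} → UniqueList xs → ∀ {i j} →
  List.lookup xs i ≡ List.lookup xs j → i ≡ j
lookup-injective (x≢ ∷ _) {Fin.zero}  {Fin.zero}  _ = refl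
lookup-injective (x≢ ∷ _) {Fin.zero}  {Fin.suc j} e = contradiction e (All.lookup x≢ (∈-lookup j))
lookup-injective (x≢ ∷ _) {Fin.suc i} {Fin.zero}  e = contradiction (sym e) (All.lookup x≢ (∈-lookup i))
lookup-injective (_ ∷ u)  {Fin.suc i} {Fin.suc j} e = cong Fin.suc (lookup-injective u e)

unique-⊆-length : ∀ {V : Set} {xs ys : List V} → UniqueList xs → (∀ {x} → x ∈ xs → x ∈ ys) →
  length xs ≤ length ys
unique-⊆-length {xs = xs} {ys} xs! xs⊆ys = Fin.injective⇒≤ {f = f} λ {i} {j} fi≡fj →
  lookup-injective xs! (trans (position i) (trans (cong (List.lookup ys) fi≡fj) (sym (position j))))
  where
  f : Fin (length xs) → Fin (length ys)
  f i = Any.index (xs⊆ys (∈-lookup i))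
  position : ∀ i → List.lookup xs i ≡ List.lookup ys (f i)
  position i = Any.lookup-index (xs⊆ys (∈-lookup i))

module _ {n} {Q : Fin n → Set} (Q? : Decidable Q) where

  ∈-filter-allFin : ∀ {w} → Q w → w ∈ filter Q? (allFin n)
  ∈-filter-allFin = ∈-filter⁺ Q? (∈-allFin _)

  length≤count : ∀ {xs} → UniqueList xs → (∀ {x} → x ∈ xs → Q x) → length xs ≤ count Q?
  length≤count xs! xs⊆Q = ℕ.≤-trans (unique-⊆-length xs! (∈-filter-allFin ∘ xs⊆Q))
    (ℕ.≤-reflexive (length-filter-allFin Q?))

  count≤length : ∀ {xs} → (∀ {w} → Q w → w ∈ xs) → count Q? ≤ length xs
  count≤length Q⊆xs = ℕ.≤-trans (ℕ.≤-reflexive (sym (length-filter-allFin Q?)))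
    (unique-⊆-length (Unique.filter⁺ Q? (Unique.allFin⁺ n)) (Q⊆xs ∘ proj₂ ∘ ∈-filter⁻ Q? {xs = allFin n}))

  count≡length : ∀ {xs} → UniqueList xs → (∀ {x} → x ∈ xs → Q x) → (∀ {w} → Q w → w ∈ xs) →
    count Q? ≡ length xs
  count≡length xs! xs⊆Q Q⊆xs = ℕ.≤-antisym (count≤length Q⊆xs) (length≤count xs! xs⊆Q)

count-≡ : ∀ {n} (v : Fin n) → count (Fin._≟ v) ≡ 1
count-≡ v = count≡length (Fin._≟ v) ([] ∷ []) (λ where (here refl) → refl) here

unique-map : ∀ {U V : Set} {f : U → V} {xs : List U} →
  (∀ {x y} → x ∈ xs → y ∈ xs → f x ≡ f y → x ≡ y) → UniqueList xs → UniqueList (map f xs)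
unique-map inj []         = []
unique-map inj (x≢ ∷ xs!) =
  All.map⁺ (All.tabulate λ y∈ e → All.lookup x≢ y∈ (inj (here refl) (there y∈) e)) ∷
  unique-map (λ x∈ y∈ → inj (there x∈) (there y∈)) xs!

-- Linear arithmetic: the hypotheses are added up to a ≤ b, and the ring solver verifies the balance.
by≤ : ∀ {a b x y} c → a ≤ b → x + b + c ≡ y + a → x ≤ y
by≤ {a} {b} {x} {y} c a≤b e = ℕ.+-cancelʳ-≤ b x y (begin
  x + b     ≤⟨ ℕ.m≤m+n _ c ⟩
  x + b + c ≡⟨ e ⟩
  y + a     ≤⟨ ℕ.+-monoʳ-≤ y a≤b ⟩
  y + b     ∎)
  where open ℕ.≤-Reasoning

abstract
  argmin : ∀ {n} {Q : Fin n → Set} → Decidable Q → (f : Fin n → ℕ) → ∃ Q →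
    ∃ λ v → Q v × (∀ w → Q w → f v ≤ f w)
  argmin {n} {Q} Q? f (v , q) = go v q (<-wellFounded (f v))
    where
    go : ∀ v → Q v → Acc _<_ (f v) → ∃ λ v → Q v × (∀ w → Q w → f v ≤ f w)
    go v q (acc rs) with Fin.any? (λ w → Q? w ×-dec (f w <? f v))
    ... | yes (w , qw , lt) = go w qw (rs lt)
    ... | no none           = v , q , λ w qw → ℕ.≮⇒≥ λ lt → none (w , qw , lt)

∑-term : ∀ {n} (f : Fin n → ℕ) v → f v ≤ ∑[ i < n ] f i
∑-term f Fin.zero    = ℕ.m≤m+n _ _
∑-term f (Fin.suc v) = ℕ.≤-trans (∑-term (f ∘ Fin.suc) v) (ℕ.m≤n+m _ _)

abstract
  argmax : ∀ {n} {Q : Fin n → Set} → Decidable Q → (f : Fin n → ℕ) → ∃ Q →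
    ∃ λ v → Q v × (∀ w → Q w → f w ≤ f v)
  -- The total bounds every value of `f`, so the truncated difference strictly reverses the order.
  argmax {n} Q? f q with argmin Q? (λ v → Σᶠ f ∸ f v) q
  ... | v , qv , min = v , qv , λ w qw → ℕ.≮⇒≥ λ lt → ℕ.<⇒≱ (ℕ.∸-monoʳ-< lt (∑-term f w)) (min w qw)

-- Distances and cuts

least-≤ : ∀ {Q : ℕ → Set} (Q? : Decidable Q) b {i} → Q i → least Q? b ≤ i
least-≤ Q? zero    q = z≤n
least-≤ Q? (suc b) q with Q? zero
... | yes _ = z≤n
least-≤ Q? (suc b) {zero}  q | no ¬q = contradiction q ¬q
least-≤ Q? (suc b) {suc i} q | no _  = s≤s (least-≤ (λ i → Q? (suc i)) b q)

least-holds : ∀ {Q : ℕ → Set} (Q? : Decidable Q) b {i} → i < b → Q i → Q (least Q? b)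
least-holds Q? (suc b) lt q with Q? zero
... | yes q₀ = q₀
least-holds Q? (suc b) {zero}  lt       q | no ¬q = contradiction q ¬q
least-holds Q? (suc b) {suc i} (s≤s lt) q | no _  = least-holds (λ i → Q? (suc i)) b lt q

module Walks {n : ℕ} (G : Graph (Fin n)) where
  open Graph G

  -- Walks confined to `W`. Confinement is what produces cycles: a walk that avoids `x` between two
  -- distinct neighbours of `x` closes up through `x`.
  data Joined (W : Fin n → Set) : Fin n → Fin n → Set where
    stop : ∀ {u} → W u → Joined W u u
    go   : ∀ {u w v} → u ~ w → W u → Joined W w v → Joined W u v

  module _ {W : Fin n → Set} where

    joined-trans : ∀ {u v w} → Joined W u v → Joined W v w → Joined W u w
    joined-trans (stop _)    k = k
    joined-trans (go e wu j) k = go e wu (joined-trans j k)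

    joined-start : ∀ {u v} → Joined W u v → W u
    joined-start (stop wu)   = wu
    joined-start (go _ wu _) = wu

    joined-sym : ∀ {u v} → Joined W u v → Joined W v u
    joined-sym (stop wu)   = stop wu
    joined-sym (go e wu j) =
      joined-trans (joined-sym j) (go (~-sym e) (joined-start j) (stop wu))

  walk⇒joined : ∀ ℓ {u v} → Walk G ℓ u v → Joined (λ _ → ⊤) u v
  walk⇒joined zero    refl        = stop tt
  walk⇒joined (suc ℓ) (w , e , k) = go e tt (walk⇒joined ℓ k)

  walk-trans : ∀ k ℓ {u v w} → Walk G k u v → Walk G ℓ v w → Walk G (k + ℓ) u w
  walk-trans zero    ℓ refl        q = q
  walk-trans (suc k) ℓ (x , e , p) q = x , e , walk-trans k ℓ p q

  data SimplePath (W : Fin n → Set) : Fin n → Fin n → ∀ {r} → Vec (Fin n) (suc r) → Set where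
    stop : ∀ {u} → W u → SimplePath W u u (u ∷ [])
    go   : ∀ {u w v r} {p : Vec (Fin n) (suc r)} → u ~ w → W u → VecAll.All (u ≢_) p →
           SimplePath W w v p → SimplePath W u v (u ∷ p)

  module _ {W : Fin n → Set} where

    -- Loop erasure: when `u` is already on the path, everything before that occurrence is dropped.
    suffix : ∀ u {w v r} {p : Vec (Fin n) (suc r)} → SimplePath W w v p →
      (∃ λ s → ∃ λ (q : Vec (Fin n) (suc s)) → SimplePath W u v q) ⊎ VecAll.All (u ≢_) p
    suffix u {w} s with u Fin.≟ w
    suffix u s | yes refl = inj₁ (_ , _ , s)
    suffix u (stop _)       | no u≢w = inj₂ (u≢w ∷ [])
    suffix u (go e ww fr s) | no u≢w = Sum.map₂ (u≢w ∷_) (suffix u s)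

    joined⇒simplePath : ∀ {u v} → Joined W u v → ∃ λ r → ∃ λ (p : Vec (Fin n) (suc r)) → SimplePath W u v p
    joined⇒simplePath (stop wu) = _ , _ , stop wu
    joined⇒simplePath {u} (go e wu j) with joined⇒simplePath j
    ... | _ , p , s with suffix u s
    ...   | inj₁ t     = t
    ...   | inj₂ fresh = _ , _ , go e wu fresh s

    simplePath-unique : ∀ {u v r} {p : Vec (Fin n) (suc r)} → SimplePath W u v p → UniqueVec p
    simplePath-unique (stop _)      = [] ∷ []
    simplePath-unique (go _ _ fr s) = fr ∷ simplePath-unique s

    simplePath-all : ∀ {u v r} {p : Vec (Fin n) (suc r)} → SimplePath W u v p → VecAll.All W p
    simplePath-all (stop wu)     = wu ∷ []
    simplePath-all (go _ wu _ s) = wu ∷ simplePath-all s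

    simplePath-head : ∀ {u v r} {p : Vec (Fin n) (suc r)} → SimplePath W u v p → head p ≡ u
    simplePath-head (stop _)     = refl
    simplePath-head (go _ _ _ _) = refl

    simplePath-last : ∀ {u v r} {p : Vec (Fin n) (suc r)} → SimplePath W u v p → Vec.last p ≡ v
    simplePath-last (stop _)     = refl
    simplePath-last (go _ _ _ s) = simplePath-last s

    simplePath-adjacent : ∀ {u v r} {p : Vec (Fin n) (suc r)} → SimplePath W u v p →
      ∀ i → lookup p (inject₁ i) ~ lookup p (Fin.suc i)
    simplePath-adjacent {u} (go {p = _ ∷ _} e _ _ s) Fin.zero    = subst (u ~_) (sym (simplePath-head s)) e
    simplePath-adjacent     (go {p = _ ∷ _} _ _ _ s) (Fin.suc i) = simplePath-adjacent s i

    simplePath-walk : ∀ {u v r} {p : Vec (Fin n) (suc r)} → SimplePath W u v p → Walk G r u v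
    simplePath-walk (stop _)     = refl
    simplePath-walk (go e _ _ s) = _ , e , simplePath-walk s

    -- `dist` searches only lengths below `n`; the pigeonhole principle guarantees that a loop-free
    -- walk is found there.
    simplePath-short : ∀ {u v r} {p : Vec (Fin n) (suc r)} → SimplePath W u v p → r < n
    simplePath-short s = Fin.injective⇒≤ λ {i} {j} → UniqueVec.lookup-injective (simplePath-unique s) i j

  cycle : ∀ {x y z r} {p : Vec (Fin n) (suc r)} → x ~ y → z ~ x → y ≢ z →
    SimplePath (x ≢_) y z p → IsCycle G (x ∷ p)
  cycle {x} {r = r} {p} x~y z~x y≢z s = record
    { isPath = record
      { distinct = simplePath-all s ∷ simplePath-unique s
      ; adjacent = λ where
          Fin.zero    → subst (x ~_) (sym (trans (lookup-zero p) (simplePath-head s))) x~y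
          (Fin.suc i) → simplePath-adjacent s i
      }
    ; long   = long s
    ; closed = subst (_~ x) (sym (simplePath-last s)) z~x
    }
    where
    lookup-zero : ∀ {r} (p : Vec (Fin n) (suc r)) → lookup p Fin.zero ≡ head p
    lookup-zero (_ ∷ _) = refl
    long : ∀ {r} {p : Vec (Fin n) (suc r)} → SimplePath (x ≢_) _ _ p → 2 ≤ suc r
    long (stop _)             = contradiction refl y≢z
    long (go {p = _ ∷ _} _ _ _ _) = s≤s (s≤s z≤n)

  dist-≤ : ∀ {u v ℓ} → Walk G ℓ u v → dist G u v ≤ ℓ
  dist-≤ {u} {v} = least-≤ (walk? G u v) n

  module _ (connected : Connected G) where

    shortest : ∀ u v → Walk G (dist G u v) u v
    shortest u v with joined⇒simplePath (walk⇒joined _ (proj₂ (connected u v)))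
    ... | _ , _ , s = least-holds (walk? G u v) n (simplePath-short s) (simplePath-walk s)

    dist-~ : ∀ {u v} w → u ~ v → dist G u w ≤ suc (dist G v w)
    dist-~ w e = dist-≤ (_ , e , shortest _ w)

    dist≡0 : ∀ {u v} → dist G u v ≡ 0 → u ≡ v
    dist≡0 {u} {v} e = subst (λ ℓ → Walk G ℓ u v) e (shortest u v)

    -- If ab is the only edge leaving C, every walk from C to b has to visit a first.
    module Cut {C : Fin n → Set} (C? : Decidable C) {a b : Fin n} (a∈C : C a) (b∉C : ¬ C b)
      (bridge : ∀ {x y} → x ~ y → C x → ¬ C y → x ≡ a) where

      detour : ∀ ℓ {w} → C w → Walk G ℓ w b → ∃ λ ℓ′ → ℓ′ < ℓ × Walk G ℓ′ w a
      detour zero    w∈C refl        = contradiction w∈C b∉C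
      detour (suc ℓ) w∈C (x , e , k) with C? x
      ... | no x∉C  = 0 , z<s , bridge e w∈C x∉C
      ... | yes x∈C with detour ℓ x∈C k
      ...   | ℓ′ , lt , k′ = suc ℓ′ , s<s lt , x , e , k′

      inside-closer : ∀ {w} → C w → dist G w a < dist G w b
      inside-closer {w} w∈C with detour _ w∈C (shortest w b)
      ... | ℓ′ , lt , k = ℕ.≤-<-trans (dist-≤ k) lt

    module _ {C : Fin n → Set} (C? : Decidable C) {a b : Fin n} (a∈C : C a) (b∉C : ¬ C b)
      (bridge : ∀ {x y} → x ~ y → C x → ¬ C y → x ≡ a × y ≡ b) where

      private
        stable : ∀ {x} → ¬ ¬ C x → C x
        stable {x} ¬¬c with C? x
        ... | yes c = c
        ... | no ¬c = contradiction ¬c ¬¬c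

        module Inside  = Cut C? a∈C b∉C (λ e x∈ y∉ → proj₁ (bridge e x∈ y∉))
        -- The complement of `C` is cut off by the same edge traversed backwards; `stable` recovers
        -- membership in `C` from not lying in the complement.
        module Outside = Cut (λ w → ¬? (C? w)) b∉C (λ ¬a → ¬a a∈C)
          (λ e x∉ y∈ → proj₂ (bridge (~-sym e) (stable y∈) x∉))

      -- Every vertex is on one side of the bridge and strictly closer to the end on that side.
      -- Hence there are no ties, and comparing distances is the same as testing membership.
      closer-inside : closer G a b ≡ count C?
      closer-inside = trans (length-filter-allFin (λ w → dist G w a <? dist G w b))
        (sum-cong-≗ λ w → χ-cong _ (C? w)
          (λ lt → stable λ ¬c → ℕ.<-asym lt (Outside.inside-closer ¬c)) Inside.inside-closer)

      closer-outside : closer G b a ≡ count (λ w → ¬? (C? w))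
      closer-outside = trans (length-filter-allFin (λ w → dist G w b <? dist G w a))
        (sum-cong-≗ λ w → χ-cong _ (¬? (C? w))
          (λ lt c → ℕ.<-asym lt (Inside.inside-closer c)) Outside.inside-closer)

-- Rooted trees and the Mostar index

-- A tree in a form that allows induction: `depth` makes climbing along `par` stop at the root, and
-- `~-par` says that every edge joins a vertex to its parent. `par` is constrained only off the
-- root, hence the guards `v ≢ root`. The vertex type is arbitrary, so that `A`, with its sum type
-- of vertices, can be rooted before it is numbered.
record Rooted {V : Set} (G : Graph V) : Set where
  open Graph G
  field
    root       : V
    par        : V → V
    depth      : V → ℕ
    depth-root : depth root ≡ 0
    depth-par  : ∀ {v} → v ≢ root → depth v ≡ suc (depth (par v))
    par-~      : ∀ {v} → v ≢ root → v ~ par v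
    ~-par      : ∀ {u v} → u ~ v → (u ≢ root × par u ≡ v) ⊎ (v ≢ root × par v ≡ u)

  anc : ℕ → V → V
  anc zero    v = v
  anc (suc i) v = par (anc i v)

  infix 4 _≼_

  -- `w ≼ v` means that `w` is a descendant of `v`, so the vertices `≼ v` form the side of the edge
  -- from `v` to `par v` that does not contain the root.
  data _≼_ (w : V) : V → Set

  data _≼_ w where
    here : w ≼ w
    up   : ∀ {v} → w ≢ root → par w ≼ v → w ≼ v

  anc-par : ∀ i v → anc i (par v) ≡ par (anc i v)
  anc-par zero    v = refl
  anc-par (suc i) v = cong par (anc-par i v)

  depth≡0 : ∀ {v} → depth v ≡ 0 → ¬ v ≢ root
  depth≡0 e v≢root = ℕ.1+n≢0 (trans (sym (depth-par v≢root)) e)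

  depth>0 : ∀ {v} → 0 < depth v → v ≢ root
  depth>0 lt refl = ℕ.n≮0 (subst (0 <_) depth-root lt)

  par-≢ : ∀ {v} → v ≢ root → par v ≢ v
  par-≢ v≢root e = ℕ.1+n≢n (trans (sym (depth-par v≢root)) (cong depth (sym e)))

  ≼-depth : ∀ {w v} → w ≼ v → depth v ≤ depth w
  ≼-depth here        = ℕ.≤-refl
  ≼-depth (up w≢ par≼) = ℕ.≤-trans (≼-depth par≼) (ℕ.≤-trans (ℕ.n≤1+n _) (ℕ.≤-reflexive (sym (depth-par w≢))))

  ≼-depth-≡ : ∀ {w v} → w ≼ v → depth w ≤ depth v → w ≡ v
  ≼-depth-≡ here         _  = refl
  ≼-depth-≡ (up w≢ par≼) le = ⊥-elim (ℕ.<-irrefl refl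
    (ℕ.<-≤-trans (ℕ.≤-<-trans (≼-depth par≼) (ℕ.≤-reflexive (sym (depth-par w≢)))) le))

  ≼-antisym : ∀ {w v} → w ≼ v → v ≼ w → w ≡ v
  ≼-antisym w≼v v≼w = ≼-depth-≡ w≼v (≼-depth v≼w)

  ≼-trans : ∀ {u v w} → u ≼ v → v ≼ w → u ≼ w
  ≼-trans here       v≼w = v≼w
  ≼-trans (up u≢ p) v≼w = up u≢ (≼-trans p v≼w)

  ≼-par : ∀ {v} → v ≢ root → v ≼ par v
  ≼-par v≢ = up v≢ here

  par-⋠ : ∀ {v} → v ≢ root → ¬ par v ≼ v
  par-⋠ v≢ p = par-≢ v≢ (≼-antisym p (≼-par v≢))

  -- Climbing is deterministic, so the ancestors of `w` lie on one ascending line. Consequently two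
  -- sets of descendants are nested or disjoint, which the packing arguments below rely on.
  ≼-linear : ∀ {w u v} → w ≼ u → w ≼ v → u ≼ v ⊎ v ≼ u
  ≼-linear here        w≼v       = inj₁ w≼v
  ≼-linear w≼u@(up _ _) here     = inj₂ w≼u
  ≼-linear (up _ p)    (up _ q) = ≼-linear p q

  ≼-anc : ∀ {w v} → w ≼ v → ∃ λ i → i + depth v ≡ depth w × anc i w ≡ v
  ≼-anc here = 0 , refl , refl
  ≼-anc {w} (up w≢ p) with ≼-anc p
  ... | i , e , f = suc i , trans (cong suc e) (sym (depth-par w≢)) , trans (sym (anc-par i w)) f

  ≼-child : ∀ {w v} → w ≼ v → w ≡ v ⊎ ∃ λ c → c ≢ root × par c ≡ v × w ≼ c
  ≼-child here = inj₁ refl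
  ≼-child {w} (up w≢ p) with ≼-child p
  ... | inj₁ e                    = inj₂ (w , w≢ , e , here)
  ... | inj₂ (c , c≢ , e , w≼c) = inj₂ (c , c≢ , e , up w≢ w≼c)

  anc-depth : ∀ i {v} → i ≤ depth v → i + depth (anc i v) ≡ depth v
  anc-depth zero    le = refl
  anc-depth (suc i) {v} le = trans (sym (ℕ.+-suc i _)) (trans
    (cong (i +_) (sym (depth-par (depth>0 (ℕ.n≢0⇒n>0 λ e → ℕ.<-irrefl
      (trans (sym (cong (i +_) e)) (anc-depth i (ℕ.<⇒≤ le))) (subst (_< depth v) (sym (ℕ.+-identityʳ i)) le))))))
    (anc-depth i (ℕ.<⇒≤ le)))

  anc-≢root : ∀ i {v} → i < depth v → anc i v ≢ root
  anc-≢root i {v} lt e = ℕ.<-irrefl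
    (trans (sym (ℕ.+-identityʳ i)) (trans (cong (i +_) (sym (trans (cong depth e) depth-root))) (anc-depth i (ℕ.<⇒≤ lt)))) lt

  ≼anc : ∀ i {v} → i ≤ depth v → v ≼ anc i v
  ≼anc zero    le = here
  ≼anc (suc i) le = ≼-trans (≼anc i (ℕ.<⇒≤ le)) (≼-par (anc-≢root i le))

-- Rooting a tree by the distance to a chosen vertex

module _ {n} {G : Graph (Fin n)} (t : IsTree G) (ρ : Fin n) where
  open Graph G
  open IsTree t
  open Walks G

  private
    d : Fin n → ℕ
    d v = dist G v ρ

    d-root : d ρ ≡ 0
    d-root = ℕ.n≤0⇒n≡0 (dist-≤ {ρ} {ρ} {0} refl)

    next : ∀ ℓ {v} → v ≢ ρ → Walk G ℓ v ρ → ∃ λ w → v ~ w × Walk G (pred ℓ) w ρ × ℓ ≡ suc (pred ℓ)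
    next zero    v≢ρ e           = contradiction e v≢ρ
    next (suc ℓ) v≢ρ (w , e , k) = w , e , k , refl

    step : ∀ {v} → v ≢ ρ → ∃ λ w → v ~ w × d v ≡ suc (d w)
    step {v} v≢ρ with next _ v≢ρ (shortest connected v ρ)
    ... | w , e , k , eq = w , e , ℕ.≤-antisym (dist-~ connected ρ e)
      (ℕ.≤-trans (s≤s (dist-≤ k)) (ℕ.≤-reflexive (sym eq)))

    abstract
      parent : Fin n → Fin n
      parent v with v Fin.≟ ρ
      ... | yes _  = ρ
      ... | no v≢ρ = proj₁ (step v≢ρ)

      parent-spec : ∀ {v} → v ≢ ρ → v ~ parent v × d v ≡ suc (d (parent v))
      parent-spec {v} v≢ρ with v Fin.≟ ρ
      ... | yes e  = contradiction e v≢ρ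
      ... | no v≢ρ = proj₂ (step v≢ρ)

    -- Meeting `u` after at least one step would leave a walk from `u` to `ρ` of fewer than `d u`
    -- steps.
    avoid : ∀ ℓ {u v} → Walk G ℓ v ρ → ℓ ≤ d u → u ≢ v → Joined (u ≢_) v ρ
    avoid zero    refl        le u≢v = stop u≢v
    avoid (suc ℓ) (w , e , k) le u≢v = go e u≢v (avoid ℓ k (ℕ.<⇒≤ le)
      λ where refl → ℕ.<-irrefl refl (ℕ.<-≤-trans (s≤s (dist-≤ k)) le))

    -- Otherwise v and parent u are both joined to ρ without passing u, which closes a cycle through u.
    parent-unique : ∀ {u v} → u ~ v → u ≢ ρ → d v ≤ d u → parent u ≡ v
    parent-unique {u} {v} u~v u≢ρ dv≤du with parent u Fin.≟ v | parent-spec u≢ρ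
    ... | yes e   | _ = e
    ... | no par≢v | u~par , du≡ = ⊥-elim (acyclic _ (cycle u~par (~-sym u~v) par≢v
      (proj₂ (proj₂ (joined⇒simplePath (joined-trans
        (avoid _ (shortest connected (parent u) ρ) (ℕ.≤-trans (ℕ.n≤1+n _) (ℕ.≤-reflexive (sym du≡)))
          (λ e → ~-irrefl (subst (u ~_) (sym e) u~par)))
        (joined-sym (avoid _ (shortest connected v ρ) dv≤du λ e → ~-irrefl (subst (u ~_) (sym e) u~v)))))))))

    toward : ∀ {u v} → u ~ v → d v ≤ d u → u ≢ ρ × parent u ≡ v
    toward {u} {v} u~v le = u≢ρ , parent-unique u~v u≢ρ le
      where
      u≢ρ : u ≢ ρ
      u≢ρ refl = ~-irrefl (subst (u ~_) (dist≡0 connected (ℕ.n≤0⇒n≡0 (subst (d v ≤_) d-root le))) u~v)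

  -- Depth is the distance to `ρ`. A shortest walk provides a neighbour one step nearer, and
  -- acyclicity makes it the only neighbour that is not farther from `ρ`.
  rootAt : Rooted G
  rootAt = record
    { root       = ρ
    ; par        = parent
    ; depth      = d
    ; depth-root = d-root
    ; depth-par  = proj₂ ∘ parent-spec
    ; par-~      = proj₁ ∘ parent-spec
    ; ~-par      = λ {u} {v} u~v → Sum.map (toward u~v) (toward (~-sym u~v)) (ℕ.≤-total (d v) (d u))
    }

module RootedFin {n} {G : Graph (Fin n)} (R : Rooted G) where
  open Graph G
  open Rooted R public

  infix 4 _≼?_

  _≼?_ : ∀ w v → Dec (w ≼ v)
  w ≼? v = go (depth w) w refl
    where
    go : ∀ d w → depth w ≡ d → Dec (w ≼ v)
    go d w e with w Fin.≟ v
    ... | yes refl = yes here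
    ... | no w≢v with w Fin.≟ root
    ...   | yes w≡root = no λ where
      here     → w≢v refl
      (up p _) → p w≡root
    go zero    w e | no w≢v | no w≢root = contradiction w≢root (depth≡0 e)
    go (suc d) w e | no w≢v | no w≢root =
      map′ (up w≢root) (λ where here → contradiction refl w≢v
                                (up _ p) → p)
        (go d (par w) (ℕ.suc-injective (trans (sym (depth-par w≢root)) e)))

  depth≡0⇒root : ∀ {v} → depth v ≡ 0 → v ≡ root
  depth≡0⇒root {v} e with v Fin.≟ root
  ... | yes v≡root = v≡root
  ... | no v≢root  = contradiction v≢root (depth≡0 e)

  ≼-root : ∀ w → w ≼ root
  ≼-root w = go (depth w) refl
    where
    go : ∀ d {w} → depth w ≡ d → w ≼ root
    go zero    e = subst (_≼ root) (sym (depth≡0⇒root e)) here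
    go (suc d) {w} e = up w≢ (go d (ℕ.suc-injective (trans (sym (depth-par w≢)) e)))
      where
      w≢ : w ≢ root
      w≢ = depth>0 (subst (0 <_) (sym e) z<s)

  size cosize : Fin n → ℕ
  size v   = count (_≼? v)
  cosize v = count (λ w → ¬? (w ≼? v))

  size+cosize : ∀ v → size v + cosize v ≡ n
  size+cosize v = count-¬ (_≼? v)

  size-strict : ∀ {w v} → w ≼ v → w ≢ v → size w < size v
  size-strict {w} {v} w≼v w≢v = ℕ.≤-trans (ℕ.≤-reflexive (sym (trans
    (count-⊎ (Fin._≟ v) (_≼? w) λ where refl v≼w → w≢v (≼-antisym w≼v v≼w))
    (cong (_+ size w) (count-≡ v)))))
    (count-mono (λ u → (u Fin.≟ v) ⊎-dec (u ≼? w)) (_≼? v) [ (λ where refl → here) , (λ u≼w → ≼-trans u≼w w≼v) ])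

  to-root : ∀ w → ∃ λ ℓ → Walk G ℓ w root
  to-root w = go (≼-root w)
    where
    go : ∀ {w v} → w ≼ v → ∃ λ ℓ → Walk G ℓ w v
    go here       = 0 , refl
    go (up w≢ p) with go p
    ... | ℓ , k = suc ℓ , _ , par-~ w≢ , k

  from-root : ∀ w → ∃ λ ℓ → Walk G ℓ root w
  from-root w = go (≼-root w)
    where
    go : ∀ {w v} → w ≼ v → ∃ λ ℓ → Walk G ℓ v w
    go here       = 0 , refl
    go (up w≢ p) with go p
    ... | ℓ , k = ℓ + 1 , Walks.walk-trans G ℓ 1 k (_ , ~-sym (par-~ w≢) , refl)

  rooted-connected : Connected G
  rooted-connected u v with to-root u | from-root v
  ... | k , p | ℓ , q = k + ℓ , Walks.walk-trans G k ℓ p q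

  private
    lookup-last : ∀ {r} (p : Vec (Fin n) (suc r)) → lookup p (Fin.fromℕ r) ≡ Vec.last p
    lookup-last (_ ∷ [])     = refl
    lookup-last (_ ∷ y ∷ ys) = lookup-last (y ∷ ys)

    lookup-head : ∀ {r} (p : Vec (Fin n) (suc r)) → lookup p Fin.zero ≡ head p
    lookup-head (_ ∷ _) = refl

  -- In a cycle, both neighbours of a deepest vertex would be its parent.
  rooted-acyclic : ∀ {r} (p : Vec (Fin n) (suc r)) → ¬ IsCycle G p
  rooted-acyclic {r} p c = case argmax {Q = λ _ → ⊤} (λ _ → yes tt) (depth ∘ lookup p) (Fin.zero , tt) of
    λ (i , _ , max) → neighbours i λ a b a≢b p~a p~b →
      a≢b (UniqueVec.lookup-injective distinct a b
        (trans (sym (parent≡ (max a tt) p~a)) (parent≡ (max b tt) p~b)))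
    where
    open IsCycle c
    open IsPath isPath

    parent≡ : ∀ {u v} → depth v ≤ depth u → u ~ v → par u ≡ v
    parent≡ le e with ~-par e
    ... | inj₁ (_ , eq)     = eq
    ... | inj₂ (v≢ , refl) = contradiction (ℕ.≤-trans (ℕ.≤-reflexive (sym (depth-par v≢))) le) (ℕ.<-irrefl refl)

    wrap : lookup p (Fin.fromℕ r) ~ lookup p Fin.zero
    wrap = subst₂ _~_ (sym (lookup-last p)) (sym (lookup-head p)) closed

    next : ∀ i → toℕ i < r → ∃ λ b → toℕ b ≡ suc (toℕ i) × lookup p i ~ lookup p b
    next i lt = Fin.suc (fromℕ< lt) , cong suc (Fin.toℕ-fromℕ< lt) ,
      subst (λ j → lookup p j ~ lookup p (Fin.suc (fromℕ< lt))) (Fin.toℕ-injective (trans (Fin.toℕ-inject₁ _) (Fin.toℕ-fromℕ< lt))) (adjacent (fromℕ< lt))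

    -- The two cyclic neighbours of a position. At either end one of them is reached through the
    -- closing edge, and `long` keeps the two apart.
    neighbours : ∀ i → (∀ a b → a ≢ b → lookup p i ~ lookup p a → lookup p i ~ lookup p b → ⊥) → ⊥
    neighbours Fin.zero k with next Fin.zero (ℕ.<⇒≤ long)
    ... | b , b≡ , e = k (Fin.fromℕ r) b
      (λ r≡b → ℕ.<-irrefl (trans (sym b≡) (trans (sym (cong toℕ r≡b)) (Fin.toℕ-fromℕ r))) long)
      (~-sym wrap) e
    neighbours (Fin.suc j) k with suc (toℕ j) <? r
    ... | yes lt with next (Fin.suc j) lt
    ...   | b , b≡ , e = k (inject₁ j) b
      (λ j≡b → ℕ.<-irrefl (trans (sym (Fin.toℕ-inject₁ j)) (trans (cong toℕ j≡b) b≡)) (s≤s (ℕ.n≤1+n _)))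
      (~-sym (adjacent j)) e
    neighbours (Fin.suc j) k | no ≥r = k (inject₁ j) Fin.zero
      (λ j≡0 → ≥r (ℕ.≤-trans (s≤s (s≤s (ℕ.≤-reflexive (trans (sym (Fin.toℕ-inject₁ j)) (cong toℕ j≡0))))) long))
      (~-sym (adjacent j))
      (subst (λ i → lookup p i ~ lookup p Fin.zero)
        (Fin.toℕ-injective (trans (Fin.toℕ-fromℕ r) (ℕ.≤-antisym (ℕ.≮⇒≥ ≥r) (Fin.toℕ<n j)))) wrap)

  rooted-tree : IsTree G
  rooted-tree = record { connected = rooted-connected ; acyclic = rooted-acyclic }

  module _ {v} (v≢root : v ≢ root) where

    private
      bridge : ∀ {x y} → x ~ y → x ≼ v → ¬ y ≼ v → x ≡ v × y ≡ par v
      bridge e x≼v y⋠v with ~-par e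
      bridge e here       y⋠v | inj₁ (_ , refl)  = refl , refl
      bridge e (up _ p)   y⋠v | inj₁ (_ , refl)  = contradiction p y⋠v
      bridge e x≼v        y⋠v | inj₂ (y≢ , refl) = contradiction (up y≢ x≼v) y⋠v

    closer-par : closer G v (par v) ≡ size v
    closer-par = Walks.closer-inside G rooted-connected (_≼? v) here (par-⋠ v≢root) bridge

    par-closer : closer G (par v) v ≡ cosize v
    par-closer = Walks.closer-outside G rooted-connected (_≼? v) here (par-⋠ v≢root) bridge

  nonroot? : ∀ v → Dec (v ≢ root)
  nonroot? v = ¬? (v Fin.≟ root)

  private
    h : Fin n → Fin n → ℕ
    h u v = ∣ closer G u v - closer G v u ∣

    h-sym : ∀ u v → h u v ≡ h v u
    h-sym u v = ℕ.∣-∣-comm (closer G u v) (closer G v u)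

    parent-edge? : ∀ u v → Dec (u ≢ root × v ≡ par u)
    parent-edge? u v = nonroot? u ×-dec (v Fin.≟ par u)

    ordered : Fin n → Fin n → ℕ
    ordered u v = χ (u Fin.<? v)

    -- An edge is listed at its smaller endpoint; it belongs to whichever endpoint is the child.
    split : ∀ u v → χ ((u Fin.<? v) ×-dec (u ~? v)) ≡
      ordered u v * χ (parent-edge? u v) + ordered u v * χ (parent-edge? v u)
    split u v = lem {u Fin.< v} {u ~ v} {u ≢ root × v ≡ par u} {v ≢ root × u ≡ par v} (u Fin.<? v) (u ~? v) (parent-edge? u v) (parent-edge? v u)
      (λ e → Sum.map (λ (p , q) → p , sym q) (λ (p , q) → p , sym q) (~-par e))
      (λ where (u≢ , refl) → par-~ u≢)
      (λ where (v≢ , refl) → ~-sym (par-~ v≢))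
      (λ where (u≢ , e) (v≢ , e′) → par-⋠ u≢ (subst (_≼ u) e (subst (v ≼_) (sym e′) (≼-par v≢))))
      where
      lem : ∀ {W X Y Z : Set} (w : Dec W) (x : Dec X) (y : Dec Y) (z : Dec Z) →
        (X → Y ⊎ Z) → (Y → X) → (Z → X) → (Y → Z → ⊥) →
        χ (w ×-dec x) ≡ χ w * χ y + χ w * χ z
      lem (no _)  x       y       z       f g h k = refl
      lem (yes _) x       (yes y) (yes z) f g h k = ⊥-elim (k y z)
      lem (yes _) (yes _) (yes _) (no _)  f g h k = refl
      lem (yes _) (yes _) (no _)  (yes _) f g h k = refl
      lem (yes _) (yes x) (no ¬y) (no ¬z) f g h k = ⊥-elim ([ ¬y , ¬z ] (f x))
      lem (yes _) (no ¬x) (yes y) z       f g h k = contradiction (g y) ¬x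
      lem (yes _) (no ¬x) (no _)  (yes z) f g h k = contradiction (h z) ¬x
      lem (yes _) (no _)  (no _)  (no _)  f g h k = refl

    -- A child differs from its parent, so exactly one of the two orders holds and the first factor
    -- is 1 on a parent edge.
    pull : ∀ u v → (ordered u v + ordered v u) * (χ (parent-edge? u v) * h u v) ≡
      χ (v Fin.≟ par u) * (χ (nonroot? u) * h u v)
    pull u v = lem {u Fin.< v} {v Fin.< u} {u ≢ root} {v ≡ par u} (u Fin.<? v) (v Fin.<? u) (nonroot? u) (v Fin.≟ par u) (h u v)
      (λ u≢ e → case Fin.<-cmp u v of λ where
        (tri< lt _ _)   → inj₁ lt
        (tri≈ _ refl _) → contradiction (sym e) (par-≢ u≢)
        (tri> _ _ gt)   → inj₂ gt)
      (Fin.<-asym {x = u} {v})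
      where
      lem : ∀ {W X Y Z : Set} (w : Dec W) (x : Dec X) (y : Dec Y) (z : Dec Z) a →
        (Y → Z → W ⊎ X) → (W → X → ⊥) →
        (χ w + χ x) * (χ (y ×-dec z) * a) ≡ χ z * (χ y * a)
      lem w       x       (no _)  (yes _) a f g = ℕ.*-zeroʳ (χ w + χ x)
      lem w       x       (no _)  (no _)  a f g = ℕ.*-zeroʳ (χ w + χ x)
      lem w       x       (yes _) (no _)  a f g = ℕ.*-zeroʳ (χ w + χ x)
      lem (yes w) (yes x) (yes _) (yes _) a f g = ⊥-elim (g w x)
      lem (yes _) (no _)  (yes _) (yes _) a f g = refl
      lem (no _)  (yes _) (yes _) (yes _) a f g = refl
      lem (no ¬w) (no ¬x) (yes y) (yes z) a f g = ⊥-elim ([ ¬w , ¬x ] (f y z))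

  Mo-rooted : Mo G ≡ ∑[ v < n ] (χ (nonroot? v) * ∣ size v - cosize v ∣)
  Mo-rooted = begin
    Mo G
      ≡⟨ sum-filter-cartesianProduct {n} {n} (λ (u , v) → (u Fin.<? v) ×-dec (u ~? v)) (λ (u , v) → h u v) id id ⟩
    ∑[ u < n ] ∑[ v < n ] (χ ((u Fin.<? v) ×-dec (u ~? v)) * h u v)
      ≡⟨ sum-cong-≗ {n} (λ u → trans (sum-cong-≗ {n} (expand u)) (∑-distrib-+ (down u) (upw u))) ⟩
    ∑[ u < n ] (Σᶠ (down u) + Σᶠ (upw u))
      ≡⟨ ∑-distrib-+ (Σᶠ ∘ down) (Σᶠ ∘ upw) ⟩
    Σᶠ (Σᶠ ∘ down) + Σᶠ (Σᶠ ∘ upw)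
      -- The edges whose larger end is the child are transposed, so that in both halves the outer
      -- index is the child; the inner sum then merely selects its parent.
      ≡⟨ cong (Σᶠ (Σᶠ ∘ down) +_) (∑-comm {n} {n} upw) ⟩
    Σᶠ (Σᶠ ∘ down) + ∑[ v < n ] ∑[ u < n ] upw u v
      ≡⟨ ∑-distrib-+ (Σᶠ ∘ down) (λ v → ∑[ u < n ] upw u v) ⟨
    ∑[ u < n ] (Σᶠ (down u) + ∑[ v < n ] upw v u)
      ≡⟨ sum-cong-≗ {n} (λ u → trans (sym (∑-distrib-+ (down u) (λ v → upw v u))) (sum-cong-≗ {n} (merge u))) ⟩
    ∑[ u < n ] ∑[ v < n ] (χ (v Fin.≟ par u) * (χ (nonroot? u) * h u v))
      ≡⟨ sum-cong-≗ {n} (λ u → ∑-select (par u) (λ v → χ (nonroot? u) * h u v) (Fin._≟ par u)) ⟩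
    ∑[ u < n ] (χ (nonroot? u) * h u (par u))
      ≡⟨ sum-cong-≗ evaluate ⟩
    ∑[ v < n ] (χ (nonroot? v) * ∣ size v - cosize v ∣) ∎
    where
    open ≡-Reasoning
    down upw : Fin n → Fin n → ℕ
    down u v = ordered u v * (χ (parent-edge? u v) * h u v)
    upw  u v = ordered u v * (χ (parent-edge? v u) * h u v)
    expand : ∀ u v → χ ((u Fin.<? v) ×-dec (u ~? v)) * h u v ≡ down u v + upw u v
    expand u v = trans (cong (_* h u v) (split u v))
      (distr (ordered u v) (χ (parent-edge? u v)) (χ (parent-edge? v u)) (h u v))
      where
      distr : ∀ a b c x → (a * b + a * c) * x ≡ a * (b * x) + a * (c * x)
      distr = solve-∀
    merge : ∀ u v → down u v + upw v u ≡ χ (v Fin.≟ par u) * (χ (nonroot? u) * h u v)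
    merge u v = trans (cong (λ x → down u v + ordered v u * (χ (parent-edge? u v) * x)) (h-sym v u))
      (trans (sym (ℕ.*-distribʳ-+ (χ (parent-edge? u v) * h u v) (ordered u v) (ordered v u))) (pull u v))
    evaluate : ∀ v → χ (nonroot? v) * h v (par v) ≡ χ (nonroot? v) * ∣ size v - cosize v ∣
    evaluate v with nonroot? v
    ... | no _   = refl
    ... | yes v≢ = cong (1 *_) (cong₂ ∣_-_∣ (closer-par v≢) (par-closer v≢))

  Heavy : ℕ → Fin n → Set
  Heavy s v = v ≢ root × s ≤ size v × s ≤ cosize v

  heavy? : ∀ s v → Dec (Heavy s v)
  heavy? s v = nonroot? v ×-dec ((s ≤? size v) ×-dec (s ≤? cosize v))

  N : ℕ → ℕ
  N s = count (heavy? s)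

  private
    layers : ∀ {m} x → x ≤ m → ∑[ i < m ] χ (suc (toℕ i) ≤? x) ≡ x
    layers {m} zero    le = sum-replicate-zero m
    layers {suc m} (suc x) (s≤s le) = cong suc (trans
      (count-cong {m} (λ i → suc (suc (toℕ i)) ≤? suc x) (λ i → suc (toℕ i) ≤? x) s≤s⁻¹ s≤s)
      (layers {m} x le))

    -- For large enough `m` the number of such `i` is min(a, b), obtained as a count of thresholds
    -- `s = i + 1`.
    both? : ∀ {m} a b (i : Fin m) → Dec (suc (toℕ i) ≤ a × suc (toℕ i) ≤ b)
    both? a b i = (suc (toℕ i) ≤? a) ×-dec (suc (toℕ i) ≤? b)

    layers-both : ∀ {m} a b → a ≤ b → a ≤ m →
      count (both? {m} a b) ≡ a
    layers-both {m} a b a≤b a≤m = trans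
      (count-cong (both? {m} a b) (λ i → suc (toℕ i) ≤? a) proj₁ (λ le → le , ℕ.≤-trans le a≤b))
      (layers {m} a a≤m)

    balance : ∀ {m} a b → a + b ≡ m →
      ∣ a - b ∣ + 2 * count (both? {m} a b) ≡ m
    balance {m} a b e with ℕ.≤-total a b
    ... | inj₁ a≤b = begin
      ∣ a - b ∣ + 2 * count (both? {m} a b) ≡⟨ cong₂ (λ x y → x + 2 * y) (ℕ.m≤n⇒∣m-n∣≡n∸m a≤b)
                             (layers-both {m} a b a≤b (ℕ.≤-trans (ℕ.m≤m+n a b) (ℕ.≤-reflexive e))) ⟩
      (b ∸ a) + 2 * a   ≡⟨ reassoc (b ∸ a) a ⟩
      a + ((b ∸ a) + a) ≡⟨ cong (a +_) (ℕ.m∸n+n≡m a≤b) ⟩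
      a + b             ≡⟨ e ⟩
      m ∎
      where
      open ≡-Reasoning
      reassoc : ∀ c a → c + 2 * a ≡ a + (c + a)
      reassoc = solve-∀
    ... | inj₂ b≤a = begin
      ∣ a - b ∣ + 2 * count (both? {m} a b) ≡⟨ cong₂ (λ x y → x + 2 * y) (ℕ.m≤n⇒∣n-m∣≡n∸m b≤a)
                             (trans (count-cong (both? {m} a b) (both? b a) Data.Product.swap Data.Product.swap)
                               (layers-both {m} b a b≤a (ℕ.≤-trans (ℕ.m≤n+m b a) (ℕ.≤-reflexive e)))) ⟩
      (a ∸ b) + 2 * b   ≡⟨ reassoc (a ∸ b) b ⟩
      ((a ∸ b) + b) + b ≡⟨ cong (_+ b) (ℕ.m∸n+n≡m b≤a) ⟩
      a + b             ≡⟨ e ⟩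
      m ∎
      where
      open ≡-Reasoning
      reassoc : ∀ c a → c + 2 * a ≡ (c + a) + a
      reassoc = solve-∀

  nonroots : 1 + count nonroot? ≡ n
  nonroots = trans (cong (_+ count nonroot?) (sym (count-≡ root))) (count-¬ (Fin._≟ root))

  -- |a − b| + 2 min(a, b) = a + b on every edge, and N s counts the edges with min ≥ s.
  Mo+2N : Mo G + 2 * ∑[ i < n ] N (suc (toℕ i)) ≡ pred n * n
  Mo+2N = begin
    Mo G + 2 * ∑[ i < n ] N (suc (toℕ i))
      ≡⟨ cong₂ (λ x y → x + 2 * y) Mo-rooted (∑-comm {n} {n} (λ i v → χ (heavy? (suc (toℕ i)) v))) ⟩
    Σᶠ difference + 2 * Σᶠ layer
      ≡⟨ cong (Σᶠ difference +_) (twice layer) ⟩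
    Σᶠ difference + ∑[ v < n ] (2 * layer v)
      ≡⟨ ∑-distrib-+ difference (λ v → 2 * layer v) ⟨
    ∑[ v < n ] (difference v + 2 * layer v)
      ≡⟨ sum-cong-≗ each ⟩
    ∑[ v < n ] (χ (nonroot? v) * n)
      ≡⟨ *-distribʳ-sum n (λ v → χ (nonroot? v)) ⟨
    count nonroot? * n
      ≡⟨ cong (λ x → pred x * n) nonroots ⟩
    pred n * n ∎
    where
    open ≡-Reasoning
    difference layer : Fin n → ℕ
    layer v = ∑[ i < n ] χ (heavy? (suc (toℕ i)) v)
    difference v = χ (nonroot? v) * ∣ size v - cosize v ∣
    twice : ∀ {m} (f : Fin m → ℕ) → 2 * Σᶠ f ≡ ∑[ v < m ] (2 * f v)
    twice f = *-distribˡ-sum 2 f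
    each′ : ∀ {Q : Set} {B : Fin n → Set} (d : Dec Q) (b? : Decidable B) {x} →
      x + 2 * count b? ≡ n → χ d * x + 2 * count (λ i → d ×-dec b? i) ≡ χ d * n
    each′ (no _)  b? e = cong (2 *_) (sum-replicate-zero n)
    each′ (yes q) b? {x} e = trans
      (cong₂ (λ x y → x + 2 * y) (ℕ.*-identityˡ x)
        (count-cong (λ i → yes q ×-dec b? i) b? proj₂ (q ,_)))
      (trans e (sym (ℕ.*-identityˡ n)))
    each : ∀ v → difference v + 2 * layer v ≡ χ (nonroot? v) * n
    each v = each′ (nonroot? v) (both? (size v) (cosize v))
      (balance {n} (size v) (cosize v) (size+cosize v))

-- By `Mo+2N` an inequality between Mostar indices is the reverse inequality between the sums of the
-- `N s`. Together with domination term by term it forces equality at each threshold from 1 to `n`,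
-- the range of those sums.
N-tight : ∀ {n} {G H : Graph (Fin n)} (R : Rooted G) (S : Rooted H) → Mo G ≤ Mo H →
  (∀ s → 1 ≤ s → RootedFin.N R s ≤ RootedFin.N S s) →
  ∀ s → 1 ≤ s → s ≤ n → RootedFin.N S s ≤ RootedFin.N R s
N-tight {n} {G} {H} R S MoG≤MoH NR≤NS (suc s) _ s<n = subst (λ s → RootedFin.N S (suc s) ≤ RootedFin.N R (suc s))
  (Fin.toℕ-fromℕ< s<n) (∑-tight (λ i → NR≤NS (suc (toℕ i)) (s≤s z≤n)) total (fromℕ< s<n))
  where
  total : ∑[ i < n ] RootedFin.N S (suc (toℕ i)) ≤ ∑[ i < n ] RootedFin.N R (suc (toℕ i))
  total = ℕ.*-cancelˡ-≤ 2 (ℕ.+-cancelˡ-≤ (Mo G) _ _ (ℕ.≤-trans (ℕ.+-monoˡ-≤ _ MoG≤MoH)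
    (ℕ.≤-reflexive (trans (RootedFin.Mo+2N S) (sym (RootedFin.Mo+2N R))))))

-- Pendent paths

module _ {n} (G : Graph (Fin n)) where
  open Graph G

  private
    neighbours : Fin n → List (Fin n)
    neighbours u = filter (u ~?_) (allFin n)

    neighbours-unique : ∀ u → UniqueList (neighbours u)
    neighbours-unique u = Unique.filter⁺ (u ~?_) (Unique.allFin⁺ n)

    neighbours-~ : ∀ {u x} → x ∈ neighbours u → u ~ x
    neighbours-~ {u} x∈ = proj₂ (∈-filter⁻ (u ~?_) {xs = allFin n} x∈)

  length≤degree : ∀ {u xs} → UniqueList xs → (∀ {x} → x ∈ xs → u ~ x) → length xs ≤ degree G u
  length≤degree {u} xs! adj = unique-⊆-length xs! (∈-filter-allFin (u ~?_) ∘ adj)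

  degree≤length : ∀ {u xs} → (∀ {x} → u ~ x → x ∈ xs) → degree G u ≤ length xs
  degree≤length {u} adj = unique-⊆-length (neighbours-unique u) (adj ∘ neighbours-~)

  two≤degree : ∀ {u x y} → u ~ x → u ~ y → x ≢ y → 2 ≤ degree G u
  two≤degree ux uy x≢y = length≤degree ((x≢y ∷ []) ∷ [] ∷ []) λ where
    (here refl)         → ux
    (there (here refl)) → uy

  three≤degree : ∀ {u x y z} → u ~ x → u ~ y → u ~ z → x ≢ y → x ≢ z → y ≢ z → 3 ≤ degree G u
  three≤degree ux uy uz x≢y x≢z y≢z =
    length≤degree ((x≢y ∷ x≢z ∷ []) ∷ (y≢z ∷ []) ∷ [] ∷ []) λ where
      (here refl)                 → ux
      (there (here refl))         → uy
      (there (there (here refl))) → uz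

  three-neighbours : ∀ {u} → 3 ≤ degree G u →
    ∃ λ x → ∃ λ y → ∃ λ z → (x ≢ y × x ≢ z × y ≢ z) × (u ~ x × u ~ y × u ~ z)
  three-neighbours {u} le = take3 (neighbours u) le (neighbours-unique u) neighbours-~
    where
    take3 : ∀ xs → 3 ≤ length xs → UniqueList xs → (∀ {x} → x ∈ xs → u ~ x) →
      ∃ λ x → ∃ λ y → ∃ λ z → (x ≢ y × x ≢ z × y ≢ z) × (u ~ x × u ~ y × u ~ z)
    take3 (x ∷ y ∷ z ∷ _) _ ((x≢y ∷ x≢z ∷ _) ∷ (y≢z ∷ _) ∷ _) adj =
      x , y , z , (x≢y , x≢z , y≢z) , adj (here refl) , adj (there (here refl)) , adj (there (there (here refl)))
    take3 (_ ∷ [])     (s≤s ())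
    take3 (_ ∷ _ ∷ []) (s≤s (s≤s ()))

module _ {V : Set} {G : Graph V} (R : Rooted G) where
  open Rooted R

  -- The part of a pendent path seen from the root: r nonroot vertices above a childless u, without branching.
  record Tip (r : ℕ) (u : V) : Set where
    field
      nonroot   : ∀ i → i < r → anc i u ≢ root
      childless : ∀ w → w ≢ root → par w ≢ u
      onlychild : ∀ i → suc i < r → ∀ w → w ≢ root → par w ≡ anc (suc i) u → w ≡ anc i u

module Chains {n} {G : Graph (Fin n)} (R : Rooted G) where
  open Graph G
  open RootedFin R

  chain : ∀ r → Fin n → Vec (Fin n) (suc r)
  chain zero    v = v ∷ []
  chain (suc r) v = v ∷ chain r (par v)

  chain-head : ∀ r v → head (chain r v) ≡ v
  chain-head zero    v = refl
  chain-head (suc r) v = refl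

  chain-last : ∀ r v → Vec.last (chain r v) ≡ anc r v
  chain-last zero    v = refl
  chain-last (suc r) v = trans (chain-last r (par v)) (anc-par r v)

  chain-lookup : ∀ r v i → lookup (chain r v) i ≡ anc (toℕ i) v
  chain-lookup zero    v Fin.zero    = refl
  chain-lookup (suc r) v Fin.zero    = refl
  chain-lookup (suc r) v (Fin.suc i) = trans (chain-lookup r (par v) i) (anc-par (toℕ i) v)

  child≢par : ∀ {c v} → c ≢ root → par c ≡ v → v ≢ root → c ≢ par v
  child≢par {c} c≢ refl v≢ e = par-⋠ c≢ (subst (par c ≼_) (sym e) (≼-par v≢))

  child-~ : ∀ {c v} → c ≢ root → par c ≡ v → v ~ c
  child-~ c≢ refl = ~-sym (par-~ c≢)

  par-or-child : ∀ {v w} → v ~ w → w ≡ par v ⊎ (w ≢ root × par w ≡ v)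
  par-or-child e = Sum.map₁ (sym ∘ proj₂) (~-par e)

  module _ {r} {p : Vec (Fin n) (suc r)} (pp : IsPendentPath G p) (head≢root : head p ≢ root)
    (root-degree : degree G root ≢ 2) where
    open IsPendentPath pp
    open IsPath isPath

    private
      lookup-head : ∀ {r} (p : Vec (Fin n) (suc r)) → lookup p Fin.zero ≡ head p
      lookup-head (_ ∷ _) = refl

      climbs : ∀ {r} (p : Vec (Fin n) (suc r)) → (∀ i → par (lookup p (inject₁ i)) ≡ lookup p (Fin.suc i)) →
        p ≡ chain r (head p)
      climbs (x ∷ [])     par≡ = refl
      climbs (x ∷ y ∷ ys) par≡ =
        cong (x ∷_) (trans (climbs (y ∷ ys) (par≡ ∘ Fin.suc)) (cong (chain _) (sym (par≡ Fin.zero))))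

      first : ∀ {r} (p : Vec (Fin n) (suc (suc r))) → (∀ i → lookup p (inject₁ i) ~ lookup p (Fin.suc i)) →
        head p ≢ root → degree G (head p) ≡ 1 → lookup p Fin.zero ≢ root × par (lookup p Fin.zero) ≡ lookup p (Fin.suc Fin.zero)
      first p@(x ∷ y ∷ _) adj x≢ d with par-or-child (adj Fin.zero)
      ... | inj₁ e            = x≢ , sym e
      ... | inj₂ (y≢ , refl) = contradiction
        (two≤degree G (adj Fin.zero) (par-~ x≢) (child≢par y≢ refl x≢)) (ℕ.<⇒≱ (ℕ.≤-reflexive (cong suc d)))

    -- The head is a leaf other than the root, so its only neighbour is its parent. At an inner
    -- vertex reached from a child, turning down again would give two children and a parent, hence
    -- degree 3; such a vertex is not the root, whose degree is not 2.
    pendent-climbs : ∀ i → lookup p (inject₁ i) ≢ root × par (lookup p (inject₁ i)) ≡ lookup p (Fin.suc i)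
    pendent-climbs = go r p positive adjacent distinct start inner head≢root
      where
      go : ∀ r (p : Vec (Fin n) (suc r)) → 1 ≤ r → (∀ i → lookup p (inject₁ i) ~ lookup p (Fin.suc i)) → UniqueVec p →
        degree G (head p) ≡ 1 → (∀ i → 1 ≤ toℕ i → toℕ i < r → degree G (lookup p i) ≡ 2) → head p ≢ root →
        ∀ i → lookup p (inject₁ i) ≢ root × par (lookup p (inject₁ i)) ≡ lookup p (Fin.suc i)
      go (suc r) p _ adj uniq d inn h≢ = Fin.<-weakInduction _ (first p adj h≢ d) step
        where
        step : ∀ i → lookup p (inject₁ (inject₁ i)) ≢ root × par (lookup p (inject₁ (inject₁ i))) ≡ lookup p (Fin.suc (inject₁ i)) →
          lookup p (inject₁ (Fin.suc i)) ≢ root × par (lookup p (inject₁ (Fin.suc i))) ≡ lookup p (Fin.suc (Fin.suc i))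
        step i (x≢ , e) = y≢ , (case par-or-child (adj (Fin.suc i)) of λ where
            (inj₁ z≡)        → sym z≡
            (inj₂ (z≢ , e′)) → contradiction
              (three≤degree G (child-~ x≢ e) (child-~ z≢ e′) (par-~ y≢)
                (λ x≡z → ℕ.<-irrefl (trans (sym (trans (Fin.toℕ-inject₁ _) (Fin.toℕ-inject₁ i)))
                  (cong toℕ (UniqueVec.lookup-injective uniq _ _ x≡z))) (s≤s (ℕ.n≤1+n _)))
                (child≢par x≢ e y≢) (child≢par z≢ e′ y≢))
              (ℕ.<⇒≱ (ℕ.≤-reflexive (cong suc d2))))
          where
          d2 : degree G (lookup p (Fin.suc (inject₁ i))) ≡ 2
          d2 = inn _ (s≤s z≤n) (s≤s (subst (_< r) (sym (Fin.toℕ-inject₁ i)) (Fin.toℕ<n i)))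
          y≢ : lookup p (Fin.suc (inject₁ i)) ≢ root
          y≢ y≡root = root-degree (trans (cong (degree G) (sym y≡root)) d2)

    pendent-chain : p ≡ chain r (head p)
    pendent-chain = climbs p (proj₂ ∘ pendent-climbs)

    private
      at : ∀ i → lookup p i ≡ anc (toℕ i) (head p)
      at i = trans (cong (λ q → lookup q i) pendent-chain) (chain-lookup r (head p) i)

      degree-anc : ∀ i → suc i < r → degree G (anc (suc i) (head p)) ≡ 2
      degree-anc i lt = subst (λ v → degree G v ≡ 2)
        (trans (at j) (cong (λ x → anc x (head p)) (Fin.toℕ-fromℕ< (ℕ.m<n⇒m<1+n lt))))
        (inner j (subst (1 ≤_) (sym (Fin.toℕ-fromℕ< (ℕ.m<n⇒m<1+n lt))) (s≤s z≤n))
          (subst (_< r) (sym (Fin.toℕ-fromℕ< (ℕ.m<n⇒m<1+n lt))) lt))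
        where
        j : Fin (suc r)
        j = fromℕ< (ℕ.m<n⇒m<1+n lt)

      nonroot-anc : ∀ i → i < r → anc i (head p) ≢ root
      nonroot-anc i lt = subst (_≢ root)
        (trans (at (inject₁ (fromℕ< lt))) (cong (λ x → anc x (head p)) (trans (Fin.toℕ-inject₁ _) (Fin.toℕ-fromℕ< lt))))
        (proj₁ (pendent-climbs (fromℕ< lt)))

    pendent-tip : Tip R r (head p)
    pendent-tip = record
      { nonroot   = nonroot-anc
      ; childless = λ w w≢ e → ℕ.<⇒≱ (ℕ.≤-reflexive (cong suc start))
          (two≤degree G (child-~ w≢ e) (par-~ head≢root) (child≢par w≢ e head≢root))
      ; onlychild = λ i lt w w≢ e → case w Fin.≟ anc i (head p) of λ where
          (yes e′) → e′
          (no w≢′) → contradiction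
            (three≤degree G (child-~ w≢ e) (child-~ (nonroot-anc i (ℕ.<⇒≤ lt)) refl) (par-~ (nonroot-anc (suc i) lt))
              w≢′ (child≢par w≢ e (nonroot-anc (suc i) lt)) (child≢par (nonroot-anc i (ℕ.<⇒≤ lt)) refl (nonroot-anc (suc i) lt)))
            (ℕ.<⇒≱ (ℕ.≤-reflexive (cong suc (degree-anc i lt))))
      }

  chain-adjacent : ∀ r {v} → (∀ i → i < r → anc i v ≢ root) →
    ∀ i → lookup (chain r v) (inject₁ i) ~ lookup (chain r v) (Fin.suc i)
  chain-adjacent r {v} nonroot i = subst₂ _~_
    (sym (trans (chain-lookup r v (inject₁ i)) (cong (λ x → anc x v) (Fin.toℕ-inject₁ i))))
    (sym (chain-lookup r v (Fin.suc i)))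
    (par-~ (nonroot (toℕ i) (Fin.toℕ<n i)))

  chain-depth : ∀ i {v} → (∀ j → j < i → anc j v ≢ root) → i + depth (anc i v) ≡ depth v
  chain-depth zero    nonroot = refl
  chain-depth (suc i) nonroot = trans (sym (ℕ.+-suc i _))
    (trans (cong (i +_) (sym (depth-par (nonroot i ℕ.≤-refl)))) (chain-depth i (λ j lt → nonroot j (ℕ.m<n⇒m<1+n lt))))

  anc-injective : ∀ {r v i j} → (∀ i → i < r → anc i v ≢ root) → i ≤ r → j ≤ r → anc i v ≡ anc j v → i ≡ j
  anc-injective {r} {v} {i} {j} nonroot i≤r j≤r e = ℕ.+-cancelʳ-≡ (depth (anc i v)) i j (begin
    i + depth (anc i v) ≡⟨ chain-depth i (λ k lt → nonroot k (ℕ.<-≤-trans lt i≤r)) ⟩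
    depth v             ≡⟨ chain-depth j (λ k lt → nonroot k (ℕ.<-≤-trans lt j≤r)) ⟨
    j + depth (anc j v) ≡⟨ cong (λ x → j + depth x) e ⟨
    j + depth (anc i v) ∎)
    where open ≡-Reasoning

  chain-unique : ∀ r {v} → (∀ i → i < r → anc i v ≢ root) → UniqueVec (chain r v)
  chain-unique r {v} nonroot = lookup-injective⇒unique _ λ i j e → Fin.toℕ-injective
    (anc-injective nonroot (s≤s⁻¹ (Fin.toℕ<n i)) (s≤s⁻¹ (Fin.toℕ<n j))
      (trans (sym (chain-lookup r v i)) (trans e (chain-lookup r v j))))
    where
    lookup-injective⇒unique : ∀ {m} (q : Vec (Fin n) m) → (∀ i j → lookup q i ≡ lookup q j → i ≡ j) → UniqueVec q
    lookup-injective⇒unique q inj = subst UniqueVec (Vec.tabulate∘lookup q) (UniqueVec.tabulate⁺ (λ {i} {j} → inj i j))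

  -- A `Tip` says nothing about its last vertex, which must have degree at least 2. Off the root a
  -- child and a parent are available; at the root the degree has to be supplied. The first
  -- alternative serves a path rooted at a leaf, the second a root of degree at least 3.
  tip⇒pendent : ∀ {r u} → 1 ≤ r → Tip R r u → anc r u ≢ root ⊎ 2 ≤ degree G root → IsPendentPath G (chain r u)
  tip⇒pendent {r} {u} 1≤r tip end = record
    { positive = 1≤r
    ; isPath   = record { distinct = chain-unique r nonroot ; adjacent = chain-adjacent r nonroot }
    ; start    = subst (λ v → degree G v ≡ 1) (sym (chain-head r u)) start
    ; end      = subst (λ v → 2 ≤ degree G v) (sym (chain-last r u)) (last-degree r 1≤r nonroot end)
    ; inner    = λ i 1≤i i<r → subst (λ v → degree G v ≡ 2) (sym (chain-lookup r u i)) (inner (toℕ i) 1≤i i<r)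
    }
    where
    open Tip tip
    start : degree G u ≡ 1
    start = ℕ.≤-antisym
      (degree≤length G {xs = par u ∷ []} λ {x} e → case par-or-child e of λ where
        (inj₁ e′)        → here e′
        (inj₂ (w≢ , e′)) → contradiction e′ (childless x w≢))
      (length≤degree G ([] ∷ []) λ where (here refl) → par-~ (nonroot 0 1≤r))
    inner : ∀ i → 1 ≤ i → i < r → degree G (anc i u) ≡ 2
    inner (suc i) _ lt = ℕ.≤-antisym
      (degree≤length G {xs = par (anc (suc i) u) ∷ anc i u ∷ []} λ {x} e → case par-or-child e of λ where
        (inj₁ e′)        → here e′
        (inj₂ (w≢ , e′)) → there (here (onlychild i lt x w≢ e′)))
      (two≤degree G (par-~ (nonroot (suc i) lt)) (child-~ (nonroot i (ℕ.<⇒≤ lt)) refl)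
        (≢-sym (child≢par (nonroot i (ℕ.<⇒≤ lt)) refl (nonroot (suc i) lt))))
    last-degree : ∀ r → 1 ≤ r → (∀ i → i < r → anc i u ≢ root) → anc r u ≢ root ⊎ 2 ≤ degree G root → 2 ≤ degree G (anc r u)
    last-degree (suc r) _ nonroot (inj₁ a≢) =
      two≤degree G (par-~ a≢) (child-~ (nonroot r ℕ.≤-refl) refl) (≢-sym (child≢par (nonroot r ℕ.≤-refl) refl a≢))
    last-degree (suc r) _ nonroot (inj₂ le) with anc (suc r) u Fin.≟ root
    ... | yes e = subst (λ v → 2 ≤ degree G v) (sym e) le
    ... | no a≢ = last-degree (suc r) (s≤s z≤n) nonroot (inj₁ a≢)

  module _ {r k : ℕ} (1≤r : 1 ≤ r) (branching : 3 ≤ degree G root) where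

    private
      head≢root : {p : Vec (Fin n) (suc r)} → IsPendentPath G p → head p ≢ root
      head≢root pp e = ℕ.<⇒≱ (ℕ.≤-reflexive (cong suc (IsPendentPath.start pp)))
        (ℕ.≤-trans (s≤s (s≤s z≤n)) (subst (λ v → 3 ≤ degree G v) (sym e) branching))

      root≢2 : degree G root ≢ 2
      root≢2 e = ℕ.<-irrefl (sym e) branching

    tips⇒pendents : ∀ us → UniqueList us → length us ≡ k → (∀ {u} → u ∈ us → Tip R r u) → (∀ {u} → Tip R r u → u ∈ us) →
      HasExactly k (IsPendentPath G {r})
    tips⇒pendents us us! len tips complete =
      map (chain r) us , Unique.map⁺ chain-injective us! , trans (List.length-map (chain r) us) len ,
      λ p → mk⇔
        (λ p∈ → case ∈-map⁻ (chain r) p∈ of λ where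
          (u , u∈ , refl) → tip⇒pendent 1≤r (tips u∈) (inj₂ (ℕ.<⇒≤ branching)))
        (λ pp → subst (_∈ map (chain r) us) (sym (pendent-chain pp (head≢root pp) root≢2))
          (∈-map⁺ (chain r) (complete (pendent-tip pp (head≢root pp) root≢2))))
      where
      chain-injective : ∀ {u v} → chain r u ≡ chain r v → u ≡ v
      chain-injective {u} {v} e = trans (sym (chain-head r u)) (trans (cong head e) (chain-head r v))

    -- A pendent path is the chain climbing from its head, so distinct paths have distinct heads and
    -- none is lost in passing to tips.
    pendents⇒tips : HasExactly k (IsPendentPath G {r}) →
      ∃ λ us → UniqueList us × length us ≡ k × (∀ {u} → u ∈ us → Tip R r u)
    pendents⇒tips (ps , ps! , len , spec) =
      map head ps , unique-map heads-differ ps! , trans (List.length-map head ps) len ,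
      λ u∈ → case ∈-map⁻ head u∈ of λ where
        (p , p∈ , refl) → pendent-tip (pendent p∈) (head≢root (pendent p∈)) root≢2
      where
      pendent : ∀ {p} → p ∈ ps → IsPendentPath G p
      pendent = Equivalence.to (spec _)
      as-chain : ∀ {p} → p ∈ ps → p ≡ chain r (head p)
      as-chain p∈ = pendent-chain (pendent p∈) (head≢root (pendent p∈)) root≢2
      heads-differ : ∀ {p q} → p ∈ ps → q ∈ ps → head p ≡ head q → p ≡ q
      heads-differ p∈ q∈ e = trans (as-chain p∈) (trans (cong (chain r) e) (sym (as-chain q∈)))

-- Upper bounds for N

count-witness : ∀ {n} {Q : Fin n → Set} (Q? : Decidable Q) → 0 < count Q? → ∃ Q
count-witness Q? lt with Fin.any? Q?
... | yes q   = q
... | no none = contradiction (count≤length Q? {xs = []} (λ q → contradiction (_ , q) none)) (ℕ.<⇒≱ lt)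

length-cartesianProduct : ∀ {U V : Set} (xs : List U) (ys : List V) →
  length (cartesianProduct xs ys) ≡ length xs * length ys
length-cartesianProduct []       ys = refl
length-cartesianProduct (x ∷ xs) ys = trans (List.length-++ (map (x ,_) ys))
  (cong₂ _+_ (List.length-map (x ,_) ys) (length-cartesianProduct xs ys))

count-split : ∀ {n} {Q S : Fin n → Set} (Q? : Decidable Q) (S? : Decidable S) →
  count Q? ≡ count (λ w → Q? w ×-dec S? w) + count (λ w → Q? w ×-dec ¬? (S? w))
count-split Q? S? = trans
  (count-cong Q? (λ w → (Q? w ×-dec S? w) ⊎-dec (Q? w ×-dec ¬? (S? w)))
    (λ {w} q → case S? w of λ where
      (yes s) → inj₁ (q , s)
      (no ¬s) → inj₂ (q , ¬s))
    [ proj₁ , proj₁ ])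
  (count-⊎ (λ w → Q? w ×-dec S? w) (λ w → Q? w ×-dec ¬? (S? w)) (λ (_ , s) (_ , ¬s) → ¬s s))

module _ {n} {Q R U : Fin n → Set} (Q? : Decidable Q) (R? : Decidable R) (U? : Decidable U) where

  -- The upper bounds below come from packing: disjoint sets of heavy and of discarded vertices
  -- inside one larger set.
  pack₂ : (∀ {w} → Q w → U w) → (∀ {w} → R w → U w) → (∀ {w} → Q w → R w → ⊥) → count Q? + count R? ≤ count U?
  pack₂ Q⊆U R⊆U dis = ℕ.≤-trans (ℕ.≤-reflexive (sym (count-⊎ Q? R? dis)))
    (count-mono (λ w → Q? w ⊎-dec R? w) U? [ Q⊆U , R⊆U ])

module _ {n} {Q R S U : Fin n → Set} (Q? : Decidable Q) (R? : Decidable R) (S? : Decidable S) (U? : Decidable U) where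

  pack₃ : (∀ {w} → Q w → U w) → (∀ {w} → R w → U w) → (∀ {w} → S w → U w) →
    (∀ {w} → Q w → R w → ⊥) → (∀ {w} → Q w → S w → ⊥) → (∀ {w} → R w → S w → ⊥) →
    count Q? + count R? + count S? ≤ count U?
  pack₃ Q⊆U R⊆U S⊆U QR QS RS = ℕ.≤-trans (ℕ.≤-reflexive (cong (_+ count S?) (sym (count-⊎ Q? R? QR))))
    (pack₂ (λ w → Q? w ⊎-dec R? w) S? U? [ Q⊆U , R⊆U ] S⊆U [ QS , RS ])

module Bounds {n} {G : Graph (Fin n)} (R : Rooted G) where
  open RootedFin R
  open Chains R using (chain-depth; anc-injective)

  Below : Fin n → Fin n → Set
  Below v w = w ≼ v × w ≢ v

  below? : ∀ v → Decidable (Below v)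
  below? v w = (w ≼? v) ×-dec ¬? (w Fin.≟ v)

  count-peel : ∀ {Q : Fin n → Set} (Q? : Decidable Q) {v} → Q v → count Q? ≡ 1 + count (λ w → Q? w ×-dec ¬? (w Fin.≟ v))
  count-peel Q? {v} q = trans (count-split Q? (Fin._≟ v)) (cong (_+ count (λ w → Q? w ×-dec ¬? (w Fin.≟ v)))
    (trans (count-cong (λ w → Q? w ×-dec (w Fin.≟ v)) (Fin._≟ v) proj₂ (λ where refl → q , refl)) (count-≡ v)))

  size≡1+below : ∀ v → size v ≡ 1 + count (below? v)
  size≡1+below v = count-peel (_≼? v) here

  root-not-below : ∀ {v} → ¬ Below v root
  root-not-below {v} (r≼v , r≢v) = r≢v (≼-antisym r≼v (≼-root v))

  all? : (w : Fin n) → Dec ⊤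
  all? _ = yes tt

  count-all : count all? ≡ n
  count-all = trans (∑-replicate n 1) (ℕ.*-identityʳ n)

  -- Take a heavy `v` of least size. If some heavy vertex is not above `v`, a smallest such `v′` has
  -- descendants disjoint from those of `v`; proper descendants of either are not heavy and the root
  -- is left over, so N s + (size v - 1) + (size v′ - 1) + 1 ≤ n. Otherwise the heavy vertices form
  -- a chain above `v`, and the complement of the topmost one takes the part of the second set.
  heavy-bound : ∀ s → 0 < N s → N s + 2 * s ≤ suc n
  heavy-bound s N>0 with argmin (heavy? s) size (count-witness (heavy? s) N>0)
  ... | v , v∈H , v-min with Fin.any? (λ w → heavy? s w ×-dec ¬? (v ≼? w))
  ...   | yes (w₀ , w₀∈H , v⋠w₀) = branches (argmin (λ w → heavy? s w ×-dec ¬? (v ≼? w)) size (w₀ , w₀∈H , v⋠w₀))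
    where
    branches : (∃ λ v′ → (Heavy s v′ × ¬ v ≼ v′) × (∀ w → Heavy s w × ¬ v ≼ w → size v′ ≤ size w)) → N s + 2 * s ≤ suc n
    branches (v′ , (v′∈H , v⋠v′) , v′-min) = by≤ 0
      (ℕ.+-mono-≤ (ℕ.+-mono-≤ (proj₁ (proj₂ v∈H)) (proj₁ (proj₂ v′∈H)))
        (ℕ.≤-trans (pack₂ (λ w → heavy? s w ⊎-dec below? v w ⊎-dec below? v′ w) (Fin._≟ root) all? _ _ λ where
          (inj₁ (w≢ , _))  refl → w≢ refl
          (inj₂ (inj₁ b))  refl → root-not-below b
          (inj₂ (inj₂ b))  refl → root-not-below b)
          (ℕ.≤-reflexive count-all)))
      (trans (cong₂ (λ x y → N s + 2 * s + (x + y + n) + 0) (size≡1+below v) (size≡1+below v′))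
      (trans (arith (N s) s (count (below? v)) (count (below? v′)) n)
        (cong₂ (λ x y → suc n + (s + s + (x + y))) (sym parts) (sym (count-≡ root)))))
      where
      parts : count (λ w → heavy? s w ⊎-dec below? v w ⊎-dec below? v′ w) ≡ N s + (count (below? v) + count (below? v′))
      parts = trans
        (count-⊎ (heavy? s) (λ w → below? v w ⊎-dec below? v′ w) λ where
          w∈H (inj₁ (w≼v , w≢v))   → ℕ.<⇒≱ (size-strict w≼v w≢v) (v-min _ w∈H)
          w∈H (inj₂ (w≼v′ , w≢v′)) → ℕ.<⇒≱ (size-strict w≼v′ w≢v′) (v′-min _ (w∈H , λ v≼w → v⋠v′ (≼-trans v≼w w≼v′))))
        (cong (N s +_) (count-⊎ (below? v) (below? v′) λ (w≼v , _) (w≼v′ , _) → case ≼-linear w≼v w≼v′ of λ where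
          (inj₁ v≼v′) → v⋠v′ v≼v′
          (inj₂ v′≼v) → ℕ.<⇒≱ (size-strict v′≼v λ where refl → v⋠v′ here) (v-min _ v′∈H)))
      arith : ∀ a s x y n → a + 2 * s + (suc x + suc y + n) + 0 ≡ suc n + (s + s + (a + (x + y) + 1))
      arith = solve-∀
  ...   | no none = nested (argmax (heavy? s) size (v , v∈H))
    where
    nested : (∃ λ v′ → Heavy s v′ × (∀ w → Heavy s w → size w ≤ size v′)) → N s + 2 * s ≤ suc n
    nested (v′ , v′∈H , v′-max) = by≤ 0
      (ℕ.+-mono-≤ (ℕ.+-mono-≤ (proj₁ (proj₂ v∈H)) (proj₂ (proj₂ v′∈H)))
        (pack₂ (heavy? s) (below? v) (_≼? v′) inside (λ (w≼v , _) → ≼-trans w≼v (inside v∈H))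
          (λ w∈H (w≼v , w≢v) → ℕ.<⇒≱ (size-strict w≼v w≢v) (v-min _ w∈H))))
      (trans (cong (λ x → N s + 2 * s + (x + cosize v′ + size v′) + 0) (size≡1+below v))
        (trans (arith (N s) s (count (below? v)) (size v′) (cosize v′))
          (cong (λ x → suc x + (s + s + (N s + count (below? v)))) (size+cosize v′))))
      where
      above : ∀ {w} → Heavy s w → v ≼ w
      above {w} w∈H with v ≼? w
      ... | yes v≼w = v≼w
      ... | no v⋠w  = contradiction (w , w∈H , v⋠w) none
      inside : ∀ {w} → Heavy s w → w ≼ v′
      inside {w} w∈H with ≼-linear (above w∈H) (above v′∈H)
      ... | inj₁ w≼v′ = w≼v′
      ... | inj₂ v′≼w with v′ Fin.≟ w
      ...   | yes refl = here
      ...   | no v′≢w  = contradiction (v′-max w w∈H) (ℕ.<⇒≱ (size-strict v′≼w v′≢w))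
      arith : ∀ a s x p q → a + 2 * s + (suc x + q + p) + 0 ≡ suc (p + q) + (s + s + (a + x))
      arith = solve-∀

  module Legs {r} {ts : List (Fin n)} (ts! : UniqueList ts) (1≤r : 1 ≤ r) (tips : ∀ {u} → u ∈ ts → Tip R r u) where

    k : ℕ
    k = length ts

    -- Descending a leg offers no choice: by `onlychild` each step leads to the next leg vertex,
    -- down to the childless tip.
    below-tip : ∀ t {u w} → u ∈ ts → t < r → w ≼ anc t u → ∃ λ i → i ≤ t × w ≡ anc i u
    below-tip t {u} u∈ t<r w≼ with ≼-child w≼
    ... | inj₁ e = t , ℕ.≤-refl , e
    below-tip zero    {u} u∈ t<r w≼ | inj₂ (c , c≢ , e , _) = contradiction e (Tip.childless (tips u∈) c c≢)
    below-tip (suc t) {u} {w} u∈ t<r w≼ | inj₂ (c , c≢ , e , w≼c)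
      with below-tip t u∈ (ℕ.<⇒≤ t<r) (subst (w ≼_) (Tip.onlychild (tips u∈) t t<r c c≢ e) w≼c)
    ... | i , i≤t , eq = i , ℕ.m≤n⇒m≤1+n i≤t , eq

    anc-size : ∀ {t u} → u ∈ ts → t < r → size (anc t u) ≤ suc t
    anc-size {t} {u} u∈ t<r = ℕ.≤-trans
      (count≤length (_≼? anc t u) {xs = map (λ i → anc i u) (upTo (suc t))} λ w≼ → case below-tip t u∈ t<r w≼ of λ where
        (i , i≤t , refl) → ∈-map⁺ (λ i → anc i u) (∈-upTo⁺ (s≤s i≤t)))
      (ℕ.≤-reflexive (trans (List.length-map _ (upTo (suc t))) (List.length-upTo (suc t))))

    ≼anc-tip : ∀ {t u} → u ∈ ts → t ≤ r → u ≼ anc t u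
    ≼anc-tip {t} {u} u∈ t≤r = ≼anc t (ℕ.≤-trans (ℕ.m≤m+n t _)
      (ℕ.≤-reflexive (chain-depth t (λ j lt → Tip.nonroot (tips u∈) j (ℕ.<-≤-trans lt t≤r)))))

    ≼-tip : ∀ {u w} → u ∈ ts → w ≼ u → w ≡ u
    ≼-tip u∈ w≼u with below-tip 0 u∈ 1≤r w≼u
    ... | zero , _ , e = e

    -- If the legs meet, `u` lies below a vertex of the leg of `v`, hence on that leg and above `v`;
    -- but only `u` itself is below the childless `u`, so `u ≡ v`. Depth then determines the
    -- position.
    legs-disjoint : ∀ {i j u v} → u ∈ ts → v ∈ ts → i < r → j < r → anc i u ≡ anc j v → i ≡ j × u ≡ v
    legs-disjoint {i} {j} {u} {v} u∈ v∈ i<r j<r e = same u≡v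
      where
      u≡v : u ≡ v
      u≡v with below-tip j v∈ j<r (subst (u ≼_) e (≼anc-tip u∈ (ℕ.<⇒≤ i<r)))
      ... | i′ , i′≤j , refl = sym (≼-tip u∈ (≼anc-tip v∈ (ℕ.≤-trans i′≤j (ℕ.<⇒≤ j<r))))
      same : u ≡ v → i ≡ j × u ≡ v
      same refl = anc-injective (Tip.nonroot (tips u∈)) (ℕ.<⇒≤ i<r) (ℕ.<⇒≤ j<r) e , refl

    -- The lowest `b` vertices of each leg; `b = r` gives the whole legs.
    legs : ℕ → List (Fin n) → List (Fin n)
    legs b us = map (uncurry anc) (cartesianProduct (upTo b) us)

    ∈-legs⁺ : ∀ {b us t u} → t < b → u ∈ us → anc t u ∈ legs b us
    ∈-legs⁺ t<b u∈ = ∈-map⁺ (uncurry anc) (∈-cartesianProduct⁺ (∈-upTo⁺ t<b) u∈)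

    ∈-legs⁻ : ∀ b us {w} → w ∈ legs b us → ∃₂ λ t u → t < b × u ∈ us × w ≡ anc t u
    ∈-legs⁻ b us w∈ with ∈-map⁻ (uncurry anc) w∈
    ... | (t , u) , tu∈ , e with ∈-cartesianProduct⁻ (upTo b) us tu∈
    ...   | t∈ , u∈ = t , u , ∈-upTo⁻ t∈ , u∈ , e

    legs-unique : ∀ {b us} → b ≤ r → UniqueList us → (∀ {u} → u ∈ us → u ∈ ts) → UniqueList (legs b us)
    legs-unique {b} {us} b≤r us! us⊆ts = unique-map (λ {(i , u)} {(j , v)} p q e →
      let i∈ , u∈ = ∈-cartesianProduct⁻ (upTo b) us p
          j∈ , v∈ = ∈-cartesianProduct⁻ (upTo b) us q
          i≡j , u≡v = legs-disjoint (us⊆ts u∈) (us⊆ts v∈) (ℕ.<-≤-trans (∈-upTo⁻ i∈) b≤r) (ℕ.<-≤-trans (∈-upTo⁻ j∈) b≤r) e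
      in cong₂ _,_ i≡j u≡v)
      (Unique.cartesianProduct⁺ (Unique.upTo⁺ b) us!)

    length-legs : ∀ b us → length (legs b us) ≡ b * length us
    length-legs b us = trans (List.length-map (uncurry anc) (cartesianProduct (upTo b) us))
      (trans (length-cartesianProduct (upTo b) us) (cong (_* length us) (List.length-upTo b)))

    infix 4 _∈?_

    _∈?_ : ∀ (w : Fin n) xs → Dec (w ∈ xs)
    w ∈? xs = Any.any? (w Fin.≟_) xs

    OnLeg : Fin n → Set
    OnLeg w = w ∈ legs r ts

    onLeg? : Decidable OnLeg
    onLeg? w = w ∈? legs r ts

    spine? : ∀ w → Dec (¬ OnLeg w)
    spine? w = ¬? (onLeg? w)

    spineCount tipCount : {S : Fin n → Set} → Decidable S → ℕ
    spineCount S? = count (λ w → spine? w ×-dec S? w)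
    tipCount   S? = count (λ w → (w ∈? ts) ×-dec S? w)

    count-ts : count (_∈? ts) ≡ k
    count-ts = count≡length (_∈? ts) ts! id id

    count-onLeg : count onLeg? ≡ r * k
    count-onLeg = trans (count≡length onLeg? (legs-unique ℕ.≤-refl ts! id) id id) (length-legs r ts)

    count-spine : count spine? + r * k ≡ n
    count-spine = trans (ℕ.+-comm (count spine?) (r * k)) (trans (cong (_+ count spine?) (sym count-onLeg)) (count-¬ onLeg?))

    -- A set that never separates the vertices of a leg is measured by its spine vertices and its
    -- tips, each tip standing for `r` vertices.
    count-by-legs : ∀ {S : Fin n → Set} (S? : Decidable S) →
      (∀ {t u} → t < r → u ∈ ts → (S u → S (anc t u)) × (S (anc t u) → S u)) →
      count S? ≡ spineCount S? + r * tipCount S?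
    count-by-legs {S} S? compat = begin
      count S?
        ≡⟨ count-split S? onLeg? ⟩
      count (λ w → S? w ×-dec onLeg? w) + count (λ w → S? w ×-dec spine? w)
        ≡⟨ cong₂ _+_ on-legs (count-cong (λ w → S? w ×-dec spine? w) (λ w → spine? w ×-dec S? w) Data.Product.swap Data.Product.swap) ⟩
      r * tipCount S? + spineCount S?
        ≡⟨ ℕ.+-comm (r * tipCount S?) _ ⟩
      spineCount S? + r * tipCount S? ∎
      where
      open ≡-Reasoning
      us : List (Fin n)
      us = filter S? ts
      us! : UniqueList us
      us! = Unique.filter⁺ S? ts!
      us⊆ts : ∀ {u} → u ∈ us → u ∈ ts
      us⊆ts u∈ = proj₁ (∈-filter⁻ S? {xs = ts} u∈)
      on-legs : count (λ w → S? w ×-dec onLeg? w) ≡ r * tipCount S?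
      on-legs = trans
        (count≡length (λ w → S? w ×-dec onLeg? w) (legs-unique ℕ.≤-refl us! us⊆ts)
          (λ x∈ → case ∈-legs⁻ r us x∈ of λ where
            (t , u , t<r , u∈ , refl) → proj₁ (compat t<r (us⊆ts u∈)) (proj₂ (∈-filter⁻ S? {xs = ts} u∈)) , ∈-legs⁺ t<r (us⊆ts u∈))
          (λ (s , w∈) → case ∈-legs⁻ r ts w∈ of λ where
            (t , u , t<r , u∈ , refl) → ∈-legs⁺ t<r (∈-filter⁺ S? u∈ (proj₂ (compat t<r u∈) s))))
        (trans (length-legs r us) (cong (r *_) (sym (count≡length (λ w → (w ∈? ts) ×-dec S? w) us!
          (∈-filter⁻ S? {xs = ts}) (λ (u∈ , s) → ∈-filter⁺ S? u∈ s)))))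

    -- If `u ≼ v`, then `v` and `anc t u` are both ancestors of `u`, hence comparable, and `v` below
    -- `anc t u` would put the spine vertex `v` on the leg.
    leg-compat : ∀ {v t u} → ¬ OnLeg v → t < r → u ∈ ts → (u ≼ v → anc t u ≼ v) × (anc t u ≼ v → u ≼ v)
    leg-compat {v} v-spine t<r u∈ = (λ u≼v → case ≼-linear u≼v (≼anc-tip u∈ (ℕ.<⇒≤ t<r)) of λ where
        (inj₁ v≼) → case below-tip _ u∈ t<r v≼ of λ where
          (i , i≤t , refl) → contradiction (∈-legs⁺ (ℕ.≤-<-trans i≤t t<r) u∈) v-spine
        (inj₂ ≼v) → ≼v)
      , ≼-trans (≼anc-tip u∈ (ℕ.<⇒≤ t<r))

    p p′ l l′ : Fin n → ℕ
    p v  = spineCount (_≼? v)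
    p′ v = spineCount (λ w → ¬? (w ≼? v))
    l v  = tipCount (_≼? v)
    l′ v = tipCount (λ w → ¬? (w ≼? v))

    size-spine : ∀ {v} → ¬ OnLeg v → size v ≡ p v + r * l v
    size-spine {v} v-spine = count-by-legs (_≼? v) (leg-compat v-spine)

    cosize-spine : ∀ {v} → ¬ OnLeg v → cosize v ≡ p′ v + r * l′ v
    cosize-spine {v} v-spine = count-by-legs (λ w → ¬? (w ≼? v)) λ t<r u∈ →
      (λ ¬u q → ¬u (proj₂ (leg-compat v-spine t<r u∈) q)) , (λ ¬a q → ¬a (proj₁ (leg-compat v-spine t<r u∈) q))

    p+p′ : ∀ v → p v + p′ v ≡ count spine?
    p+p′ v = sym (count-split spine? (_≼? v))

    l+l′ : ∀ v → l v + l′ v ≡ k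
    l+l′ v = trans (sym (count-split (_∈? ts) (_≼? v))) count-ts

    l-mono : ∀ {w v} → w ≼ v → l w ≤ l v
    l-mono w≼v = count-mono (λ u → (u ∈? ts) ×-dec (u ≼? _)) (λ u → (u ∈? ts) ×-dec (u ≼? _)) λ (u∈ , u≼w) → u∈ , ≼-trans u≼w w≼v

    l-disjoint : ∀ {w v} → ¬ w ≼ v → ¬ v ≼ w → l w + l v ≤ k
    l-disjoint {w} {v} w⋠v v⋠w = ℕ.≤-trans
      (pack₂ (λ u → (u ∈? ts) ×-dec (u ≼? w)) (λ u → (u ∈? ts) ×-dec (u ≼? v)) (_∈? ts) proj₁ proj₁
        λ (_ , u≼w) (_ , u≼v) → [ w⋠v , v⋠w ] (≼-linear u≼w u≼v))
      (ℕ.≤-reflexive count-ts)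

    root-spine : ¬ OnLeg root
    root-spine r∈ with ∈-legs⁻ r ts r∈
    ... | t , u , t<r , u∈ , e = Tip.nonroot (tips u∈) t t<r (sym e)

    -- The vertex at height t < b of a leg has at most t + 1 ≤ b < s descendants, so the lowest `b`
    -- vertices of the legs are not heavy, nor is the root. The variable `b` stands for min(s - 1,
    -- r), which thus never has to be computed.
    leg-bound : ∀ {b s} → b ≤ r → b < s → N s + b * k + 1 ≤ n
    leg-bound {b} {s} b≤r b<s = ℕ.≤-trans (ℕ.≤-reflexive (cong₂ (λ x y → N s + x + y) (sym on) (sym (count-≡ root))))
      (ℕ.≤-trans (pack₃ (heavy? s) (_∈? legs b ts) (Fin._≟ root) all? _ _ _
        (λ w∈H w∈L → case ∈-legs⁻ b ts w∈L of λ where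
          (t , u , t<b , u∈ , refl) → ℕ.<⇒≱ b<s (ℕ.≤-trans (proj₁ (proj₂ w∈H)) (ℕ.≤-trans (anc-size u∈ (ℕ.<-≤-trans t<b b≤r)) t<b)))
        (λ where w∈H refl → proj₁ w∈H refl)
        (λ where w∈L refl → case ∈-legs⁻ b ts w∈L of λ where
                   (t , u , t<b , u∈ , e) → Tip.nonroot (tips u∈) t (ℕ.<-≤-trans t<b b≤r) (sym e)))
        (ℕ.≤-reflexive count-all))
      where
      on : count (_∈? legs b ts) ≡ b * k
      on = trans (count≡length (_∈? legs b ts) (legs-unique b≤r ts! id) id id) (length-legs b ts)

    heavy-spine : ∀ {s v} → r < s → Heavy s v → ¬ OnLeg v
    heavy-spine r<s (_ , s≤size , _) v∈ with ∈-legs⁻ r ts v∈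
    ... | t , u , t<r , u∈ , refl = ℕ.<⇒≱ r<s (ℕ.≤-trans s≤size (ℕ.≤-trans (anc-size u∈ t<r) t<r))

    p-peel : ∀ {v} → ¬ OnLeg v → p v ≡ 1 + count (λ w → (spine? w ×-dec (w ≼? v)) ×-dec ¬? (w Fin.≟ v))
    p-peel v-spine = count-peel (λ w → spine? w ×-dec (w ≼? _)) (v-spine , here)

    -- A heavy edge either leaves at most j tips below it, or at most j above it; the extreme
    -- edges of one kind bound the number of heavy edges.
    spine-bound : ∀ j j′ → j + j′ ≡ k → j ≤ j′ → j′ ≤ suc j → ∀ {s} → r < s → 0 < N s → N s + j′ * r + s ≤ n
    spine-bound j j′ j+j′ j≤j′ j′≤1+j {s} r<s N>0 with Fin.any? (λ v → heavy? s v ×-dec (l v ≤? j))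
    ... | yes some = low (argmin (λ v → heavy? s v ×-dec (l v ≤? j)) size some)
      where
      low : (∃ λ v → (Heavy s v × l v ≤ j) × (∀ w → Heavy s w × l w ≤ j → size v ≤ size w)) → N s + j′ * r + s ≤ n
      -- No proper descendant of `v` is heavy, so N s + p v ≤ M for the number M of spine vertices,
      -- while s ≤ size v ≤ p v + rj. Adding these and M + rk = n gives the bound.
      low (v , (v∈H , lv≤j) , v-min) = by≤ 0
        (ℕ.+-mono-≤ (ℕ.+-mono-≤
          (pack₃ (heavy? s) (λ w → (spine? w ×-dec (w ≼? v)) ×-dec ¬? (w Fin.≟ v)) (Fin._≟ root) spine?
            (heavy-spine r<s) (proj₁ ∘ proj₁) (λ where refl → root-spine)
            (λ w∈H ((_ , w≼v) , w≢v) → ℕ.<⇒≱ (size-strict w≼v w≢v) (v-min _ (w∈H , ℕ.≤-trans (l-mono w≼v) lv≤j)))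
            (λ where w∈H refl → proj₁ w∈H refl)
            (λ where ((_ , r≼v) , r≢v) refl → root-not-below (r≼v , r≢v)))
          (ℕ.*-monoʳ-≤ r lv≤j))
          (ℕ.≤-trans (proj₁ (proj₂ v∈H)) (ℕ.≤-reflexive (trans (size-spine (heavy-spine r<s v∈H)) (cong (_+ r * l v) (p-peel (heavy-spine r<s v∈H)))))))
        (trans (arith (N s) j j′ r s (count spine?) X (l v))
          (cong₂ (λ x y → x + (N s + X + y + r * l v + s))
            (trans (cong (λ x → count spine? + r * x) j+j′) count-spine) (sym (count-≡ root))))
        where
        X : ℕ
        X = count (λ w → (spine? w ×-dec (w ≼? v)) ×-dec ¬? (w Fin.≟ v))
        arith : ∀ a j j′ r s m x l → a + j′ * r + s + (m + r * j + (1 + x + r * l)) + 0 ≡ m + r * (j + j′) + (a + x + 1 + r * l + s)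
        arith = solve-∀
    ... | no none = high (argmax (heavy? s) size (count-witness (heavy? s) N>0))
      where
      many : ∀ {w} → Heavy s w → suc j ≤ l w
      many {w} w∈H = ℕ.≰⇒> λ le → none (w , w∈H , le)
      high : (∃ λ v → Heavy s v × (∀ w → Heavy s w → size w ≤ size v)) → N s + j′ * r + s ≤ n
      high (v , v∈H , v-max) = by≤ 0
        (ℕ.+-mono-≤ (ℕ.+-mono-≤ Ns≤pv (ℕ.≤-trans (proj₂ (proj₂ v∈H)) (ℕ.≤-reflexive (cosize-spine (heavy-spine r<s v∈H)))))
          (ℕ.*-monoʳ-≤ r l′≤j))
        (trans (arith (N s) j j′ r s (p v) (p′ v) (l′ v))
          (cong (_+ (N s + s + r * l′ v)) (trans (cong₂ (λ x y → x + r * y) (p+p′ v) j+j′) count-spine)))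
        where
        arith : ∀ a j j′ r s p q l → a + j′ * r + s + (p + (q + r * l) + r * j) + 0 ≡ p + q + r * (j + j′) + (a + s + r * l)
        arith = solve-∀
        l′≤j : l′ v ≤ j
        l′≤j = by≤ 0 (ℕ.+-mono-≤ (many v∈H) j′≤1+j) (trans (arith′ (l v) (l′ v) j) (trans (cong (_+ suc j) (trans (l+l′ v) (sym j+j′))) (arith″ j j′)))
          where
          arith′ : ∀ a b j → b + (a + suc j) + 0 ≡ a + b + suc j
          arith′ = solve-∀
          arith″ : ∀ j j′ → j + j′ + suc j ≡ j + (suc j + j′)
          arith″ = solve-∀
        inside : ∀ {w} → Heavy s w → w ≼ v
        inside {w} w∈H with w ≼? v | v ≼? w
        ... | yes w≼v | _      = w≼v
        ... | no w⋠v | yes v≼w = contradiction (v-max w w∈H) (ℕ.<⇒≱ (size-strict v≼w λ where refl → w⋠v here))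
        -- Each of two incomparable heavy vertices would have j + 1 tips below it, but k = j + j′ ≤
        -- 2j + 1.
        ... | no w⋠v | no v⋠w  = contradiction (ℕ.≤-trans (ℕ.+-mono-≤ (many w∈H) (many v∈H)) (l-disjoint w⋠v v⋠w))
          (ℕ.<⇒≱ (subst (_< suc j + suc j) j+j′ (s≤s (ℕ.+-monoʳ-≤ j j′≤1+j))))
        Ns≤pv : N s ≤ p v
        Ns≤pv = count-mono (heavy? s) (λ w → spine? w ×-dec (w ≼? v)) λ w∈H → heavy-spine r<s w∈H , inside w∈H

-- The extremal trees

≅-trans : ∀ {U V W : Set} {G : Graph U} {H : Graph V} {K : Graph W} → G ≅ H → H ≅ K → G ≅ K
≅-trans (f , p) (g , q) = ↔-trans f g , λ u v → mk⇔
  (λ e → Equivalence.to (q _ _) (Equivalence.to (p u v) e))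
  (λ e → Equivalence.from (p u v) (Equivalence.from (q _ _) e))

bijection : ∀ {V W : Set} (g : W → V) → (∀ {x y} → g x ≡ g y → x ≡ y) → (∀ v → ∃ λ x → g x ≡ v) → W ↔ V
bijection g inj surj = mk↔ₛ′ g (proj₁ ∘ surj) (proj₂ ∘ surj) (λ x → inj (proj₂ (surj (g x))))

-- Every edge is a parent edge, so preserving the root and parents is enough. The bijection runs
-- from the model to `G`, because that is the direction given by a formula.
rooted-≅ : ∀ {V W : Set} {G : Graph V} {H : Graph W} (R : Rooted G) (S : Rooted H) (e : W ↔ V) →
  Inverse.to e (Rooted.root S) ≡ Rooted.root R →
  (∀ x → x ≢ Rooted.root S → Inverse.to e (Rooted.par S x) ≡ Rooted.par R (Inverse.to e x)) → G ≅ H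
rooted-≅ {G = G} {H} R S e root≡ par≡ = ↔-sym e , λ u v → mk⇔ forth back
  where
  module R = Rooted R
  module S = Rooted S
  open Inverse e using (to; from; strictlyInverseˡ; strictlyInverseʳ)
  open Graph

  climb : ∀ {u v} → u ≢ R.root → R.par u ≡ v → from u ≢ S.root × S.par (from u) ≡ from v
  climb {u} {v} u≢ eq = from-u≢ , (begin
    S.par (from u)             ≡⟨ strictlyInverseʳ _ ⟨
    from (to (S.par (from u))) ≡⟨ cong from (par≡ (from u) from-u≢) ⟩
    from (R.par (to (from u))) ≡⟨ cong (from ∘ R.par) (strictlyInverseˡ u) ⟩
    from (R.par u)             ≡⟨ cong from eq ⟩
    from v                     ∎)
    where
    open ≡-Reasoning
    from-u≢ : from u ≢ S.root
    from-u≢ e′ = u≢ (trans (sym (strictlyInverseˡ u)) (trans (cong to e′) root≡))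

  forth : ∀ {u v} → _~_ G u v → _~_ H (from u) (from v)
  forth {u} {v} u~v with R.~-par u~v
  ... | inj₁ (u≢ , eq) = let u≢′ , eq′ = climb u≢ eq in subst (_~_ H (from u)) eq′ (S.par-~ u≢′)
  ... | inj₂ (v≢ , eq) = let v≢′ , eq′ = climb v≢ eq in ~-sym H (subst (_~_ H (from v)) eq′ (S.par-~ v≢′))

  descend : ∀ {x y} → x ≢ S.root → S.par x ≡ y → _~_ G (to x) (to y)
  descend {x} x≢ refl = subst (_~_ G (to x)) (sym (par≡ x x≢)) (R.par-~ λ e′ →
    x≢ (trans (sym (strictlyInverseʳ x)) (trans (cong from (trans e′ (sym root≡))) (strictlyInverseʳ _))))

  back : ∀ {u v} → _~_ H (from u) (from v) → _~_ G u v
  back {u} {v} x~y with S.~-par x~y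
  ... | inj₁ (x≢ , eq) = subst₂ (_~_ G) (strictlyInverseˡ u) (strictlyInverseˡ v) (descend x≢ eq)
  ... | inj₂ (y≢ , eq) = ~-sym G (subst₂ (_~_ G) (strictlyInverseˡ v) (strictlyInverseˡ u) (descend y≢ eq))

-- The Mostar index and minimality concern graphs on `Fin n`, while `A` has a sum type of vertices.
-- The rooted structure is transported along a numbering, and sizes are bounded below by exhibiting
-- lists of vertices of `H`.
module Copy {V : Set} {H : Graph V} (S : Rooted H) {n} (e : V ↔ Fin n) where
  open Inverse e using (to; from; strictlyInverseˡ; strictlyInverseʳ)
  module H = Graph H
  module S = Rooted S

  copy : Graph (Fin n)
  copy = record
    { _~_      = λ u v → from u H.~ from v
    ; _~?_     = λ u v → from u H.~? from v
    ; ~-sym    = H.~-sym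
    ; ~-irrefl = H.~-irrefl
    }

  to-injective : ∀ {x y} → to x ≡ to y → x ≡ y
  to-injective {x} {y} eq = trans (sym (strictlyInverseʳ x)) (trans (cong from eq) (strictlyInverseʳ y))

  from-≢root : ∀ {u} → u ≢ to S.root → from u ≢ S.root
  from-≢root {u} u≢ eq = u≢ (trans (sym (strictlyInverseˡ u)) (cong to eq))

  rooted : Rooted copy
  rooted = record
    { root       = to S.root
    ; par        = to ∘ S.par ∘ from
    ; depth      = S.depth ∘ from
    ; depth-root = trans (cong S.depth (strictlyInverseʳ _)) S.depth-root
    ; depth-par  = λ u≢ → trans (S.depth-par (from-≢root u≢)) (cong (suc ∘ S.depth) (sym (strictlyInverseʳ _)))
    ; par-~      = λ {u} u≢ → subst (from u H.~_) (sym (strictlyInverseʳ _)) (S.par-~ (from-≢root u≢))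
    ; ~-par      = λ {u} {v} u~v → Sum.map (child {u} {v}) (child {v} {u}) (S.~-par u~v)
    }
    where
    child : ∀ {u v} → from u ≢ S.root × S.par (from u) ≡ from v → u ≢ to S.root × to (S.par (from u)) ≡ v
    child {u} {v} (u≢ , eq) = (λ eq′ → u≢ (trans (cong from eq′) (strictlyInverseʳ _))) ,
      trans (cong to eq) (strictlyInverseˡ v)

  module C = RootedFin rooted

  to-~ : ∀ {x y} → x H.~ y → Graph._~_ copy (to x) (to y)
  to-~ = subst₂ H._~_ (sym (strictlyInverseʳ _)) (sym (strictlyInverseʳ _))

  to-par : ∀ x → C.par (to x) ≡ to (S.par x)
  to-par x = cong (to ∘ S.par) (strictlyInverseʳ x)

  to-anc : ∀ i x → C.anc i (to x) ≡ to (S.anc i x)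
  to-anc zero    x = refl
  to-anc (suc i) x = trans (cong C.par (to-anc i x)) (to-par (S.anc i x))

  to-≼ : ∀ {x y} → x S.≼ y → to x C.≼ to y
  to-≼ S.here              = C.here
  to-≼ {y = y} (S.up x≢ p) = C.up (x≢ ∘ to-injective) (subst (C._≼ to y) (sym (to-par _)) (to-≼ p))

  from-≼ : ∀ {u v} → u C.≼ v → from u S.≼ from v
  from-≼ C.here      = S.here
  from-≼ (C.up u≢ p) = S.up (from-≢root u≢) (subst (S._≼ _) (strictlyInverseʳ _) (from-≼ p))

  ≼-to : ∀ {x y} → to x C.≼ to y → x S.≼ y
  ≼-to p = subst₂ S._≼_ (strictlyInverseʳ _) (strictlyInverseʳ _) (from-≼ p)

  module _ {Q : Fin n → Set} (Q? : Decidable Q) where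

    count-to : ∀ {xs} → UniqueList xs → (∀ {x} → x ∈ xs → Q (to x)) → length xs ≤ count Q?
    count-to {xs} xs! xs⊆Q = ℕ.≤-trans (ℕ.≤-reflexive (sym (List.length-map to xs)))
      (length≤count Q? (Unique.map⁺ to-injective xs!) λ x∈ → case ∈-map⁻ to x∈ of λ where
        (x , x∈ , refl) → xs⊆Q x∈)

  size≥ : ∀ {v xs} → UniqueList xs → (∀ {x} → x ∈ xs → x S.≼ v) → length xs ≤ C.size (to v)
  size≥ xs! xs≼ = count-to (C._≼? _) xs! (to-≼ ∘ xs≼)

  cosize≥ : ∀ {v xs} → UniqueList xs → (∀ {x} → x ∈ xs → ¬ x S.≼ v) → length xs ≤ C.cosize (to v)
  cosize≥ xs! xs⋠ = count-to (λ w → ¬? (w C.≼? _)) xs! (λ x∈ p → xs⋠ x∈ (≼-to p))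

  to-tip : ∀ {r x} → Tip S r x → Tip rooted r (to x)
  to-tip {r} {x} tip = record
    { nonroot   = λ i lt eq → nonroot i lt (to-injective (trans (sym (to-anc i x)) eq))
    ; childless = λ w w≢ eq → childless (from w) (from-≢root w≢) (to-injective eq)
    ; onlychild = λ i lt w w≢ eq → trans (sym (strictlyInverseˡ w))
        (trans (cong to (onlychild i lt (from w) (from-≢root w≢) (to-injective (trans eq (to-anc (suc i) x)))))
          (sym (to-anc i x)))
    }
    where open Tip tip

  from-tip : ∀ {r x} → Tip rooted r (to x) → Tip S r x
  from-tip {r} {x} tip = record
    { nonroot   = λ i lt eq → nonroot i lt (trans (to-anc i x) (cong to eq))
    ; childless = λ w w≢ eq → childless (to w) (w≢ ∘ to-injective) (trans (to-par w) (cong to eq))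
    ; onlychild = λ i lt w w≢ eq → to-injective (trans
        (onlychild i lt (to w) (w≢ ∘ to-injective) (trans (to-par w) (trans (cong to eq) (sym (to-anc (suc i) x)))))
        (to-anc i x))
    }
    where open Tip tip

module _ {m} (q c : ℕ) (q+c≤m : q + c ≤ m) where

  segment-at : Fin c → Fin m
  segment-at t = fromℕ< (ℕ.<-≤-trans (ℕ.+-monoʳ-< q (Fin.toℕ<n t)) q+c≤m)

  toℕ-segment-at : ∀ t → toℕ (segment-at t) ≡ q + toℕ t
  toℕ-segment-at t = Fin.toℕ-fromℕ< _

  segment : List (Fin m)
  segment = tabulate segment-at

  length-segment : length segment ≡ c
  length-segment = List.length-tabulate segment-at

  segment-unique : UniqueList segment
  segment-unique = Unique.tabulate⁺ λ {s} {t} eq → Fin.toℕ-injective (ℕ.+-cancelˡ-≡ q _ _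
    (trans (sym (toℕ-segment-at s)) (trans (cong toℕ eq) (toℕ-segment-at t))))

  ∈-segment : ∀ {i} → i ∈ segment → q ≤ toℕ i × toℕ i < q + c
  ∈-segment i∈ with ∈-tabulate⁻ i∈
  ... | t , refl = subst (q ≤_) (sym (toℕ-segment-at t)) (ℕ.m≤m+n q _) ,
    subst (_< q + c) (sym (toℕ-segment-at t)) (ℕ.+-monoʳ-< q (Fin.toℕ<n t))

toℕ-pred : ∀ {m} (i : Fin m) → toℕ (Fin.pred i) ≡ pred (toℕ i)
toℕ-pred Fin.zero    = refl
toℕ-pred (Fin.suc i) = Fin.toℕ-inject₁ i

module PathTree (m : ℕ) where

  rooted : Rooted (P (suc m))
  rooted = record
    { root       = Fin.zero
    ; par        = Fin.pred
    ; depth      = toℕ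
    ; depth-root = refl
    ; depth-par  = suc-pred
    ; par-~      = λ i≢ → inj₂ (sym (suc-pred i≢))
    ; ~-par      = [ (λ eq → inj₂ (child eq)) , (λ eq → inj₁ (child eq)) ]
    }
    where
    suc-pred : ∀ {i : Fin (suc m)} → i ≢ Fin.zero → toℕ i ≡ suc (toℕ (Fin.pred i))
    suc-pred {Fin.zero}  i≢ = contradiction refl i≢
    suc-pred {Fin.suc i} i≢ = cong suc (sym (Fin.toℕ-inject₁ i))
    child : ∀ {i j : Fin (suc m)} → suc (toℕ i) ≡ toℕ j → j ≢ Fin.zero × Fin.pred j ≡ i
    child {i} {j} eq = (λ where refl → ℕ.1+n≢0 eq) ,
      Fin.toℕ-injective (trans (toℕ-pred j) (cong pred (sym eq)))

  open RootedFin rooted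

  ≤⇒≼ : ∀ {i j : Fin (suc m)} → toℕ j ≤ toℕ i → i ≼ j
  ≤⇒≼ {i} {j} le = go (toℕ i) refl le
    where
    go : ∀ d {i} → toℕ i ≡ d → toℕ j ≤ d → i ≼ j
    go d {i} eq le with i Fin.≟ j
    ... | yes refl = here
    go zero    {i} eq le | no i≢j = contradiction (Fin.toℕ-injective (trans eq (sym (ℕ.n≤0⇒n≡0 le)))) i≢j
    go (suc d) {i} eq le | no i≢j = up (λ where refl → ℕ.1+n≢0 (sym eq))
      (go d (trans (toℕ-pred i) (cong pred eq))
        (s≤s⁻¹ (ℕ.≤∧≢⇒< le λ eq′ → i≢j (Fin.toℕ-injective (trans eq (sym eq′))))))

  -- The vertex at position i has i vertices on the root side and n - i on its own, so positions s,
  -- ..., s + X - 1 are heavy. With X = n + 1 - 2s this meets `heavy-bound`.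
  N≥ : ∀ s {X} → 1 ≤ s → X + 2 * s ≤ suc (suc m) → X ≤ N s
  N≥ s {X} 1≤s bound = ℕ.≤-trans (ℕ.≤-reflexive (sym (length-segment s X fits)))
    (length≤count (heavy? s) (segment-unique s X fits) λ {i} i∈ →
      let s≤i , i<s+X = ∈-segment s X fits i∈
          i≤m = ℕ.<⇒≤ (Fin.toℕ<n i)
          whole = ℕ.m+[n∸m]≡n i≤m
      in (λ where refl → ℕ.<⇒≱ 1≤s s≤i) ,
         ℕ.≤-trans (upper (toℕ i) (suc m ∸ toℕ i) i<s+X whole)
           (ℕ.≤-trans (ℕ.≤-reflexive (sym (length-segment (toℕ i) _ (ℕ.≤-reflexive whole))))
             (length≤count (_≼? i) (segment-unique (toℕ i) _ (ℕ.≤-reflexive whole))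
               (λ x∈ → ≤⇒≼ (proj₁ (∈-segment (toℕ i) _ (ℕ.≤-reflexive whole) x∈))))) ,
         ℕ.≤-trans s≤i (ℕ.≤-trans (ℕ.≤-reflexive (sym (length-segment 0 (toℕ i) i≤m)))
           (length≤count (λ w → ¬? (w ≼? i)) (segment-unique 0 (toℕ i) i≤m)
             (λ x∈ p → ℕ.<⇒≱ (proj₂ (∈-segment 0 (toℕ i) i≤m x∈)) (≼-depth p)))))
    where
    fits : s + X ≤ suc m
    fits = s≤s⁻¹ (ℕ.≤-trans (by≤ (pred s) (ℕ.≤-refl {0}) (arith s 1≤s)) bound)
      where
      arith : ∀ s → 1 ≤ s → suc (s + X) + 0 + pred s ≡ X + 2 * s + 0
      arith (suc s) _ = arith′ s X
        where
        arith′ : ∀ s X → suc (suc s + X) + 0 + s ≡ X + 2 * suc s + 0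
        arith′ = solve-∀
    upper : ∀ q c → q < s + X → q + c ≡ suc m → s ≤ c
    upper q c lt eq = by≤ 0 (ℕ.+-mono-≤ lt bound)
      (trans (arith s X m) (trans (cong (λ x → suc x + (X + 2 * s)) (sym eq)) (arith′ q c (X + 2 * s))))
      where
      arith : ∀ s X m → s + (s + X + suc (suc m)) + 0 ≡ suc (suc m) + (X + 2 * s)
      arith = solve-∀
      arith′ : ∀ q c y → suc (q + c) + y ≡ c + (suc q + y)
      arith′ = solve-∀

-- Sides of the edges of A(n, r, a, b)

module DoubleTree (n r a b : ℕ) (1≤r : 1 ≤ r) (1≤a : 1 ≤ a) (1≤b : 1 ≤ b) (fits : (a + b) * r + 2 ≤ n) where
  open Double n r a b

  2≤m : 2 ≤ m
  2≤m = ℕ.m+n≤o⇒m≤o∸n 2 (subst (_≤ n) (ℕ.+-comm ((a + b) * r) 2) fits)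

  m+legs : m + (a + b) * r ≡ n
  m+legs = ℕ.m∸n+n≡m (ℕ.m+n≤o⇒m≤o ((a + b) * r) fits)

  suc-pred : ∀ {x} → x ≢ 0 → suc (pred x) ≡ x
  suc-pred {zero}  x≢ = contradiction refl x≢
  suc-pred {suc x} x≢ = refl

  suc-pred-m : suc (pred m) ≡ m
  suc-pred-m = suc-pred (λ m≡0 → ℕ.<⇒≱ 2≤m (subst (_≤ 1) (sym m≡0) z≤n))

  first last : Fin m
  first = fromℕ< (ℕ.<⇒≤ 2≤m)
  last  = fromℕ< (ℕ.≤-reflexive suc-pred-m)

  toℕ-first : toℕ first ≡ 0
  toℕ-first = Fin.toℕ-fromℕ< _

  toℕ-last : suc (toℕ last) ≡ m
  toℕ-last = trans (cong suc (Fin.toℕ-fromℕ< _)) suc-pred-m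

  foot : Leg → Fin m
  foot (inj₁ _) = first
  foot (inj₂ _) = last

  attached-foot : ∀ l → AttachedAt l (foot l)
  attached-foot (inj₁ _) = toℕ-first
  attached-foot (inj₂ _) = toℕ-last

  attached⇒foot : ∀ l {i} → AttachedAt l i → foot l ≡ i
  attached⇒foot (inj₁ _) e = Fin.toℕ-injective (trans toℕ-first (sym e))
  attached⇒foot (inj₂ _) e = Fin.toℕ-injective (ℕ.suc-injective (trans toℕ-last (sym e)))

  parent : Vertex → Vertex
  parent (inj₁ i)               = inj₁ (Fin.pred i)
  parent (inj₂ (l , Fin.zero))  = inj₁ (foot l)
  parent (inj₂ (l , Fin.suc s)) = inj₂ (l , inject₁ s)

  depthᵈ : Vertex → ℕ
  depthᵈ (inj₁ i)       = toℕ i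
  depthᵈ (inj₂ (l , s)) = suc (toℕ (foot l) + toℕ s)

  ≢first : ∀ {i} → inj₁ i ≢ inj₁ {B = Leg × Fin r} first → toℕ i ≢ 0
  ≢first i≢ e = i≢ (cong inj₁ (Fin.toℕ-injective (trans e (sym toℕ-first))))

  spine-child : ∀ {i j} → suc (toℕ i) ≡ toℕ j → inj₁ j ≢ inj₁ {B = Leg × Fin r} first × parent (inj₁ j) ≡ inj₁ i
  spine-child {i} {j} e = (λ where refl → ℕ.1+n≢0 (trans e toℕ-first)) ,
    cong inj₁ (Fin.toℕ-injective (trans (toℕ-pred j) (cong pred (sym e))))

  leg-child : ∀ {l s t} → suc (toℕ s) ≡ toℕ t → parent (inj₂ (l , t)) ≡ inj₂ (l , s)
  leg-child {l} {s} {Fin.suc t} e = cong (λ x → inj₂ (l , x)) (Fin.toℕ-injective (trans (Fin.toℕ-inject₁ t) (sym (ℕ.suc-injective e))))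

  leg-root : ∀ {l i s} → AttachedAt l i → toℕ s ≡ 0 → parent (inj₂ (l , s)) ≡ inj₁ i
  leg-root {l} {s = Fin.zero} at _ = cong inj₁ (attached⇒foot l at)

  private
    depth-parent : ∀ {v} → v ≢ inj₁ first → depthᵈ v ≡ suc (depthᵈ (parent v))
    depth-parent {inj₁ i} v≢ = sym (trans (cong suc (toℕ-pred i)) (suc-pred (≢first v≢)))
    depth-parent {inj₂ (l , Fin.zero)}  v≢ = cong suc (ℕ.+-identityʳ _)
    depth-parent {inj₂ (l , Fin.suc s)} v≢ = cong suc (trans (ℕ.+-suc _ _)
      (cong (λ x → suc (toℕ (foot l) + x)) (sym (Fin.toℕ-inject₁ s))))

    adj-parent : ∀ {v} → v ≢ inj₁ first → Adj v (parent v)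
    adj-parent {inj₁ i} v≢ = inj₂ (trans (cong suc (toℕ-pred i)) (suc-pred (≢first v≢)))
    adj-parent {inj₂ (l , Fin.zero)}  v≢ = attached-foot l , refl
    adj-parent {inj₂ (l , Fin.suc s)} v≢ = refl , inj₂ (cong suc (Fin.toℕ-inject₁ s))

    parent-adj : ∀ {u v} → Adj u v → (u ≢ inj₁ first × parent u ≡ v) ⊎ (v ≢ inj₁ first × parent v ≡ u)
    parent-adj {inj₁ i} {inj₁ j} (inj₁ e) = inj₂ (spine-child e)
    parent-adj {inj₁ i} {inj₁ j} (inj₂ e) = inj₁ (spine-child e)
    parent-adj {inj₁ i} {inj₂ (l , s)} (at , e) = inj₂ ((λ ()) , leg-root at e)
    parent-adj {inj₂ (l , s)} {inj₁ i} (at , e) = inj₁ ((λ ()) , leg-root at e)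
    parent-adj {inj₂ (l , s)} {inj₂ (_ , t)} (refl , inj₁ e) = inj₂ ((λ ()) , leg-child e)
    parent-adj {inj₂ (l , s)} {inj₂ (_ , t)} (refl , inj₂ e) = inj₁ ((λ ()) , leg-child e)

  rootedᵈ : Rooted (A n r a b)
  rootedᵈ = record
    { root       = inj₁ first
    ; par        = parent
    ; depth      = depthᵈ
    ; depth-root = toℕ-first
    ; depth-par  = λ {v} → depth-parent {v}
    ; par-~      = λ {v} → adj-parent {v}
    ; ~-par      = λ {u} {v} → parent-adj {u} {v}
    }

  abstract
    enumeration : Vertex ↔ Fin n
    enumeration = subst (λ x → Vertex ↔ Fin x) m+legs
      (↔-trans (↔-refl ⊎-↔ ↔-trans (↔-sym Fin.+↔⊎ ×-↔ ↔-refl) (↔-sym Fin.*↔×)) (↔-sym Fin.+↔⊎))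

  open Copy rootedᵈ enumeration public
  open Inverse enumeration using (to; from; strictlyInverseˡ; strictlyInverseʳ)

  spine-≼ : ∀ {i j} → toℕ j ≤ toℕ i → inj₁ i S.≼ inj₁ j
  spine-≼ {i} {j} le = go (toℕ i) refl le
    where
    go : ∀ d {i} → toℕ i ≡ d → toℕ j ≤ d → inj₁ i S.≼ inj₁ j
    go d {i} eq le with i Fin.≟ j
    ... | yes refl = S.here
    go zero    {i} eq le | no i≢j = contradiction (Fin.toℕ-injective (trans eq (sym (ℕ.n≤0⇒n≡0 le)))) i≢j
    go (suc d) {i} eq le | no i≢j = S.up (λ where refl → ℕ.1+n≢0 (trans (sym eq) toℕ-first))
      (go d (trans (toℕ-pred i) (cong pred eq))
        (s≤s⁻¹ (ℕ.≤∧≢⇒< le λ eq′ → i≢j (Fin.toℕ-injective (trans eq (sym eq′))))))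

  leg-≼-foot : ∀ {l} s → inj₂ (l , s) S.≼ inj₁ (foot l)
  leg-≼-foot {l} s = go (toℕ s) refl
    where
    go : ∀ d {s} → toℕ s ≡ d → inj₂ (l , s) S.≼ inj₁ (foot l)
    go zero    {Fin.zero}  eq = S.up (λ ()) S.here
    go (suc d) {Fin.suc s} eq = S.up (λ ()) (go d (trans (Fin.toℕ-inject₁ s) (ℕ.suc-injective eq)))

  leg-≼ : ∀ {l s t} → toℕ t ≤ toℕ s → inj₂ (l , s) S.≼ inj₂ (l , t)
  leg-≼ {l} {s} {t} le = go (toℕ s) refl le
    where
    go : ∀ d {s} → toℕ s ≡ d → toℕ t ≤ d → inj₂ (l , s) S.≼ inj₂ (l , t)
    go d {s} eq le with s Fin.≟ t
    ... | yes refl = S.here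
    go zero    {Fin.zero}  eq le | no s≢t = contradiction (Fin.toℕ-injective (sym (ℕ.n≤0⇒n≡0 le))) s≢t
    go (suc d) {Fin.suc s} eq le | no s≢t = S.up (λ ()) (go d (trans (Fin.toℕ-inject₁ s) (ℕ.suc-injective eq))
      (s≤s⁻¹ (ℕ.≤∧≢⇒< le λ eq′ → s≢t (Fin.toℕ-injective (trans eq (sym eq′))))))

  position : Vertex → ℕ
  position (inj₁ i)       = toℕ i
  position (inj₂ (l , _)) = toℕ (foot l)

  ≼-position : ∀ {w i} → w S.≼ inj₁ i → toℕ i ≤ position w
  ≼-position S.here = ℕ.≤-refl
  ≼-position {inj₁ j} (S.up _ p) = ℕ.≤-trans (≼-position p) (ℕ.≤-trans (ℕ.≤-reflexive (toℕ-pred j)) ℕ.pred[n]≤n)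
  ≼-position {inj₂ (l , Fin.zero)}  (S.up _ p) = ≼-position p
  ≼-position {inj₂ (l , Fin.suc s)} (S.up _ p) = ≼-position p

  ≼-leg : ∀ {w l s} → w S.≼ inj₂ (l , s) → ∃ λ t → w ≡ inj₂ (l , t)
  ≼-leg S.here = _ , refl
  ≼-leg {inj₁ i} (S.up _ p) with ≼-leg p
  ... | _ , ()
  ≼-leg {inj₂ (l , Fin.zero)} (S.up _ p) with ≼-leg p
  ... | _ , ()
  ≼-leg {inj₂ (l , Fin.suc s)} (S.up _ p) with ≼-leg p
  ... | _ , refl = _ , refl

  allLegs : List Leg
  allLegs = map inj₁ (allFin a) ++ map inj₂ (allFin b)

  inj-disjoint : ∀ {U V : Set} (xs : List U) (ys : List V) {z} → z ∈ map inj₁ xs × z ∈ map inj₂ ys → ⊥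
  inj-disjoint xs ys (p , q) with ∈-map⁻ inj₁ p | ∈-map⁻ inj₂ q
  ... | _ , _ , refl | _ , _ , ()

  unique-⊎ : ∀ {U V : Set} {xs : List U} {ys : List V} → UniqueList xs → UniqueList ys →
    UniqueList (map inj₁ xs ++ map inj₂ ys)
  unique-⊎ {xs = xs} {ys} xs! ys! = Unique.++⁺ (Unique.map⁺ inj₁-injective xs!) (Unique.map⁺ inj₂-injective ys!) (inj-disjoint xs ys)

  length-⊎ : ∀ {U V : Set} (xs : List U) (ys : List V) → length (map (inj₁ {B = V}) xs ++ map inj₂ ys) ≡ length xs + length ys
  length-⊎ xs ys = trans (List.length-++ (map inj₁ xs)) (cong₂ _+_ (List.length-map inj₁ xs) (List.length-map inj₂ ys))

  allLegs-unique : UniqueList allLegs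
  allLegs-unique = unique-⊎ (Unique.allFin⁺ a) (Unique.allFin⁺ b)

  length-allFin : ∀ x → length (allFin x) ≡ x
  length-allFin x = List.length-tabulate id

  length-allLegs : length allLegs ≡ a + b
  length-allLegs = trans (length-⊎ (allFin a) (allFin b)) (cong₂ _+_ (length-allFin a) (length-allFin b))

  vertices : List (Fin m) → List Leg → List (Fin r) → List Vertex
  vertices is ls ss = map inj₁ is ++ map inj₂ (cartesianProduct ls ss)

  vertices-unique : ∀ {is ls ss} → UniqueList is → UniqueList ls → UniqueList ss → UniqueList (vertices is ls ss)
  vertices-unique is! ls! ss! = unique-⊎ is! (Unique.cartesianProduct⁺ ls! ss!)

  length-vertices : ∀ is ls ss → length (vertices is ls ss) ≡ length is + length ls * length ss
  length-vertices is ls ss = trans (length-⊎ is (cartesianProduct ls ss)) (cong (length is +_) (length-cartesianProduct ls ss))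

  vertices-elim : ∀ {is ls ss} (Q : Vertex → Set) → (∀ {i} → i ∈ is → Q (inj₁ i)) →
    (∀ {l s} → l ∈ ls → s ∈ ss → Q (inj₂ (l , s))) → ∀ {x} → x ∈ vertices is ls ss → Q x
  vertices-elim {is} {ls} {ss} Q f g x∈ with ∈-++⁻ (map inj₁ is) x∈
  ... | inj₁ p with ∈-map⁻ inj₁ p
  ...   | i , i∈ , refl = f i∈
  vertices-elim {is} {ls} {ss} Q f g x∈ | inj₂ p with ∈-map⁻ inj₂ p
  ... | (l , s) , ls∈ , refl = let l∈ , s∈ = ∈-cartesianProduct⁻ ls ss ls∈ in g l∈ s∈

  -- `c` is the number m - i of path vertices from `i` on. They and the `b` legs at v_m are below
  -- `i`, because v₁ is the root.
  spine-size : ∀ i c → toℕ i + c ≡ m → c + b * r ≤ C.size (to (inj₁ i))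
  spine-size i c e = subst (_≤ C.size (to (inj₁ i))) len
    (size≥ {xs = xs} (vertices-unique {ls = right} (segment-unique (toℕ i) c le) (Unique.map⁺ inj₂-injective (Unique.allFin⁺ b)) (Unique.allFin⁺ r))
      (vertices-elim {ls = right} (S._≼ inj₁ i)
        (λ j∈ → spine-≼ (proj₁ (∈-segment (toℕ i) c le j∈)))
        (λ l∈ _ → case ∈-map⁻ inj₂ l∈ of λ where
          (y , _ , refl) → S.≼-trans (leg-≼-foot _) (spine-≼ (s≤s⁻¹ (ℕ.≤-trans (Fin.toℕ<n i) (ℕ.≤-reflexive (sym toℕ-last))))))))
    where
    le : toℕ i + c ≤ m
    le = ℕ.≤-reflexive e
    seg : List (Fin m)
    seg = segment (toℕ i) c le
    right : List Leg
    right = map inj₂ (allFin b)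
    xs : List Vertex
    xs = vertices seg right (allFin r)
    len : length xs ≡ c + b * r
    len = trans (length-vertices seg right (allFin r))
      (cong₂ _+_ (length-segment (toℕ i) c le) (cong₂ _*_ (trans (List.length-map inj₂ (allFin b)) (length-allFin b)) (length-allFin r)))

  spine-cosize : ∀ i → 1 ≤ toℕ i → toℕ i + a * r ≤ C.cosize (to (inj₁ i))
  spine-cosize i 1≤i = subst (_≤ C.cosize (to (inj₁ i))) len
    (cosize≥ {xs = xs} (vertices-unique {ls = left} (segment-unique 0 (toℕ i) le) (Unique.map⁺ inj₁-injective (Unique.allFin⁺ a)) (Unique.allFin⁺ r))
      (vertices-elim {ls = left} (λ x → ¬ x S.≼ inj₁ i)
        (λ j∈ p → ℕ.<⇒≱ (proj₂ (∈-segment 0 (toℕ i) le j∈)) (≼-position p))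
        (λ l∈ _ p → case ∈-map⁻ inj₁ l∈ of λ where
          (y , _ , refl) → ℕ.<⇒≱ 1≤i (ℕ.≤-trans (≼-position p) (ℕ.≤-reflexive toℕ-first)))))
    where
    le : 0 + toℕ i ≤ m
    le = ℕ.<⇒≤ (Fin.toℕ<n i)
    seg : List (Fin m)
    seg = segment 0 (toℕ i) le
    left : List Leg
    left = map inj₁ (allFin a)
    xs : List Vertex
    xs = vertices seg left (allFin r)
    len : length xs ≡ toℕ i + a * r
    len = trans (length-vertices seg left (allFin r))
      (cong₂ _+_ (length-segment 0 (toℕ i) le) (cong₂ _*_ (trans (List.length-map inj₁ (allFin a)) (length-allFin a)) (length-allFin r)))

  onLeg : Leg → Fin r → Vertex
  onLeg l s = inj₂ (l , s)

  onLeg-injective : ∀ {l s t} → onLeg l s ≡ onLeg l t → s ≡ t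
  onLeg-injective refl = refl

  leg-size : ∀ l s c → toℕ s + c ≡ r → c ≤ C.size (to (inj₂ (l , s)))
  leg-size l s c e = subst (_≤ C.size (to (inj₂ (l , s))))
    (trans (List.length-map (onLeg l) seg) (length-segment (toℕ s) c le))
    (size≥ {xs = map (onLeg l) seg} (Unique.map⁺ onLeg-injective (segment-unique (toℕ s) c le))
      λ x∈ → case ∈-map⁻ (onLeg l) x∈ of λ where
        (t , t∈ , refl) → leg-≼ (proj₁ (∈-segment (toℕ s) c le t∈)))
    where
    le : toℕ s + c ≤ r
    le = ℕ.≤-reflexive e
    seg : List (Fin r)
    seg = segment (toℕ s) c le

  otherLeg : ∀ (l : Leg) → ∃ λ l′ → l′ ≢ l
  otherLeg (inj₁ _) = inj₂ (fromℕ< 1≤b) , λ ()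
  otherLeg (inj₂ _) = inj₁ (fromℕ< 1≤a) , λ ()

  -- An entire second leg lies outside. This is enough, because vertices of legs are considered only
  -- for s ≤ r.
  leg-cosize : ∀ l s → r ≤ C.cosize (to (inj₂ (l , s)))
  leg-cosize l s with otherLeg l
  ... | l′ , l′≢l = subst (_≤ C.cosize (to (inj₂ (l , s))))
    (trans (List.length-map (onLeg l′) (allFin r)) (length-allFin r))
    (cosize≥ {xs = map (onLeg l′) (allFin r)} (Unique.map⁺ onLeg-injective (Unique.allFin⁺ r))
      λ x∈ p → case ∈-map⁻ (onLeg l′) x∈ of λ where
        (t , _ , refl) → case ≼-leg p of λ where
          (_ , refl) → l′≢l refl)

  branching : 2 ≤ a → 3 ≤ degree copy C.root
  branching 2≤a = three≤degree copy {to (inj₁ first)} {to (inj₂ (inj₁ x₀ , s₀))} {to (inj₂ (inj₁ x₁ , s₀))} {to (inj₁ second)}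
    (to-~ {inj₁ first} {inj₂ (inj₁ x₀ , s₀)} (toℕ-first , toℕ-s₀))
    (to-~ {inj₁ first} {inj₂ (inj₁ x₁ , s₀)} (toℕ-first , toℕ-s₀))
    (to-~ {inj₁ first} {inj₁ second} (inj₁ (trans (cong suc toℕ-first) (sym (Fin.toℕ-fromℕ< 2≤m)))))
    (λ e → ℕ.1+n≢0 (trans (sym (Fin.toℕ-fromℕ< 2≤a)) (trans (cong toℕ (sym (leg-label (to-injective e)))) (Fin.toℕ-fromℕ< 1≤a))))
    (λ e → case to-injective e of λ ())
    (λ e → case to-injective e of λ ())
    where
    leg-label : ∀ {x y s t} → onLeg (inj₁ x) s ≡ onLeg (inj₁ y) t → x ≡ y
    leg-label refl = refl
    x₀ x₁ : Fin a
    x₀ = fromℕ< 1≤a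
    x₁ = fromℕ< 2≤a
    s₀ : Fin r
    s₀ = fromℕ< 1≤r
    toℕ-s₀ : toℕ s₀ ≡ 0
    toℕ-s₀ = Fin.toℕ-fromℕ< 1≤r
    second : Fin m
    second = fromℕ< 2≤m

  -- For s ≤ r the m - 1 path vertices other than v₁ are heavy and, on each leg, the r - s + 1
  -- vertices nearest its foot; their number is what the first bound permits at β = s - 1. For s > r
  -- an interval of `X` path vertices is heavy, and the bounds say that it fits.
  N≥ : b ≤ a → ∀ s X → 1 ≤ s → (∀ β → β ≤ r → β < s → X + β * (a + b) + 1 ≤ n) →
    (0 < X → X + 2 * s ≤ suc n) → (r < s → 0 < X → X + a * r + s ≤ n) → X ≤ C.N s
  N≥ b≤a s zero 1≤s legs both spine = z≤n
  N≥ b≤a s@(suc s′) X@(suc _) 1≤s legs both spine with s ≤? r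
  ... | yes s≤r = ℕ.≤-trans enough (subst (_≤ C.N s) len
      (count-to (C.heavy? s) {xs = vertices (segment 1 (pred m) spine-le) allLegs (segment 0 c legs-le)} (vertices-unique {ls = allLegs} (segment-unique 1 (pred m) spine-le) allLegs-unique (segment-unique 0 c legs-le))
        (vertices-elim {ls = allLegs} (C.Heavy s ∘ to) spine-heavy (λ _ → leg-heavy))))
    where
    c : ℕ
    c = r ∸ s′
    c+s′ : c + s′ ≡ r
    c+s′ = ℕ.m∸n+n≡m (ℕ.<⇒≤ s≤r)
    spine-le : 1 + pred m ≤ m
    spine-le = ℕ.≤-reflexive suc-pred-m
    legs-le : 0 + c ≤ r
    legs-le = ℕ.m∸n≤m r s′
    len : length (vertices (segment 1 (pred m) spine-le) allLegs (segment 0 c legs-le)) ≡ pred m + (a + b) * c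
    len = trans (length-vertices (segment 1 (pred m) spine-le) allLegs (segment 0 c legs-le))
      (cong₂ _+_ (length-segment 1 (pred m) spine-le) (cong₂ _*_ length-allLegs (length-segment 0 c legs-le)))
    enough : X ≤ pred m + (a + b) * c
    enough = by≤ 0 (legs s′ (ℕ.<⇒≤ s≤r) ℕ.≤-refl) (trans (cong (λ x → X + x + 0) (trans (sym m+legs) (cong₂ (λ x y → x + (a + b) * y)
      (sym suc-pred-m) (sym c+s′)))) (arith X (pred m) (a + b) c s′))
      where
      arith : ∀ X q k c s → X + (suc q + k * (c + s)) + 0 ≡ q + k * c + (X + s * k + 1)
      arith = solve-∀
    spine-heavy : ∀ {i} → i ∈ segment 1 (pred m) spine-le → C.Heavy s (to (inj₁ i))
    spine-heavy {i} i∈ = (λ e → ℕ.<⇒≱ 1≤i (ℕ.≤-reflexive (trans (cong toℕ (inj₁-injective (to-injective e))) toℕ-first))) ,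
      ℕ.≤-trans s≤r (ℕ.≤-trans (ℕ.≤-trans (times 1≤b) (ℕ.m≤n+m (b * r) (m ∸ toℕ i)))
        (spine-size i (m ∸ toℕ i) (ℕ.m+[n∸m]≡n (ℕ.<⇒≤ (Fin.toℕ<n i))))) ,
      ℕ.≤-trans s≤r (ℕ.≤-trans (ℕ.≤-trans (times 1≤a) (ℕ.m≤n+m (a * r) (toℕ i))) (spine-cosize i 1≤i))
      where
      1≤i : 1 ≤ toℕ i
      1≤i = proj₁ (∈-segment 1 (pred m) spine-le i∈)
      times : ∀ {x} → 1 ≤ x → r ≤ x * r
      times {x} 1≤x = ℕ.≤-trans (ℕ.≤-reflexive (sym (ℕ.*-identityˡ r))) (ℕ.*-monoˡ-≤ r 1≤x)
    leg-heavy : ∀ {l t} → t ∈ segment 0 c legs-le → C.Heavy s (to (inj₂ (l , t)))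
    leg-heavy {l} {t} t∈ = (λ e → case to-injective e of λ ()) ,
      ℕ.≤-trans (by≤ 0 (proj₂ (∈-segment 0 c legs-le t∈)) (trans (arith s′ c)
        (trans (cong suc (trans c+s′ (sym whole))) (arith′ (toℕ t) (r ∸ toℕ t)))))
        (leg-size l t (r ∸ toℕ t) whole) ,
      ℕ.≤-trans s≤r (leg-cosize l t)
      where
      whole : toℕ t + (r ∸ toℕ t) ≡ r
      whole = ℕ.m+[n∸m]≡n (ℕ.<⇒≤ (Fin.toℕ<n t))
      arith : ∀ s c → suc s + c + 0 ≡ suc (c + s)
      arith = solve-∀
      arith′ : ∀ t x → suc (t + x) ≡ x + suc t
      arith′ = solve-∀
  ... | no s≰r = subst (_≤ C.N s) (trans (List.length-map inj₁ (segment lo X lo-le)) (length-segment lo X lo-le))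
      (count-to (C.heavy? s) {xs = map inj₁ (segment lo X lo-le)} (Unique.map⁺ inj₁-injective (segment-unique lo X lo-le)) λ x∈ → case ∈-map⁻ inj₁ x∈ of λ where
        (i , i∈ , refl) → heavy i (∈-segment lo X lo-le i∈))
    where
    r<s : r < s
    r<s = ℕ.≰⇒> s≰r
    lo : ℕ
    -- Position i ≥ 1 has i + ar vertices on its root side, so this is the first nonroot position at
    -- which that side reaches `s`. If it is 1, `lo-le` uses the leg bound and `hi-le` the spine
    -- bound; otherwise `lo-le` uses the spine bound with `b≤a`, and `hi-le` the bound with 2s.
    lo = 1 ⊔ (s ∸ a * r)
    lo-cases : lo ≡ 1 ⊎ lo + a * r ≡ s
    lo-cases with ℕ.≤-total (s ∸ a * r) 1
    ... | inj₁ le = inj₁ (ℕ.m≥n⇒m⊔n≡m le)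
    ... | inj₂ ge = inj₂ (trans (cong (_+ a * r) (ℕ.m≤n⇒m⊔n≡n ge))
      (ℕ.m∸n+n≡m (ℕ.<⇒≤ (ℕ.m∸n≢0⇒n<m {s} {a * r} λ e → ℕ.<⇒≱ ge (subst (_≤ 0) (sym e) z≤n)))))
    n≡ : n ≡ m + (a + b) * r
    n≡ = sym m+legs
    c-bound : X + a * r + s ≤ m + (a + b) * r
    c-bound = subst (X + a * r + s ≤_) n≡ (spine r<s z<s)
    lo-le : lo + X ≤ m
    lo-le with lo-cases
    ... | inj₁ e = subst (λ x → x + X ≤ m) (sym e) (by≤ 0 (subst (X + r * (a + b) + 1 ≤_) n≡ (legs r ℕ.≤-refl r<s)) (arith X m a b r))
      where
      arith : ∀ X m a b r → 1 + X + (m + (a + b) * r) + 0 ≡ m + (X + r * (a + b) + 1)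
      arith = solve-∀
    ... | inj₂ e = by≤ 0 (ℕ.+-mono-≤ (subst (λ x → X + a * r + x ≤ m + (a + b) * r) (sym e) c-bound) (ℕ.*-monoˡ-≤ r b≤a)) (arith lo X m a b r)
      where
      arith : ∀ q X m a b r → q + X + (m + (a + b) * r + a * r) + 0 ≡ m + (X + a * r + (q + a * r) + b * r)
      arith = solve-∀
    hi-le : lo + X + s ≤ m + b * r + 1
    hi-le with lo-cases
    ... | inj₁ e = subst (λ x → x + X + s ≤ m + b * r + 1) (sym e) (by≤ 0 c-bound (arith X s m a b r))
      where
      arith : ∀ X s m a b r → 1 + X + s + (m + (a + b) * r) + 0 ≡ m + b * r + 1 + (X + a * r + s)
      arith = solve-∀
    ... | inj₂ e = by≤ 0 (subst₂ (λ x y → X + 2 * x ≤ suc y) (sym e) n≡ (both z<s))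
      (trans (cong (λ x → lo + X + x + suc (m + (a + b) * r) + 0) (sym e)) (arith lo X m a b r))
      where
      arith : ∀ q X m a b r → q + X + (q + a * r) + suc (m + (a + b) * r) + 0 ≡ m + b * r + 1 + (X + 2 * (q + a * r))
      arith = solve-∀
    heavy : ∀ i → lo ≤ toℕ i × toℕ i < lo + X → C.Heavy s (to (inj₁ i))
    heavy i (lo≤i , i<) = (λ e → ℕ.<⇒≱ 1≤i (ℕ.≤-reflexive (trans (cong toℕ (inj₁-injective (to-injective e))) toℕ-first))) ,
      ℕ.≤-trans (by≤ 0 (ℕ.+-mono-≤ i< hi-le) (trans (cong (λ x → s + (lo + X + (x + b * r + 1)) + 0) (sym whole))
          (arith s (lo + X) (toℕ i) (m ∸ toℕ i) b r)))
        (spine-size i (m ∸ toℕ i) whole) ,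
      ℕ.≤-trans (ℕ.≤-trans (ℕ.m≤n+m∸n s (a * r)) (ℕ.≤-trans (ℕ.≤-reflexive (ℕ.+-comm (a * r) _))
        (ℕ.+-monoˡ-≤ (a * r) (ℕ.≤-trans (ℕ.m≤n⊔m 1 (s ∸ a * r)) lo≤i)))) (spine-cosize i 1≤i)
      where
      1≤i : 1 ≤ toℕ i
      1≤i = ℕ.≤-trans (ℕ.m≤m⊔n 1 (s ∸ a * r)) lo≤i
      whole : toℕ i + (m ∸ toℕ i) ≡ m
      whole = ℕ.m+[n∸m]≡n (ℕ.<⇒≤ (Fin.toℕ<n i))
      arith : ∀ s y t c b r → s + (y + (t + c + b * r + 1)) + 0 ≡ c + b * r + (suc t + (y + s))
      arith = solve-∀

module DoubleTips (n r a b : ℕ) (1≤r : 1 ≤ r) (2≤a : 2 ≤ a) (1≤b : 1 ≤ b) (fits : (a + b) * r + 2 ≤ n) where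
  open Double n r a b
  open DoubleTree n r a b 1≤r (ℕ.<⇒≤ 2≤a) 1≤b fits
  open Inverse enumeration using (to; from; strictlyInverseˡ)

  -- A path vertex always has a child: the next path vertex or, at v_m, the start of a leg, which
  -- exists by `1≤b`.
  childless⇒leg-end : ∀ x → (∀ w → w ≢ inj₁ first → parent w ≢ x) →
    ∃₂ λ l s → x ≡ inj₂ (l , s) × suc (toℕ s) ≡ r
  childless⇒leg-end (inj₁ i) childless with suc (toℕ i) <? m
  ... | yes lt = let w≢ , eq = spine-child {i} {fromℕ< lt} (sym (Fin.toℕ-fromℕ< lt)) in contradiction eq (childless _ w≢)
  ... | no ≥m  = contradiction
    (leg-root {inj₂ (fromℕ< 1≤b)} (ℕ.≤-antisym (Fin.toℕ<n i) (ℕ.≮⇒≥ ≥m)) (Fin.toℕ-fromℕ< 1≤r)) (childless _ λ ())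
  childless⇒leg-end (inj₂ (l , s)) childless with suc (toℕ s) <? r
  ... | yes lt = contradiction (leg-child {l} {s} {fromℕ< lt} (sym (Fin.toℕ-fromℕ< lt))) (childless _ λ ())
  ... | no ≥r  = l , s , refl , ℕ.≤-antisym (Fin.toℕ<n s) (ℕ.≮⇒≥ ≥r)

  parent-leg : ∀ w {l s} → parent w ≡ inj₂ (l , s) → ∃ λ t → w ≡ inj₂ (l , t) × toℕ t ≡ suc (toℕ s)
  parent-leg (inj₂ (l , Fin.suc t)) refl = Fin.suc t , refl , cong suc (sym (Fin.toℕ-inject₁ t))

  anc-leg : ∀ t {l s} → t ≤ toℕ s → ∃ λ s′ → S.anc t (inj₂ (l , s)) ≡ inj₂ (l , s′) × toℕ s′ + t ≡ toℕ s
  anc-leg zero    {s = s} le = s , refl , ℕ.+-identityʳ _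
  anc-leg (suc t) {l} {s} le with anc-leg t {l} {s} (ℕ.<⇒≤ le)
  ... | Fin.zero   , _  , e′ = contradiction le (ℕ.<⇒≱ (s≤s (ℕ.≤-reflexive (sym e′))))
  ... | Fin.suc s′ , e , e′ = inject₁ s′ , cong parent e ,
    trans (cong (_+ suc t) (Fin.toℕ-inject₁ s′)) (trans (ℕ.+-suc (toℕ s′) t) e′)

  leg-end-tip : ∀ {l s} → suc (toℕ s) ≡ r → Tip rootedᵈ r (inj₂ (l , s))
  leg-end-tip {l} {s} s-end = record
    { nonroot   = λ i lt e → case anc-leg i {l} {s} (s≤s⁻¹ (ℕ.≤-trans lt (ℕ.≤-reflexive (sym s-end)))) of λ where
        (_ , e′ , _) → case trans (sym e′) e of λ ()
    ; childless = λ w w≢ e → case parent-leg w e of λ where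
        (t , _ , t≡) → ℕ.<-irrefl (trans t≡ s-end) (Fin.toℕ<n t)
    ; onlychild = λ i lt w w≢ e → only i (s≤s⁻¹ (ℕ.≤-trans lt (ℕ.≤-reflexive (sym s-end)))) w e
    }
    where
    only : ∀ i → suc i ≤ toℕ s → ∀ w → parent w ≡ S.anc (suc i) (inj₂ (l , s)) → w ≡ S.anc i (inj₂ (l , s))
    only i lt w e with anc-leg i {l} {s} (ℕ.<⇒≤ lt) | anc-leg (suc i) {l} {s} lt
    ... | s₁ , e₁ , p₁ | s₂ , e₂ , p₂ with parent-leg w (trans e e₂)
    ...   | t , refl , t≡ = trans (cong (λ x → inj₂ (l , x)) (Fin.toℕ-injective (trans t≡
      (ℕ.+-cancelʳ-≡ i (suc (toℕ s₂)) (toℕ s₁) (trans (sym (ℕ.+-suc (toℕ s₂) i)) (trans p₂ (sym p₁))))))) (sym e₁)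

  member : IsTreeWithPendentPaths n (a + b) r copy
  member = record
    { isTree  = C.rooted-tree
    ; pendent = Chains.tips⇒pendents rooted 1≤r (branching 2≤a) (map end allLegs)
        (Unique.map⁺ end-injective allLegs-unique) (trans (List.length-map end allLegs) length-allLegs)
        (λ u∈ → case ∈-map⁻ end u∈ of λ where (l , _ , refl) → to-tip (leg-end-tip toℕ-top))
        λ {u} tip → complete u (from-tip (subst (Tip rooted r) (sym (strictlyInverseˡ u)) tip))
    }
    where
    top : Fin r
    top = fromℕ< (ℕ.≤-reflexive (suc-pred (λ r≡0 → ℕ.<⇒≱ 1≤r (ℕ.≤-reflexive r≡0))))
    toℕ-top : suc (toℕ top) ≡ r
    toℕ-top = trans (cong suc (Fin.toℕ-fromℕ< _)) (suc-pred (λ r≡0 → ℕ.<⇒≱ 1≤r (ℕ.≤-reflexive r≡0)))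
    end : Leg → Fin n
    end l = to (inj₂ (l , top))
    label : ∀ {l l′ s t} → onLeg l s ≡ onLeg l′ t → l ≡ l′
    label refl = refl
    end-injective : ∀ {l l′} → end l ≡ end l′ → l ≡ l′
    end-injective e = label (to-injective e)
    ∈-allLegs : ∀ l → l ∈ allLegs
    ∈-allLegs (inj₁ x) = ∈-++⁺ˡ (∈-map⁺ inj₁ (∈-allFin x))
    ∈-allLegs (inj₂ y) = ∈-++⁺ʳ (map inj₁ (allFin a)) (∈-map⁺ inj₂ (∈-allFin y))
    complete : ∀ u → Tip rootedᵈ r (from u) → u ∈ map end allLegs
    complete u tip with childless⇒leg-end (from u) (Tip.childless tip)
    ... | l , s , e , s-end = subst (_∈ map end allLegs)
      (trans (cong (λ x → to (inj₂ (l , x))) (Fin.toℕ-injective (ℕ.suc-injective (trans toℕ-top (sym s-end)))))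
        (trans (cong to (sym e)) (strictlyInverseˡ u)))
      (∈-map⁺ end (∈-allLegs l))

-- Two leaves hang at the root v₁, and the path with the single leg at v_m forms a tail. The leaves
-- are adjacent to the branching vertex, so for r ≥ 2 no pendent path of length `r` begins there;
-- the tail supplies one because r ≤ n - 3 = m. The order 2, 1 of the ends, opposite to that in the
-- theorem, makes the branching vertex the root.
module ForkTips (n r : ℕ) (2≤r : 2 ≤ r) (r+3≤n : r + 3 ≤ n) where
  open Double n 1 2 1

  fits : 5 ≤ n
  fits = ℕ.≤-trans (ℕ.+-monoˡ-≤ 3 2≤r) r+3≤n

  open DoubleTree n 1 2 1 (s≤s z≤n) (s≤s z≤n) (s≤s z≤n) fits public
  open DoubleTips n 1 2 1 (s≤s z≤n) (s≤s (s≤s z≤n)) (s≤s z≤n) fits using (childless⇒leg-end; parent-leg)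
  open Inverse enumeration using (to; from; strictlyInverseˡ)

  r≤m : r ≤ m
  r≤m = ℕ.m+n≤o⇒m≤o∸n r r+3≤n

  tail-end : Vertex
  tail-end = inj₂ (inj₂ Fin.zero , Fin.zero)

  anc-tail : ∀ t → t < m → ∃ λ j → S.anc (suc t) tail-end ≡ inj₁ j × toℕ j + suc t ≡ m
  anc-tail zero    lt = last , refl , trans (ℕ.+-comm _ 1) toℕ-last
  anc-tail (suc t) lt with anc-tail t (ℕ.<⇒≤ lt)
  ... | j , e , e′ = Fin.pred j , cong parent e ,
    trans (cong (_+ suc (suc t)) (toℕ-pred j)) (trans (ℕ.+-suc (pred (toℕ j)) (suc t)) (trans (cong (_+ suc t) (suc-pred j≢0)) e′))
    where
    j≢0 : toℕ j ≢ 0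
    j≢0 e″ = ℕ.<-irrefl (trans (cong (_+ suc t) (sym e″)) e′) lt

  tail-tip : Tip rootedᵈ r tail-end
  tail-tip = record
    { nonroot   = λ where
        zero    _  ()
        (suc t) lt e → let j , e₁ , e₂ = anc-tail t (ℕ.<-≤-trans (ℕ.<⇒≤ lt) r≤m) in
          ℕ.<-irrefl (trans (cong (_+ suc t) (trans (sym toℕ-first) (cong toℕ (inj₁-injective (trans (sym e) e₁))))) e₂) (ℕ.<-≤-trans lt r≤m)
    ; childless = λ w _ e → case parent-leg w e of λ where
        (Fin.zero , _ , ())
    ; onlychild = λ i lt w w≢ e → let j , e₁ , e₂ = anc-tail i (ℕ.<-≤-trans (ℕ.<⇒≤ lt) r≤m) in
        only i (ℕ.<-≤-trans lt r≤m) w w≢ (trans e e₁) e₂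
    }
    where
    only : ∀ i → suc i < m → ∀ w {j} → w ≢ inj₁ first → parent w ≡ inj₁ j → toℕ j + suc i ≡ m → w ≡ S.anc i tail-end
    only i lt (inj₂ (inj₁ x , Fin.zero)) w≢ refl e =
      contradiction (trans (cong (_+ suc i) (sym toℕ-first)) e) (ℕ.<⇒≢ lt)
    only zero    lt (inj₂ (inj₂ Fin.zero , Fin.zero)) w≢ refl e = refl
    only (suc i) lt (inj₂ (inj₂ Fin.zero , Fin.zero)) w≢ refl e =
      contradiction (trans (sym e) (trans (ℕ.+-suc (toℕ last) (suc i)) (cong (_+ suc i) toℕ-last))) (ℕ.m≢1+m+n m ∘ flip-eq)
      where
      flip-eq : m ≡ m + suc i → m ≡ suc (m + i)
      flip-eq e = trans e (ℕ.+-suc m i)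
    only zero    lt (inj₁ i′) w≢ refl e = contradiction (Fin.toℕ<n i′) (ℕ.<-irrefl
      (trans (sym (suc-pred (≢first w≢))) (trans (cong suc (sym (toℕ-pred i′))) (trans (ℕ.+-comm 1 _) e))))
    only (suc i) lt (inj₁ i′) w≢ refl e with anc-tail i (ℕ.<⇒≤ (ℕ.<⇒≤ lt))
    ... | j₀ , e₁ , e₂ = trans (cong inj₁ (Fin.toℕ-injective (ℕ.+-cancelʳ-≡ (suc i) (toℕ i′) (toℕ j₀)
      (trans (cong (_+ suc i) (sym (suc-pred (≢first w≢))))
        (trans (sym (ℕ.+-suc (pred (toℕ i′)) (suc i))) (trans (cong (_+ suc (suc i)) (sym (toℕ-pred i′))) (trans e (sym e₂)))))))) (sym e₁)

  tail-only : ∀ {x} → Tip rootedᵈ r x → x ≡ tail-end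
  tail-only {x} tip with childless⇒leg-end x (Tip.childless tip)
  ... | inj₁ _ , Fin.zero , refl , _        = contradiction refl (Tip.nonroot tip 1 2≤r)
  ... | inj₂ Fin.zero , Fin.zero , refl , _ = refl

  member : IsTreeWithPendentPaths n 1 r copy
  member = record
    { isTree  = C.rooted-tree
    ; pendent = Chains.tips⇒pendents rooted (ℕ.<⇒≤ 2≤r) (branching (s≤s (s≤s z≤n))) (to tail-end ∷ []) ([] ∷ []) refl
        (λ where (here refl) → to-tip tail-tip)
        λ {u} tip → here (trans (sym (strictlyInverseˡ u)) (cong to (tail-only
          (from-tip (subst (Tip rooted r) (sym (strictlyInverseˡ u)) tip)))))
    }

-- Reversing the path exchanges v₁ with v_m and so the two kinds of legs. The lengths
-- `n ∸ (a + b) * r` and `n ∸ (b + a) * r` agree only through commutativity, so the reversal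
-- includes a cast; the equation is an argument of `swap` so that the same definition yields the
-- inverse.
double-swap : ∀ n r a b → A n r a b ≅ A n r b a
double-swap n r a b =
  mk↔ₛ′ (swap a b eq) (swap b a (sym eq)) (swap-inverse b a (sym eq) eq) (swap-inverse a b eq (sym eq)) , λ u v →
  mk⇔ (swap-adj a b eq u v) (λ e → subst₂ (Adj n r a b) (swap-inverse a b eq (sym eq) u) (swap-inverse a b eq (sym eq) v)
    (swap-adj b a (sym eq) (swap a b eq u) (swap a b eq v) e))
  where
  open Double using (Vertex; Adj; AttachedAt; Leg)

  size : ∀ a b → ℕ
  size a b = Double.m n r a b

  eq : size a b ≡ size b a
  eq = cong (λ x → n ∸ x * r) (ℕ.+-comm a b)

  reverse : ∀ {m m′} → m ≡ m′ → Fin m → Fin m′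
  reverse e i = Fin.cast e (Fin.opposite i)

  toℕ-reverse : ∀ {m m′} (e : m ≡ m′) i → toℕ (reverse e i) + suc (toℕ i) ≡ m
  toℕ-reverse refl i = trans (cong (_+ suc (toℕ i)) (trans (Fin.toℕ-cast refl (Fin.opposite i)) (Fin.opposite-prop i))) (ℕ.m∸n+n≡m (Fin.toℕ<n i))

  reverse-inverse : ∀ {m m′} (e : m ≡ m′) (e′ : m′ ≡ m) i → reverse e′ (reverse e i) ≡ i
  reverse-inverse {m} refl e′ i = Fin.toℕ-injective (ℕ.+-cancelʳ-≡ (suc (toℕ (reverse refl i))) _ _
    (trans (toℕ-reverse e′ (reverse refl i)) (trans (sym (toℕ-reverse refl i))
      (trans (ℕ.+-suc _ (toℕ i)) (trans (ℕ.+-comm (suc (toℕ (reverse refl i))) (toℕ i)) refl)))))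

  swap : ∀ a b → size a b ≡ size b a → Vertex n r a b → Vertex n r b a
  swap a b e (inj₁ i)       = inj₁ (reverse e i)
  swap a b e (inj₂ (l , s)) = inj₂ (Sum.swap l , s)

  swap-inverse : ∀ a b (e : size a b ≡ size b a) (e′ : size b a ≡ size a b) x → swap b a e′ (swap a b e x) ≡ x
  swap-inverse a b e e′ (inj₁ i)            = cong inj₁ (reverse-inverse e e′ i)
  swap-inverse a b e e′ (inj₂ (inj₁ _ , s)) = refl
  swap-inverse a b e e′ (inj₂ (inj₂ _ , s)) = refl

  reverse-consecutive : ∀ {m m′} (e : m ≡ m′) {i j} → suc (toℕ i) ≡ toℕ j → suc (toℕ (reverse e j)) ≡ toℕ (reverse e i)
  reverse-consecutive e {i} {j} eq = ℕ.+-cancelʳ-≡ (toℕ j) _ _ (trans (sym (ℕ.+-suc _ (toℕ j)))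
    (trans (toℕ-reverse e j) (trans (sym (toℕ-reverse e i)) (cong (toℕ (reverse e i) +_) eq))))

  swap-attached : ∀ a b (e : size a b ≡ size b a) l i → AttachedAt n r a b l i → AttachedAt n r b a (Sum.swap l) (reverse e i)
  swap-attached a b e (inj₁ _) i at = trans (ℕ.+-comm 1 _) (trans (cong (λ x → toℕ (reverse e i) + suc x) (sym at)) (trans (toℕ-reverse e i) e))
  swap-attached a b e (inj₂ _) i at = ℕ.+-cancelʳ-≡ (suc (toℕ i)) _ _ (trans (toℕ-reverse e i) (sym at))

  swap-adj : ∀ a b (e : size a b ≡ size b a) u v → Adj n r a b u v → Adj n r b a (swap a b e u) (swap a b e v)
  swap-adj a b e (inj₁ i) (inj₁ j) (inj₁ c) = inj₂ (reverse-consecutive e c)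
  swap-adj a b e (inj₁ i) (inj₁ j) (inj₂ c) = inj₁ (reverse-consecutive e c)
  swap-adj a b e (inj₁ i) (inj₂ (l , s)) (at , z) = swap-attached a b e l i at , z
  swap-adj a b e (inj₂ (l , s)) (inj₁ i) (at , z) = swap-attached a b e l i at , z
  swap-adj a b e (inj₂ (l , s)) (inj₂ (_ , t)) (refl , c) = refl , c

-- Trees without branching

module PathLike {n} {G : Graph (Fin n)} (t : IsTree G) (degree≤2 : ∀ v → degree G v ≤ 2) where

  module FromLeaf (ρ : Fin n) (leaf : degree G ρ ≤ 1) where
    open RootedFin (rootAt t ρ)
    open Chains (rootAt t ρ)

    -- A second child would give the root degree 2, or give another vertex degree 3 together with
    -- its parent.
    child-unique : ∀ {c d} → c ≢ ρ → d ≢ ρ → par c ≡ par d → c ≡ d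
    child-unique {c} {d} c≢ d≢ e with c Fin.≟ d
    ... | yes c≡d = c≡d
    ... | no c≢d with par d Fin.≟ ρ
    ...   | yes e′ = contradiction (two≤degree G (child-~ c≢ (trans e e′)) (child-~ d≢ e′) c≢d) (ℕ.<⇒≱ (s≤s leaf))
    ...   | no p≢  = contradiction
      (three≤degree G (child-~ c≢ e) (child-~ d≢ refl) (par-~ p≢) c≢d (child≢par c≢ e p≢) (child≢par d≢ refl p≢))
      (ℕ.<⇒≱ (s≤s (degree≤2 _)))

    depth-injective : ∀ {u v} → depth u ≡ depth v → u ≡ v
    depth-injective {u} e = go (depth u) refl (sym e)
      where
      go : ∀ d {u v} → depth u ≡ d → depth v ≡ d → u ≡ v
      go zero    eu ev = trans (depth≡0⇒root eu) (sym (depth≡0⇒root ev))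
      go (suc d) eu ev = child-unique u≢ v≢ (go d (ℕ.suc-injective (trans (sym (depth-par u≢)) eu)) (ℕ.suc-injective (trans (sym (depth-par v≢)) ev)))
        where
        u≢ = depth>0 (subst (0 <_) (sym eu) z<s)
        v≢ = depth>0 (subst (0 <_) (sym ev) z<s)

    deepest : ∃ λ w → ⊤ × (∀ v → ⊤ → depth v ≤ depth w)
    deepest = argmax (λ _ → yes tt) depth (ρ , tt)

    far : Fin n
    far = proj₁ deepest

    depth≤far : ∀ v → depth v ≤ depth far
    depth≤far v = proj₂ (proj₂ deepest) v tt

    far-childless : ∀ w → w ≢ ρ → par w ≢ far
    far-childless w w≢ e = ℕ.<⇒≱ (ℕ.≤-reflexive (trans (cong (suc ∘ depth) (sym e)) (sym (depth-par w≢)))) (depth≤far w)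

    anc-far : ∀ i → i ≤ depth far → depth (anc (depth far ∸ i) far) ≡ i
    anc-far i le = ℕ.+-cancelˡ-≡ (depth far ∸ i) _ _ (trans (anc-depth (depth far ∸ i) (ℕ.m∸n≤m (depth far) i)) (sym (ℕ.m∸n+n≡m le)))

    as-anc : ∀ v → anc (depth far ∸ depth v) far ≡ v
    as-anc v = depth-injective (anc-far (depth v) (depth≤far v))

    -- Depth is injective, so every vertex is an ancestor of the deepest one, and these ancestors
    -- occupy each depth once.
    suc-depth-far : suc (depth far) ≡ n
    suc-depth-far = ℕ.≤-antisym
      (subst₂ _≤_ length-xs (List.length-tabulate id) (unique-⊆-length xs! λ _ → ∈-allFin _))
      (subst₂ _≤_ (List.length-tabulate id) length-xs (unique-⊆-length (Unique.allFin⁺ n) λ {v} _ →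
        subst (_∈ xs) (as-anc v) (∈-map⁺ (λ i → anc i far) (∈-upTo⁺ (s≤s (ℕ.m∸n≤m (depth far) (depth v)))))))
      where
      xs : List (Fin n)
      xs = map (λ i → anc i far) (upTo (suc (depth far)))
      length-xs : length xs ≡ suc (depth far)
      length-xs = trans (List.length-map _ (upTo (suc (depth far)))) (List.length-upTo _)
      xs! : UniqueList xs
      xs! = unique-map (λ i∈ j∈ → anc-injective (λ i → anc-≢root i) (s≤s⁻¹ (∈-upTo⁻ i∈)) (s≤s⁻¹ (∈-upTo⁻ j∈))) (Unique.upTo⁺ _)

    module _ {r} (1≤r : 1 ≤ r) (r+2≤n : r + 2 ≤ n) where

      r<depth : r < depth far
      r<depth = s≤s⁻¹ (ℕ.≤-trans (ℕ.≤-reflexive (ℕ.+-comm 2 r)) (ℕ.≤-trans r+2≤n (ℕ.≤-reflexive (sym suc-depth-far))))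

      far-tip : Tip (rootAt t ρ) r far
      far-tip = record
        { nonroot   = λ i lt → anc-≢root i (ℕ.<-trans lt r<depth)
        ; childless = far-childless
        ; onlychild = λ i lt w w≢ e → child-unique w≢ (anc-≢root i (ℕ.<-trans (ℕ.<⇒≤ lt) r<depth)) e
        }

      far-pendent : IsPendentPath G (chain r far)
      far-pendent = tip⇒pendent 1≤r far-tip (inj₁ (anc-≢root r r<depth))

      far≢ρ : far ≢ ρ
      far≢ρ = anc-≢root 0 (ℕ.≤-<-trans z≤n r<depth)

      -- The head of such a path is childless, while every vertex other than `far` has a child on
      -- the way to `far`.
      pendent-unique : ∀ {p} → IsPendentPath G p → head p ≢ ρ → p ≡ chain r far
      pendent-unique {p} pp h≢ = trans (pendent-chain pp h≢ root≢2) (cong (chain r) head≡far)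
        where
        root≢2 : degree G ρ ≢ 2
        root≢2 e = ℕ.<⇒≱ (s≤s leaf) (ℕ.≤-reflexive (sym e))
        head≡far : head p ≡ far
        head≡far with ≼-child (subst (far ≼_) (as-anc (head p)) (≼anc _ (ℕ.m∸n≤m (depth far) (depth (head p)))))
        ... | inj₁ e                = sym e
        ... | inj₂ (c , c≢ , e , _) = contradiction e (Tip.childless (pendent-tip pp h≢ root≢2) c c≢)

  some-leaf : Fin n → ∃ λ ρ → degree G ρ ≤ 1
  some-leaf x = w , degree≤length G {xs = par w ∷ []} only-parent
    where
    open RootedFin (rootAt t x)
    open Chains (rootAt t x)
    deepest : ∃ λ w → ⊤ × (∀ v → ⊤ → depth v ≤ depth w)
    deepest = argmax (λ _ → yes tt) depth (x , tt)
    w : Fin n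
    w = proj₁ deepest
    only-parent : ∀ {y} → Graph._~_ G w y → y ∈ par w ∷ []
    only-parent {y} w~y with par-or-child w~y
    ... | inj₁ e        = here e
    ... | inj₂ (y≢ , e) = contradiction (proj₂ (proj₂ deepest) y tt)
      (ℕ.<⇒≱ (ℕ.≤-reflexive (trans (cong (suc ∘ depth) (sym e)) (sym (depth-par y≢)))))

  module _ {r} (1≤r : 1 ≤ r) (r+2≤n : r + 2 ≤ n) where

    OnlyPendentNotFrom : Fin n → Vec (Fin n) (suc r) → Set
    OnlyPendentNotFrom ρ p = IsPendentPath G p × head p ≢ ρ × (∀ {q} → IsPendentPath G q → head q ≢ ρ → q ≡ p)

    pendent-not-from : ∀ ρ → degree G ρ ≤ 1 → ∃ (OnlyPendentNotFrom ρ)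
    pendent-not-from ρ leaf = chain r far , far-pendent 1≤r r+2≤n ,
      (λ e → far≢ρ 1≤r r+2≤n (trans (sym (chain-head r far)) e)) , pendent-unique 1≤r r+2≤n
      where
      open FromLeaf ρ leaf
      open Chains (rootAt t ρ)

    -- Rooting at a leaf shows every pendent path except one that starts at that leaf. The second
    -- path is therefore found by rooting anew at the head of the first.
    two-pendents : HasExactly 2 (IsPendentPath G {r})
    two-pendents = combine (pendent-not-from (proj₁ leaf) (proj₂ leaf))
      where
      leaf : ∃ λ ρ → degree G ρ ≤ 1
      leaf = some-leaf (fromℕ< (ℕ.≤-trans (ℕ.m≤n+m 1 r) (ℕ.≤-trans (ℕ.+-monoʳ-≤ r (s≤s z≤n)) r+2≤n)))
      combine₂ : ∀ {ρ p₁} → OnlyPendentNotFrom ρ p₁ → ∃ (OnlyPendentNotFrom (head p₁)) → HasExactly 2 (IsPendentPath G {r})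
      combine₂ {ρ} {p₁} (pp₁ , h₁≢ , only₁) (p₂ , pp₂ , h₂≢ , only₂) =
        (p₁ ∷ p₂ ∷ []) , (((λ e → h₂≢ (cong head (sym e))) ∷ []) ∷ [] ∷ []) , refl , λ p → mk⇔
          (λ where
            (here refl)         → pp₁
            (there (here refl)) → pp₂)
          (λ pp → case head p Fin.≟ ρ of λ where
            (no h≢)  → here (only₁ pp h≢)
            (yes h≡) → there (here (only₂ pp λ e → h₁≢ (trans (sym e) h≡))))
      combine : ∀ {ρ} → ∃ (OnlyPendentNotFrom ρ) → HasExactly 2 (IsPendentPath G {r})
      combine (p₁ , o₁@(pp₁ , _)) = combine₂ o₁ (pendent-not-from (head p₁) (ℕ.≤-reflexive (IsPendentPath.start pp₁)))

module PathFromLeaf {m} {G : Graph (Fin (suc m))} (t : IsTree G) (degree≤2 : ∀ v → degree G v ≤ 2)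
  (ρ : Fin (suc m)) (leaf : degree G ρ ≤ 1) where
  open PathLike.FromLeaf t degree≤2 ρ leaf
  open RootedFin (rootAt t ρ)

  depth-far : depth far ≡ m
  depth-far = ℕ.suc-injective suc-depth-far
  g : Fin (suc m) → Fin (suc m)
  g i = anc (depth far ∸ toℕ i) far
  depth-g : ∀ i → depth (g i) ≡ toℕ i
  depth-g i = anc-far (toℕ i) (ℕ.≤-trans (s≤s⁻¹ (Fin.toℕ<n i)) (ℕ.≤-reflexive (sym depth-far)))
  g-injective : ∀ {i j} → g i ≡ g j → i ≡ j
  g-injective {i} {j} e = Fin.toℕ-injective (trans (sym (depth-g i)) (trans (cong depth e) (depth-g j)))
  g-surjective : ∀ v → ∃ λ i → g i ≡ v
  g-surjective v = fromℕ< v<n , depth-injective (trans (depth-g (fromℕ< v<n)) (Fin.toℕ-fromℕ< v<n))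
    where
    v<n : depth v < suc m
    v<n = ℕ.<-≤-trans (s≤s (depth≤far v)) (ℕ.≤-reflexive suc-depth-far)

  leaf-≅ : G ≅ P (suc m)
  leaf-≅ = rooted-≅ (rootAt t ρ) (PathTree.rooted m) (bijection g g-injective g-surjective)
    (depth≡0⇒root (depth-g Fin.zero)) (λ x x≢ → depth-injective (ℕ.suc-injective (trans
      (trans (cong suc (depth-g (Fin.pred x))) (sym (Rooted.depth-par (PathTree.rooted m) x≢)))
      (trans (sym (depth-g x)) (depth-par (λ e → x≢ (Fin.toℕ-injective (trans (sym (depth-g x)) (trans (cong depth e) depth-root)))))))))

pathLike-≅ : ∀ {m} {G : Graph (Fin (suc m))} → IsTree G → (∀ v → degree G v ≤ 2) → G ≅ P (suc m)
pathLike-≅ {m} {G} t degree≤2 = from (PathLike.some-leaf t degree≤2 Fin.zero)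
  where
  from : (∃ λ ρ → degree G ρ ≤ 1) → G ≅ P (suc m)
  from (ρ , leaf) = PathFromLeaf.leaf-≅ t degree≤2 ρ leaf

P-degree≤2 : ∀ {m} (i : Fin m) → degree (P m) i ≤ 2
P-degree≤2 {m} i with degree (P m) i ≤? 2
... | yes le = le
... | no ≰2 with three-neighbours (P m) (ℕ.≰⇒> ≰2)
...   | x , y , z , (x≢y , x≢z , y≢z) , ex , ey , ez = ⊥-elim (go ex ey ez)
  where
  same⁺ : ∀ {u v} → suc (toℕ i) ≡ toℕ u → suc (toℕ i) ≡ toℕ v → u ≡ v
  same⁺ p q = Fin.toℕ-injective (trans (sym p) q)
  same⁻ : ∀ {u v : Fin m} → suc (toℕ u) ≡ toℕ i → suc (toℕ v) ≡ toℕ i → u ≡ v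
  same⁻ p q = Fin.toℕ-injective (ℕ.suc-injective (trans p (sym q)))
  go : Consecutive i x → Consecutive i y → Consecutive i z → ⊥
  go (inj₁ p) (inj₁ q) _        = x≢y (same⁺ p q)
  go (inj₂ p) (inj₂ q) _        = x≢y (same⁻ p q)
  go (inj₁ p) (inj₂ q) (inj₁ s) = x≢z (same⁺ p s)
  go (inj₁ p) (inj₂ q) (inj₂ s) = y≢z (same⁻ q s)
  go (inj₂ p) (inj₁ q) (inj₁ s) = y≢z (same⁺ q s)
  go (inj₂ p) (inj₁ q) (inj₂ s) = x≢z (same⁻ p s)

P-tree : ∀ m → IsTree (P (suc m))
P-tree m = RootedFin.rooted-tree (PathTree.rooted m)

-- Rigidity of the optimal trees

module RootChildren {n} {G : Graph (Fin n)} (R : Rooted G) where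
  open RootedFin R

  RootChild : Fin n → Set
  RootChild c = c ≢ root × par c ≡ root

  root-child-depth : ∀ {c} → RootChild c → depth c ≡ 1
  root-child-depth (c≢ , e) = trans (depth-par c≢) (cong suc (trans (cong depth e) depth-root))

  root-child-unique : ∀ {c d v} → RootChild c → RootChild d → v ≼ c → v ≼ d → c ≡ d
  root-child-unique rc rd v≼c v≼d with ≼-linear v≼c v≼d
  ... | inj₁ c≼d = ≼-depth-≡ c≼d (ℕ.≤-reflexive (trans (root-child-depth rc) (sym (root-child-depth rd))))
  ... | inj₂ d≼c = sym (≼-depth-≡ d≼c (ℕ.≤-reflexive (trans (root-child-depth rd) (sym (root-child-depth rc)))))

  abstract
    root-child-above : ∀ {v} → v ≢ root → ∃ λ c → RootChild c × v ≼ c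
    root-child-above {v} v≢root with ≼-child (≼-root v)
    ... | inj₁ e                  = contradiction e v≢root
    ... | inj₂ (c , c≢ , e , v≼c) = c , (c≢ , e) , v≼c

  root-neighbour : ∀ {c} → Graph._~_ G root c → RootChild c
  root-neighbour e with ~-par e
  ... | inj₁ (root≢ , _) = contradiction refl root≢
  ... | inj₂ c           = c

-- `optimal` expresses equality in the upper bounds without naming the comparison tree: `N s` is at
-- least every number that the three bounds permit.
module Rigidity {n} {G : Graph (Fin n)} (R : Rooted G) (branching : 3 ≤ degree G (Rooted.root R))
  {r} {ts : List (Fin n)} (ts! : UniqueList ts) (1≤r : 1 ≤ r) (tips : ∀ {u} → u ∈ ts → Tip R r u)
  {j j′} (j+j′ : j + j′ ≡ length ts) (1≤j : 1 ≤ j) (j≤j′ : j ≤ j′) (j′≤1+j : j′ ≤ suc j)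
  (room : length ts * r + 2 ≤ n)
  (optimal : ∀ s X → 1 ≤ s → (∀ β → β ≤ r → β < s → X + β * length ts + 1 ≤ n) →
    (0 < X → X + 2 * s ≤ suc n) → (r < s → 0 < X → X + j′ * r + s ≤ n) → X ≤ RootedFin.N R s) where
  open RootedFin R
  open Chains R using (par-or-child; chain-depth; anc-injective)
  open Bounds R
  open RootChildren R
  open Legs ts! 1≤r tips

  M : ℕ
  M = count spine?

  2≤M : 2 ≤ M
  2≤M = by≤ 0 room (trans (cong (2 +_) (trans (ℕ.+-identityʳ n) (sym count-spine))) (arith M r k))
    where
    arith : ∀ M r k → 2 + (M + r * k) ≡ M + (k * r + 2)
    arith = solve-∀

  M≡ : ∃ λ q → M ≡ 2 + q
  M≡ = M ∸ 2 , sym (ℕ.m+[n∸m]≡n 2≤M)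

  n≡ : ∀ {q} → M ≡ q → n ≡ q + r * (j + j′)
  n≡ e = trans (sym count-spine) (cong₂ (λ x y → x + r * y) e (sym j+j′))

  r<1+jr : r < suc (j * r)
  r<1+jr = s≤s (ℕ.≤-trans (ℕ.≤-reflexive (sym (ℕ.*-identityˡ r))) (ℕ.*-monoˡ-≤ r 1≤j))

  -- With q = M - 2, the three bounds permit M - 1 at the threshold jr + 1, the third one with
  -- equality.
  all-but-root : ∀ {q} → M ≡ 2 + q → suc q ≤ N (suc (j * r))
  all-but-root {q} e = optimal (suc (j * r)) (suc q) (s≤s z≤n)
    (λ β β≤r _ → subst₂ (λ x y → suc q + β * x + 1 ≤ y) j+j′ (sym (n≡ e))
      (by≤ 0 (ℕ.*-monoˡ-≤ (j + j′) β≤r) (arith₁ q β r (j + j′))))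
    (λ _ → subst (λ y → suc q + 2 * suc (j * r) ≤ suc y) (sym (n≡ e)) (by≤ 0 (ℕ.*-monoʳ-≤ r j≤j′) (arith₂ q r j j′)))
    (λ _ _ → subst (suc q + j′ * r + suc (j * r) ≤_) (sym (n≡ e)) (ℕ.≤-reflexive (arith₃ q r j j′)))
    where
    arith₁ : ∀ q β r k → suc q + β * k + 1 + r * k + 0 ≡ 2 + q + r * k + β * k
    arith₁ = solve-∀
    arith₂ : ∀ q r j j′ → suc q + 2 * suc (j * r) + r * j′ + 0 ≡ suc (2 + q + r * (j + j′)) + r * j
    arith₂ = solve-∀
    arith₃ : ∀ q r j j′ → suc q + j′ * r + suc (j * r) ≡ 2 + q + r * (j + j′)
    arith₃ = solve-∀

  -- One threshold further the bounds permit M - 2, again with equality in the third; for the second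
  -- bound this depends on r ≥ 1.
  all-but-two : ∀ {q} → M ≡ 2 + q → j′ ≡ suc j → q ≤ N (2 + j * r)
  all-but-two {q} e odd = optimal (2 + j * r) q (s≤s z≤n)
    (λ β β≤r _ → subst₂ (λ x y → q + β * x + 1 ≤ y) j+j′ (sym (n≡ e))
      (by≤ 1 (ℕ.*-monoˡ-≤ (j + j′) β≤r) (arith₁ q β r (j + j′))))
    (λ _ → subst₂ (λ x y → q + 2 * (2 + j * r) ≤ suc y) odd (sym (trans (n≡ e) (cong (λ x → 2 + q + r * (j + x)) odd)))
      (by≤ 0 1≤r (arith₂ q r j)))
    (λ _ _ → subst (q + j′ * r + (2 + j * r) ≤_) (sym (n≡ e)) (ℕ.≤-reflexive (arith₃ q r j j′)))
    where
    arith₁ : ∀ q β r k → q + β * k + 1 + r * k + 1 ≡ 2 + q + r * k + β * k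
    arith₁ = solve-∀
    arith₂ : ∀ q r j → q + 2 * (2 + j * r) + r + 0 ≡ suc (2 + q + r * (j + suc j)) + 1
    arith₂ = solve-∀
    arith₃ : ∀ q r j j′ → q + j′ * r + (2 + j * r) ≡ 2 + q + r * (j + j′)
    arith₃ = solve-∀

  -- At a threshold above `r` only nonroot spine vertices can be heavy. There are M - 1 of them, and
  -- `all-but-root` yields that many.
  spine-heavy : ∀ {v} → ¬ OnLeg v → v ≢ root → Heavy (suc (j * r)) v
  spine-heavy {v} v-spine v≢root with heavy? (suc (j * r)) v | M≡
  ... | yes h | _     = h
  ... | no ¬h | q , e = contradiction (all-but-root e) (ℕ.<⇒≱ (by≤ 0 packed
        (trans (cong (λ x → suc (N (suc (j * r))) + x + 0) e)
          (trans (arith (N (suc (j * r))) q) (cong₂ (λ x y → suc q + (N (suc (j * r)) + x + y)) (sym (count-≡ v)) (sym (count-≡ root)))))))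
    where
    packed : N (suc (j * r)) + count (Fin._≟ v) + count (Fin._≟ root) ≤ M
    packed = pack₃ (heavy? (suc (j * r))) (Fin._≟ v) (Fin._≟ root) spine?
      (heavy-spine r<1+jr) (λ where refl → v-spine) (λ where refl → root-spine)
      (λ where h refl → ¬h h) (λ where (w≢ , _) refl → w≢ refl) (λ where refl e → v≢root e)
    arith : ∀ a q → suc a + (2 + q) + 0 ≡ suc q + (a + 1 + 1)
    arith = solve-∀

  -- Two light vertices and the root would leave at most M - 3 heavy ones, against the M - 2 of
  -- `all-but-two`.
  one-light : j′ ≡ suc j → ∀ {v w} → ¬ OnLeg v → v ≢ root → ¬ OnLeg w → w ≢ root → v ≢ w →
    ¬ Heavy (2 + j * r) v → ¬ Heavy (2 + j * r) w → ⊥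
  one-light odd {v} {w} v-spine v≢root w-spine w≢root v≢w ¬hv ¬hw with M≡
  ... | q , e = contradiction (all-but-two e odd) (ℕ.<⇒≱ (by≤ 0 packed
        (trans (cong (λ x → suc (N (2 + j * r)) + x + 0) e)
          (trans (arith (N (2 + j * r)) q) (cong₂ (λ x y → q + (N (2 + j * r) + x + y))
            (sym (trans (count-⊎ (Fin._≟ v) (Fin._≟ w) (λ where refl e → v≢w e)) (cong₂ _+_ (count-≡ v) (count-≡ w)))) (sym (count-≡ root)))))))
    where
    packed : N (2 + j * r) + count (λ x → (x Fin.≟ v) ⊎-dec (x Fin.≟ w)) + count (Fin._≟ root) ≤ M
    packed = pack₃ (heavy? (2 + j * r)) (λ x → (x Fin.≟ v) ⊎-dec (x Fin.≟ w)) (Fin._≟ root) spine?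
      (heavy-spine (ℕ.m<n⇒m<1+n r<1+jr)) [ (λ where refl → v-spine) , (λ where refl → w-spine) ] (λ where refl → root-spine)
      (λ where h (inj₁ refl) → ¬hv h
               h (inj₂ refl) → ¬hw h)
      (λ where (x≢ , _) refl → x≢ refl)
      (λ where (inj₁ refl) e → v≢root e
               (inj₂ refl) e → w≢root e)
    arith : ∀ a q → suc a + (2 + q) + 0 ≡ q + (a + 2 + 1)
    arith = solve-∀

  spine-upward : ∀ {w v} → w ≼ v → ¬ OnLeg w → ¬ OnLeg v
  spine-upward w≼v w-spine v∈ with ∈-legs⁻ r ts v∈
  ... | t , u , t<r , u∈ , refl with below-tip t u∈ t<r w≼v
  ...   | i , i≤t , refl = w-spine (∈-legs⁺ (ℕ.≤-<-trans i≤t t<r) u∈)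

  *-reflects-≤ : ∀ {x y} → r * x ≤ r * y → x ≤ y
  *-reflects-≤ = ℕ.*-cancelˡ-≤ r ⦃ Data.Nat.>-nonZero 1≤r ⦄

  Lowest : Fin n → Set
  Lowest v = ∀ {w} → ¬ OnLeg w → w ≼ v → w ≡ v

  lowest-size : ∀ {v} → ¬ OnLeg v → Lowest v → size v ≡ 1 + r * l v
  lowest-size {v} v-spine low = trans (size-spine v-spine) (cong (_+ r * l v) (trans
    (count-cong (λ w → spine? w ×-dec (w ≼? v)) (Fin._≟ v) (λ (s , w≼v) → low s w≼v) (λ where refl → v-spine , here)) (count-≡ v)))

  -- Below a lowest spine vertex there are only whole legs, so heaviness reads jr + 1 ≤ 1 + r · l v.
  lowest-tips : ∀ {v} → ¬ OnLeg v → v ≢ root → Lowest v → j ≤ l v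
  lowest-tips {v} v-spine v≢root low = *-reflects-≤ (subst (_≤ r * l v) (ℕ.*-comm j r)
    (s≤s⁻¹ (ℕ.≤-trans (proj₁ (proj₂ (spine-heavy v-spine v≢root))) (ℕ.≤-reflexive (lowest-size v-spine low)))))

  light : ∀ {v} → ¬ OnLeg v → Lowest v → l v ≤ j → ¬ Heavy (2 + j * r) v
  light {v} v-spine low le (_ , h , _) = ℕ.<-irrefl refl (ℕ.≤-trans h
    (ℕ.≤-trans (ℕ.≤-reflexive (lowest-size v-spine low)) (s≤s (ℕ.≤-trans (ℕ.*-monoʳ-≤ r le) (ℕ.≤-reflexive (ℕ.*-comm r j))))))

  -- A smallest descendant of `c` is on a leg, with a tip below it, or is a lowest spine vertex,
  -- which carries at least j ≥ 1 tips. So every leaf of an optimal tree begins one of the legs.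
  tip-below : ∀ {c} → c ≢ root → 1 ≤ l c
  tip-below {c} c≢root with argmin (_≼? c) size (c , here)
  ... | w , w≼c , min with onLeg? w
  ...   | yes w∈ = case ∈-legs⁻ r ts w∈ of λ where
          (t , u , t<r , u∈ , refl) → length≤count (λ u → (u ∈? ts) ×-dec (u ≼? c)) ([] ∷ []) λ where
            (here refl) → u∈ , ≼-trans (≼anc-tip u∈ (ℕ.<⇒≤ t<r)) w≼c
  ...   | no w-spine = ℕ.≤-trans 1≤j (ℕ.≤-trans
          (lowest-tips w-spine (λ where refl → c≢root (≼-antisym (≼-root c) w≼c)) λ {x} _ x≼w → case x Fin.≟ w of λ where
            (yes e)  → e
            (no x≢w) → contradiction (min x (≼-trans x≼w w≼c)) (ℕ.<⇒≱ (size-strict x≼w x≢w)))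
          (l-mono w≼c))

  abstract
    bottom-spec : ∃ λ v → (¬ OnLeg v × v ≢ root) × (∀ w → ¬ OnLeg w × w ≢ root → size v ≤ size w)
    bottom-spec = argmin (λ w → spine? w ×-dec nonroot? w) size
      (count-witness (λ w → spine? w ×-dec nonroot? w) (s≤s⁻¹ (ℕ.≤-trans 2≤M (ℕ.≤-reflexive (count-peel spine? root-spine)))))

    bottom : Fin n
    bottom = proj₁ bottom-spec

    bottom-spine : ¬ OnLeg bottom
    bottom-spine = proj₁ (proj₁ (proj₂ bottom-spec))

    bottom≢root : bottom ≢ root
    bottom≢root = proj₂ (proj₁ (proj₂ bottom-spec))

    bottom-smallest : ∀ {w} → ¬ OnLeg w → w ≢ root → size bottom ≤ size w
    bottom-smallest s w≢ = proj₂ (proj₂ bottom-spec) _ (s , w≢)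

  bottom-lowest : Lowest bottom
  bottom-lowest {w} w-spine w≼ with w Fin.≟ bottom
  ... | yes e = e
  ... | no w≢ = contradiction (bottom-smallest w-spine λ e → w≢ (≼-antisym w≼ (subst (bottom ≼_) (sym e) (≼-root bottom))))
    (ℕ.<⇒≱ (size-strict w≼ w≢))

  -- The root has three children, and each of two given vertices lies below at most one of them.
  third-child : ∀ v w → ∃ λ c → RootChild c × ¬ v ≼ c × ¬ w ≼ c
  third-child v w with three-neighbours G branching
  ... | x , y , z , (x≢y , x≢z , y≢z) , ex , ey , ez = pick (v ≼? x) (w ≼? x) (v ≼? y) (w ≼? y)
    where
    unique : ∀ {u c d} → Graph._~_ G root c → Graph._~_ G root d → c ≢ d → u ≼ c → ¬ u ≼ d
    unique ec ed c≢d u≼c u≼d = c≢d (root-child-unique (root-neighbour ec) (root-neighbour ed) u≼c u≼d)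
    pick : Dec (v ≼ x) → Dec (w ≼ x) → Dec (v ≼ y) → Dec (w ≼ y) → ∃ λ c → RootChild c × ¬ v ≼ c × ¬ w ≼ c
    pick (no v⋠x) (no w⋠x) _ _ = x , root-neighbour ex , v⋠x , w⋠x
    pick _ _ (no v⋠y) (no w⋠y) = y , root-neighbour ey , v⋠y , w⋠y
    pick (yes v≼x) _ (yes v≼y) _ = contradiction v≼y (unique ex ey x≢y v≼x)
    pick _ (yes w≼x) _ (yes w≼y) = contradiction w≼y (unique ex ey x≢y w≼x)
    pick (yes v≼x) _ _ (yes w≼y) = z , root-neighbour ez , unique ex ez x≢z v≼x , unique ey ez y≢z w≼y
    pick _ (yes w≼x) (yes v≼y) _ = z , root-neighbour ez , unique ey ez y≢z v≼y , unique ex ez x≢z w≼x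

  separate : ∀ {c v} → RootChild c → ¬ OnLeg v → v ≢ root → ¬ v ≼ c → ¬ c ≼ v
  separate {c} {v} rc v-spine v≢root v⋠c c≼v = v⋠c (subst (v ≼_) (sym (≼-depth-≡ c≼v
    (ℕ.≤-trans (ℕ.≤-reflexive (root-child-depth rc)) (ℕ.≤-trans (s≤s z≤n) (ℕ.≤-reflexive (sym (depth-par v≢root))))))) here)

  -- A spine vertex not above `bottom` leads to a second lowest vertex `v`. Both carry at least j
  -- tips and a third child of the root carries another, so k ≥ 2j + 1. Hence k is odd and both
  -- carry exactly j tips, which makes both light at jr + 2.
  spine-chain : ∀ {v} → ¬ OnLeg v → bottom ≼ v
  spine-chain {v₀} v₀-spine with bottom ≼? v₀
  ... | yes p = p
  ... | no ¬p = branch (argmin (λ w → spine? w ×-dec ¬? (bottom ≼? w)) size (v₀ , v₀-spine , ¬p))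
    where
    branch : (∃ λ v → (¬ OnLeg v × ¬ bottom ≼ v) × (∀ w → ¬ OnLeg w × ¬ bottom ≼ w → size v ≤ size w)) → bottom ≼ v₀
    branch (v , (v-spine , b⋠v) , min) with third-child v bottom
    ... | c , c-child , v⋠c , b⋠c = ⊥-elim (one-light odd v-spine v≢root bottom-spine bottom≢root
      (λ v≡b → b⋠v (subst (bottom ≼_) (sym v≡b) here)) (light v-spine v-lowest lv≤j) (light bottom-spine bottom-lowest lb≤j))
      where
      v≢root : v ≢ root
      v≢root refl = b⋠v (≼-root bottom)
      v-lowest : Lowest v
      v-lowest {w} w-spine w≼v with w Fin.≟ v
      ... | yes e  = e
      ... | no w≢v = contradiction (min w (w-spine , λ b≼w → b⋠v (≼-trans b≼w w≼v))) (ℕ.<⇒≱ (size-strict w≼v w≢v))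
      v⋠b : ¬ v ≼ bottom
      v⋠b v≼b = b⋠v (subst (_≼ v) (bottom-lowest v-spine v≼b) here)
      total : 1 + l v + l bottom ≤ j + j′
      total = ℕ.≤-trans (ℕ.+-monoˡ-≤ (l bottom) (ℕ.+-monoˡ-≤ (l v) (tip-below (proj₁ c-child))))
        (ℕ.≤-trans (pack₃ (λ u → (u ∈? ts) ×-dec (u ≼? c)) (λ u → (u ∈? ts) ×-dec (u ≼? v)) (λ u → (u ∈? ts) ×-dec (u ≼? bottom)) (_∈? ts)
          proj₁ proj₁ proj₁
          (λ (_ , u≼c) (_ , u≼v) → [ separate c-child v-spine v≢root v⋠c , v⋠c ] (≼-linear u≼c u≼v))
          (λ (_ , u≼c) (_ , u≼b) → [ separate c-child bottom-spine bottom≢root b⋠c , b⋠c ] (≼-linear u≼c u≼b))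
          (λ (_ , u≼v) (_ , u≼b) → [ v⋠b , b⋠v ] (≼-linear u≼v u≼b)))
        (ℕ.≤-reflexive (trans count-ts (sym j+j′))))
      j≤lv : j ≤ l v
      j≤lv = lowest-tips v-spine v≢root v-lowest
      j≤lb : j ≤ l bottom
      j≤lb = lowest-tips bottom-spine bottom≢root bottom-lowest
      odd : j′ ≡ suc j
      odd = ℕ.≤-antisym j′≤1+j (by≤ 0 (ℕ.+-mono-≤ (ℕ.+-mono-≤ total j≤lv) j≤lb) (arith j j′ (l v) (l bottom)))
        where
        arith : ∀ j j′ x y → suc j + (j + j′ + x + y) + 0 ≡ j′ + (1 + x + y + j + j)
        arith = solve-∀
      lv≤j : l v ≤ j
      lv≤j = by≤ 0 (ℕ.+-mono-≤ (ℕ.+-mono-≤ total j′≤1+j) j≤lb) (arith j j′ (l v) (l bottom))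
        where
        arith : ∀ j j′ x y → x + (j + j′ + suc j + y) + 0 ≡ j + (1 + x + y + j′ + j)
        arith = solve-∀
      lb≤j : l bottom ≤ j
      lb≤j = by≤ 0 (ℕ.+-mono-≤ (ℕ.+-mono-≤ total j′≤1+j) j≤lv) (arith j j′ (l v) (l bottom))
        where
        arith : ∀ j j′ x y → y + (j + j′ + suc j + x) + 0 ≡ j + (1 + x + y + j′ + j)
        arith = solve-∀

  -- The spine is now a chain from `bottom` up to the root. `second` is its vertex next to the root,
  -- and the edge above it is the other end edge.
  second-spec : ∃ λ c → RootChild c × bottom ≼ c
  second-spec = root-child-above bottom≢root

  second : Fin n
  second = proj₁ second-spec

  second-child : RootChild second
  second-child = proj₁ (proj₂ second-spec)

  bottom≼second : bottom ≼ second
  bottom≼second = proj₂ (proj₂ second-spec)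

  second-spine : ¬ OnLeg second
  second-spine = spine-upward bottom≼second bottom-spine

  outside-second : ∀ {w} → ¬ OnLeg w → ¬ w ≼ second → w ≡ root
  outside-second {w} w-spine w⋠ with ≼-linear (spine-chain w-spine) bottom≼second
  ... | inj₁ w≼s = contradiction w≼s w⋠
  ... | inj₂ here = contradiction here w⋠
  ... | inj₂ (up _ p) = sym (≼-antisym (subst (_≼ w) (proj₂ second-child) p) (≼-root w))

  root⋠second : ¬ root ≼ second
  root⋠second p = proj₁ second-child (≼-antisym (≼-root second) p)

  -- The counterpart of `lowest-size` at the other end: the root is the only spine vertex on its
  -- side of the edge.
  second-cosize : cosize second ≡ 1 + r * l′ second
  second-cosize = trans (cosize-spine second-spine) (cong (_+ r * l′ second) (trans
    (count-cong (λ w → spine? w ×-dec ¬? (w ≼? second)) (Fin._≟ root)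
      (λ (s , w⋠) → outside-second s w⋠) (λ where refl → root-spine , root⋠second)) (count-≡ root)))

  j≤l′second : j ≤ l′ second
  j≤l′second = *-reflects-≤ (subst (_≤ r * l′ second) (ℕ.*-comm j r)
    (s≤s⁻¹ (ℕ.≤-trans (proj₂ (proj₂ (spine-heavy second-spine (proj₁ second-child)))) (ℕ.≤-reflexive second-cosize))))

  j≤lbottom : j ≤ l bottom
  j≤lbottom = lowest-tips bottom-spine bottom≢root bottom-lowest

  -- A tip attached between the ends, besides at least j tips at each end, gives k ≥ 2j + 1. Then k
  -- is odd, each end has exactly j tips, and both end edges, which this tip separates, are light at
  -- jr + 2.
  tips-at-bottom : ∀ {u} → u ∈ ts → u ≼ second → u ≼ bottom
  tips-at-bottom {u} u∈ u≼s with u ≼? bottom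
  ... | yes p = p
  ... | no ¬p = ⊥-elim (one-light odd bottom-spine bottom≢root second-spine (proj₁ second-child)
      (λ b≡s → ¬p (subst (u ≼_) (sym b≡s) u≼s)) (light bottom-spine bottom-lowest lb≤j) second-light)
    where
    more : l bottom + 1 ≤ l second
    more = ℕ.≤-trans (ℕ.≤-reflexive (cong (l bottom +_) (sym (count-≡ u))))
      (pack₂ (λ w → (w ∈? ts) ×-dec (w ≼? bottom)) (Fin._≟ u) (λ w → (w ∈? ts) ×-dec (w ≼? second))
        (λ (w∈ , p) → w∈ , ≼-trans p bottom≼second) (λ where refl → u∈ , u≼s) (λ where (_ , p) refl → ¬p p))
    total : l second + l′ second ≤ j + j′
    total = ℕ.≤-reflexive (trans (l+l′ second) (sym j+j′))
    odd : j′ ≡ suc j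
    odd = ℕ.≤-antisym j′≤1+j (by≤ 0 (ℕ.+-mono-≤ (ℕ.+-mono-≤ total j≤l′second) (ℕ.+-mono-≤ j≤lbottom more))
      (arith j j′ (l second) (l′ second) (l bottom)))
      where
      arith : ∀ j j′ x y z → suc j + (j + j′ + y + (z + x)) + 0 ≡ j′ + (x + y + j + (j + (z + 1)))
      arith = solve-∀
    lb≤j : l bottom ≤ j
    lb≤j = by≤ 0 (ℕ.+-mono-≤ (ℕ.+-mono-≤ total j≤l′second) (ℕ.+-mono-≤ j′≤1+j more))
      (arith j j′ (l second) (l′ second) (l bottom))
      where
      arith : ∀ j j′ x y z → z + (j + j′ + y + (suc j + x)) + 0 ≡ j + (x + y + j + (j′ + (z + 1)))
      arith = solve-∀
    l′≤j : l′ second ≤ j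
    l′≤j = by≤ 0 (ℕ.+-mono-≤ (ℕ.+-mono-≤ total j≤lbottom) (ℕ.+-mono-≤ j′≤1+j more))
      (arith j j′ (l second) (l′ second) (l bottom))
      where
      arith : ∀ j j′ x y z → y + (j + j′ + z + (suc j + x)) + 0 ≡ j + (x + y + j + (j′ + (z + 1)))
      arith = solve-∀
    second-light : ¬ Heavy (2 + j * r) second
    second-light (_ , _ , h) = ℕ.<-irrefl refl (ℕ.≤-trans h (ℕ.≤-trans (ℕ.≤-reflexive second-cosize)
      (s≤s (ℕ.≤-trans (ℕ.*-monoʳ-≤ r l′≤j) (ℕ.≤-reflexive (ℕ.*-comm r j))))))

  rootTips bottomTips : List (Fin n)
  rootTips   = filter (λ u → ¬? (u ≼? second)) ts
  bottomTips = filter (_≼? bottom) ts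

  a b : ℕ
  a = length rootTips
  b = length bottomTips

  a≡ : a ≡ l′ second
  a≡ = sym (count≡length (λ u → (u ∈? ts) ×-dec ¬? (u ≼? second)) (Unique.filter⁺ (λ u → ¬? (u ≼? second)) ts!)
    (∈-filter⁻ (λ u → ¬? (u ≼? second)) {xs = ts}) (λ (u∈ , u⋠) → ∈-filter⁺ (λ u → ¬? (u ≼? second)) u∈ u⋠))

  b≡ : b ≡ l bottom
  b≡ = sym (count≡length (λ u → (u ∈? ts) ×-dec (u ≼? bottom)) (Unique.filter⁺ (_≼? bottom) ts!)
    (∈-filter⁻ (_≼? bottom) {xs = ts}) (λ (u∈ , u≼) → ∈-filter⁺ (_≼? bottom) u∈ u≼))

  lbottom≡lsecond : l bottom ≡ l second
  lbottom≡lsecond = count-cong (λ u → (u ∈? ts) ×-dec (u ≼? bottom)) (λ u → (u ∈? ts) ×-dec (u ≼? second))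
    (λ (u∈ , p) → u∈ , ≼-trans p bottom≼second) (λ (u∈ , p) → u∈ , tips-at-bottom u∈ p)

  a+b : a + b ≡ k
  a+b = trans (cong₂ _+_ a≡ (trans b≡ lbottom≡lsecond)) (trans (ℕ.+-comm (l′ second) (l second)) (l+l′ second))

  j≤a : j ≤ a
  j≤a = subst (j ≤_) (sym a≡) j≤l′second

  j≤b : j ≤ b
  j≤b = subst (j ≤_) (sym b≡) j≤lbottom

  spine-length : suc (depth bottom) ≡ M
  spine-length = sym (trans (count≡length spine? {xs = xs} (unique-map
      (λ i∈ i′∈ → anc-injective (λ i → anc-≢root i) (s≤s⁻¹ (∈-upTo⁻ i∈)) (s≤s⁻¹ (∈-upTo⁻ i′∈))) (Unique.upTo⁺ _))
      (λ x∈ → case ∈-map⁻ (λ i → anc i bottom) x∈ of λ where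
        (i , i∈ , refl) → spine-upward (≼anc i (s≤s⁻¹ (∈-upTo⁻ i∈))) bottom-spine)
      (λ w-spine → case ≼-anc (spine-chain w-spine) of λ where
        (i , e , refl) → ∈-map⁺ (λ i → anc i bottom) (∈-upTo⁺ (s≤s (ℕ.m+n≤o⇒m≤o i (ℕ.≤-reflexive e))))))
    (trans (List.length-map (λ i → anc i bottom) (upTo (suc (depth bottom)))) (List.length-upTo (suc (depth bottom)))))
    where
    xs : List (Fin n)
    xs = map (λ i → anc i bottom) (upTo (suc (depth bottom)))

  open DoubleTree n r a b 1≤r (ℕ.≤-trans 1≤j j≤a) (ℕ.≤-trans 1≤j j≤b) (subst (λ x → x * r + 2 ≤ n) (sym a+b) room)
    using (rootedᵈ; parent; first; last; foot; toℕ-first; toℕ-last; m+legs; ≢first; suc-pred)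
  open Double n r a b using (Vertex; Leg; m)

  m≡ : m ≡ suc (depth bottom)
  m≡ = ℕ.+-cancelʳ-≡ ((a + b) * r) m (suc (depth bottom)) (trans m+legs (trans (sym count-spine)
    (cong₂ _+_ (sym spine-length) (trans (ℕ.*-comm r k) (cong (_* r) (sym a+b))))))

  toℕ≤depth : ∀ (i : Fin m) → toℕ i ≤ depth bottom
  toℕ≤depth i = s≤s⁻¹ (ℕ.<-≤-trans (Fin.toℕ<n i) (ℕ.≤-reflexive m≡))

  tipOf : Leg → Fin n
  tipOf (inj₁ x) = List.lookup rootTips x
  tipOf (inj₂ y) = List.lookup bottomTips y

  tipOf-root : ∀ x → List.lookup rootTips x ∈ ts × ¬ List.lookup rootTips x ≼ second
  tipOf-root x = ∈-filter⁻ (λ u → ¬? (u ≼? second)) {xs = ts} (∈-lookup x)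

  tipOf-bottom : ∀ y → List.lookup bottomTips y ∈ ts × List.lookup bottomTips y ≼ bottom
  tipOf-bottom y = ∈-filter⁻ (_≼? bottom) {xs = ts} (∈-lookup y)

  tipOf∈ : ∀ l → tipOf l ∈ ts
  tipOf∈ (inj₁ x) = proj₁ (tipOf-root x)
  tipOf∈ (inj₂ y) = proj₁ (tipOf-bottom y)

  tipOf-injective : ∀ l l′ → tipOf l ≡ tipOf l′ → l ≡ l′
  tipOf-injective (inj₁ x) (inj₁ y) e = cong inj₁ (lookup-injective (Unique.filter⁺ (λ u → ¬? (u ≼? second)) ts!) e)
  tipOf-injective (inj₂ x) (inj₂ y) e = cong inj₂ (lookup-injective (Unique.filter⁺ (_≼? bottom) ts!) e)
  tipOf-injective (inj₁ x) (inj₂ y) e = contradiction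
    (subst (_≼ second) (sym e) (≼-trans (proj₂ (tipOf-bottom y)) bottom≼second)) (proj₂ (tipOf-root x))
  tipOf-injective (inj₂ x) (inj₁ y) e = contradiction
    (subst (_≼ second) e (≼-trans (proj₂ (tipOf-bottom x)) bottom≼second)) (proj₂ (tipOf-root y))

  tipOf-surjective : ∀ {u} → u ∈ ts → ∃ λ l → tipOf l ≡ u
  tipOf-surjective {u} u∈ with u ≼? second
  ... | yes p = let u∈′ = ∈-filter⁺ (_≼? bottom) u∈ (tips-at-bottom u∈ p) in
    inj₂ (Any.index u∈′) , sym (Any.lookup-index u∈′)
  ... | no ¬p = let u∈′ = ∈-filter⁺ (λ u → ¬? (u ≼? second)) u∈ ¬p in
    inj₁ (Any.index u∈′) , sym (Any.lookup-index u∈′)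

  1+pred-r : suc (pred r) ≡ r
  1+pred-r = suc-pred (λ r≡0 → ℕ.<⇒≱ 1≤r (ℕ.≤-reflexive r≡0))

  pred-r<r : pred r < r
  pred-r<r = ℕ.≤-reflexive 1+pred-r

  ≼-leave : ∀ {w v} → w ≼ v → w ≢ v → par w ≼ v
  ≼-leave here     w≢v = contradiction refl w≢v
  ≼-leave (up _ p) w≢v = p

  above-leg : ∀ {u v} → u ∈ ts → ¬ OnLeg v → u ≼ v → anc r u ≼ v
  above-leg {u} {v} u∈ v-spine u≼v = subst (λ x → anc x u ≼ v) 1+pred-r
    (≼-leave (proj₁ (leg-compat v-spine pred-r<r u∈) u≼v) λ e → v-spine (subst OnLeg e (∈-legs⁺ pred-r<r u∈)))

  -- Otherwise one leg would run into another from below. The tip of the latter is childless, and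
  -- its other vertices have only their predecessor as child, so the two legs would be the same,
  -- with incompatible heights.
  foot-spine : ∀ {u} → u ∈ ts → ¬ OnLeg (anc r u)
  foot-spine {u} u∈ foot∈ = go (∈-legs⁻ r ts foot∈)
    where
    below : Fin n
    below = anc (pred r) u
    below≢root : below ≢ root
    below≢root = Tip.nonroot (tips u∈) (pred r) pred-r<r
    par-below : par below ≡ anc r u
    par-below = cong (λ x → anc x u) 1+pred-r
    go : (∃₂ λ t v → t < r × v ∈ ts × anc r u ≡ anc t v) → ⊥
    go (zero  , v , t<r , v∈ , e) = Tip.childless (tips v∈) below below≢root (trans par-below e)
    go (suc t , v , t<r , v∈ , e) = ℕ.<-irrefl
      (trans (cong suc (proj₁ (legs-disjoint v∈ u∈ (ℕ.<⇒≤ t<r) pred-r<r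
        (sym (Tip.onlychild (tips v∈) t t<r below below≢root (trans par-below e)))))) 1+pred-r) t<r

  -- Path vertices are numbered from the root, so index i sits at depth i of the spine. Leg vertices
  -- are numbered from the foot, so index s sits r - 1 - s steps above the tip.
  g : Vertex → Fin n
  g (inj₁ i)       = anc (depth bottom ∸ toℕ i) bottom
  g (inj₂ (l , s)) = anc (r ∸ suc (toℕ s)) (tipOf l)

  depth-spine : ∀ i → depth (g (inj₁ i)) ≡ toℕ i
  depth-spine i = ℕ.+-cancelˡ-≡ (depth bottom ∸ toℕ i) _ _
    (trans (anc-depth (depth bottom ∸ toℕ i) (ℕ.m∸n≤m (depth bottom) (toℕ i))) (sym (ℕ.m∸n+n≡m (toℕ≤depth i))))

  g-spine : ∀ i → ¬ OnLeg (g (inj₁ i))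
  g-spine i = spine-upward (≼anc _ (ℕ.m∸n≤m (depth bottom) (toℕ i))) bottom-spine

  height<r : ∀ (s : Fin r) → r ∸ suc (toℕ s) < r
  height<r s = ℕ.∸-monoʳ-< z<s (Fin.toℕ<n s)

  g-leg : ∀ l s → OnLeg (g (inj₂ (l , s)))
  g-leg l s = ∈-legs⁺ (height<r s) (tipOf∈ l)

  g-injective : ∀ {x y} → g x ≡ g y → x ≡ y
  g-injective {inj₁ i} {inj₁ i′} e = cong inj₁ (Fin.toℕ-injective (trans (sym (depth-spine i)) (trans (cong depth e) (depth-spine i′))))
  g-injective {inj₁ i} {inj₂ (l , s)} e = contradiction (subst OnLeg (sym e) (g-leg l s)) (g-spine i)
  g-injective {inj₂ (l , s)} {inj₁ i} e = contradiction (subst OnLeg e (g-leg l s)) (g-spine i)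
  g-injective {inj₂ (l , s)} {inj₂ (l′ , s′)} e with legs-disjoint (tipOf∈ l) (tipOf∈ l′) (height<r s) (height<r s′) e
  ... | h , u = cong₂ (λ l s → inj₂ (l , s)) (tipOf-injective l l′ u)
    (Fin.toℕ-injective (ℕ.suc-injective (ℕ.∸-cancelˡ-≡ (Fin.toℕ<n s) (Fin.toℕ<n s′) h)))

  g-surjective : ∀ v → ∃ λ x → g x ≡ v
  g-surjective v with onLeg? v
  ... | yes v∈ = leg (∈-legs⁻ r ts v∈)
    where
    leg : (∃₂ λ t u → t < r × u ∈ ts × v ≡ anc t u) → ∃ λ x → g x ≡ v
    leg (t , u , t<r , u∈ , refl) with tipOf-surjective u∈
    ... | l , e = inj₂ (l , fromℕ< lt) , cong₂ anc (trans (cong (λ x → r ∸ suc x) (Fin.toℕ-fromℕ< lt)) same) e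
      where
      lt : r ∸ suc t < r
      lt = ℕ.∸-monoʳ-< z<s t<r
      same : r ∸ suc (r ∸ suc t) ≡ t
      same = ℕ.+-cancelʳ-≡ (suc (r ∸ suc t)) _ t (trans (ℕ.m∸n+n≡m lt) (trans (sym (ℕ.m+[n∸m]≡n t<r)) (sym (ℕ.+-suc t _))))
  ... | no v-spine with ≼-anc (spine-chain v-spine)
  ...   | i , e , refl = inj₁ (fromℕ< lt) , cong (λ x → anc x bottom) (trans (cong (depth bottom ∸_) (Fin.toℕ-fromℕ< lt))
      (trans (cong (_∸ depth (anc i bottom)) (sym e)) (ℕ.m+n∸n≡m i (depth (anc i bottom)))))
    where
    lt : depth (anc i bottom) < m
    lt = ℕ.<-≤-trans (s≤s (ℕ.m+n≤o⇒n≤o i (ℕ.≤-reflexive e))) (ℕ.≤-reflexive (sym m≡))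

  -- The vertex on top of a leg is on the spine. For a tip not below `second` it is outside
  -- `second`, where the spine has only the root; for a tip below `bottom` it is a spine vertex
  -- below `bottom`, which is lowest.
  g-foot : ∀ l → g (inj₁ (foot l)) ≡ anc r (tipOf l)
  g-foot (inj₁ x) = trans (depth≡0⇒root (trans (depth-spine first) toℕ-first)) (sym (outside-second (foot-spine (proj₁ (tipOf-root x)))
    λ p → proj₂ (tipOf-root x) (≼-trans (≼anc-tip (proj₁ (tipOf-root x)) ℕ.≤-refl) p)))
  g-foot (inj₂ y) = trans (cong (λ x → anc x bottom) (trans (cong (depth bottom ∸_) (ℕ.suc-injective (trans toℕ-last m≡))) (ℕ.n∸n≡0 (depth bottom))))
    (sym (bottom-lowest (foot-spine (proj₁ (tipOf-bottom y))) (above-leg (proj₁ (tipOf-bottom y)) bottom-spine (proj₂ (tipOf-bottom y)))))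

  ∸-suc : ∀ {x d} → suc x ≤ d → d ∸ x ≡ suc (d ∸ suc x)
  ∸-suc le = ℕ.+-∸-assoc 1 le

  g-parent : ∀ x → x ≢ inj₁ first → g (parent x) ≡ par (g x)
  g-parent (inj₁ i) x≢ = cong (λ y → anc y bottom) (trans (cong (depth bottom ∸_) (toℕ-pred i))
    (trans (∸-suc (subst (_≤ depth bottom) (sym (suc-pred (≢first x≢))) (toℕ≤depth i))) (cong (λ y → suc (depth bottom ∸ y)) (suc-pred (≢first x≢)))))
  g-parent (inj₂ (l , Fin.zero))  x≢ = trans (g-foot l) (cong (λ y → anc y (tipOf l)) (∸-suc 1≤r))
  g-parent (inj₂ (l , Fin.suc s)) x≢ = cong (λ y → anc y (tipOf l))
    (trans (cong (λ y → r ∸ suc y) (Fin.toℕ-inject₁ s)) (∸-suc (Fin.toℕ<n (Fin.suc s))))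

  ≅-A : G ≅ A n r a b
  ≅-A = rooted-≅ R rootedᵈ (bijection g g-injective g-surjective)
    (depth≡0⇒root (trans (depth-spine first) toℕ-first)) g-parent

  -- From a + b = j + j′ and a, b ≥ j at most two distributions of the legs remain, and
  -- `double-swap` interchanges them.
  rigid : G ≅ A n r j′ j
  rigid with j′ ≟ j | a ≟ j
  ... | yes j′≡j | _ = subst₂ (λ x y → G ≅ A n r x y) a≡j′ b≡j ≅-A
    where
    a≡j′ : a ≡ j′
    a≡j′ = ℕ.≤-antisym (ℕ.+-cancelʳ-≤ j a j′ (ℕ.≤-trans (ℕ.+-monoʳ-≤ a j≤b)
      (ℕ.≤-reflexive (trans a+b (trans (sym j+j′) (ℕ.+-comm j j′)))))) (subst (_≤ a) (sym j′≡j) j≤a)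
    b≡j : b ≡ j
    b≡j = ℕ.+-cancelˡ-≡ a b j (trans a+b (trans (sym j+j′) (trans (ℕ.+-comm j j′) (cong (_+ j) (sym a≡j′)))))
  ... | no j′≢j | yes a≡j = ≅-trans {G = G} {H = A n r j j′} {K = A n r j′ j} (subst₂ (λ x y → G ≅ A n r x y) a≡j b≡j′ ≅-A) (double-swap n r j j′)
    where
    b≡j′ : b ≡ j′
    b≡j′ = ℕ.+-cancelˡ-≡ j b j′ (trans (cong (_+ b) (sym a≡j)) (trans a+b (sym j+j′)))
  ... | no j′≢j | no a≢j = subst₂ (λ x y → G ≅ A n r x y) a≡j′ b≡j ≅-A
    where
    j′≡1+j : j′ ≡ suc j
    j′≡1+j = ℕ.≤-antisym j′≤1+j (ℕ.≤∧≢⇒< j≤j′ (≢-sym j′≢j))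
    1+j≤a : suc j ≤ a
    1+j≤a = ℕ.≤∧≢⇒< j≤a (≢-sym a≢j)
    total : a + b ≡ suc j + j
    total = trans a+b (trans (sym j+j′) (trans (ℕ.+-comm j j′) (cong (_+ j) j′≡1+j)))
    b≡j : b ≡ j
    b≡j = ℕ.≤-antisym (ℕ.+-cancelˡ-≤ (suc j) b j (ℕ.≤-trans (ℕ.+-monoˡ-≤ b 1+j≤a) (ℕ.≤-reflexive total))) j≤b
    a≡j′ : a ≡ j′
    a≡j′ = trans (ℕ.+-cancelʳ-≡ j a (suc j) (trans (cong (a +_) (sym b≡j)) total)) (sym j′≡1+j)

-- Three leaves of a branching tree, and the three cases

module ThreeTips {n} {G : Graph (Fin n)} (R : Rooted G) (branching : 3 ≤ degree G (Rooted.root R)) where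
  open RootedFin R
  open RootChildren R

  -- A descendant of least size is childless, and for r = 1 a `Tip` is just a childless nonroot
  -- vertex.
  childless-below : ∀ {c} → c ≢ root → ∃ λ u → u ≼ c × Tip R 1 u
  childless-below {c} c≢root with argmin (_≼? c) size (c , here)
  ... | u , u≼c , min = u , u≼c , record
    { nonroot   = λ where
        zero _ refl → c≢root (≼-antisym (≼-root c) u≼c)
        (suc _) (s≤s ())
    ; childless = λ w w≢ e → ℕ.<⇒≱ (size-strict (up w≢ (subst (_≼ u) (sym e) here)) (λ w≡u → par-≢ w≢ (trans e (sym w≡u))))
        (min w (up w≢ (subst (_≼ c) (sym e) u≼c)))
    ; onlychild = λ where _ (s≤s ())
    }

  -- Distinct children of the root have no common descendant, so three of them provide three
  -- different leaves.
  three-tips : ∃ λ ts → UniqueList ts × length ts ≡ 3 × (∀ {u} → u ∈ ts → Tip R 1 u)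
  three-tips with three-neighbours G branching
  ... | x , y , z , (x≢y , x≢z , y≢z) , ex , ey , ez
    with childless-below (proj₁ (root-neighbour ex)) | childless-below (proj₁ (root-neighbour ey)) | childless-below (proj₁ (root-neighbour ez))
  ...   | u , u≼x , tu | v , v≼y , tv | w , w≼z , tw =
    u ∷ v ∷ w ∷ [] , ((differ ex ey x≢y u≼x v≼y ∷ differ ex ez x≢z u≼x w≼z ∷ []) ∷ (differ ey ez y≢z v≼y w≼z ∷ []) ∷ [] ∷ []) , refl , λ where
      (here refl)                 → tu
      (there (here refl))         → tv
      (there (there (here refl))) → tw
    where
    differ : ∀ {c d p q} → Graph._~_ G root c → Graph._~_ G root d → c ≢ d → p ≼ c → q ≼ d → p ≢ q
    differ ec ed c≢d p≼c q≼d refl = c≢d (root-child-unique (root-neighbour ec) (root-neighbour ed) p≼c q≼d)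

branch? : ∀ {n} (G : Graph (Fin n)) → (∃ λ ρ → 3 ≤ degree G ρ) ⊎ (∀ v → degree G v ≤ 2)
branch? G with Fin.any? (λ ρ → 3 ≤? degree G ρ)
... | yes b   = inj₁ b
... | no none = inj₂ λ v → s≤s⁻¹ (ℕ.≰⇒> λ le → none (v , le))

hasExactly-unique : ∀ {j k} {V : Set} {Q : V → Set} → HasExactly j Q → HasExactly k Q → j ≡ k
hasExactly-unique (xs , xs! , refl , x) (ys , ys! , refl , y) = ℕ.≤-antisym
  (unique-⊆-length xs! (λ x∈ → Equivalence.from (y _) (Equivalence.to (x _) x∈)))
  (unique-⊆-length ys! (λ y∈ → Equivalence.from (x _) (Equivalence.to (y _) y∈)))

module _ {n r j j′} (1≤r : 1 ≤ r) (1≤j′ : 1 ≤ j′) (1≤j : 1 ≤ j) (fits : (j′ + j) * r + 2 ≤ n)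
  (j≤j′ : j ≤ j′) (j′≤1+j : j′ ≤ suc j) where

  -- `ts` may be any list of tips of the right length, which allows r = 1 and three leaves to
  -- replace the pendent paths counted in the theorem. The upper bounds for `G` are what `D.N≥` asks
  -- of `N s`, so the comparison tree dominates; optimality turns this into equality, and `D.N≥`
  -- becomes a statement about `G`.
  extremal : ∀ {G : Graph (Fin n)} (R : Rooted G) → 3 ≤ degree G (Rooted.root R) →
    ∀ {ts} → UniqueList ts → length ts ≡ j′ + j → (∀ {u} → u ∈ ts → Tip R r u) →
    Mo G ≤ Mo (DoubleTree.copy n r j′ j 1≤r 1≤j′ 1≤j fits) → G ≅ A n r j′ j
  extremal {G} R branching {ts} ts! len tips Mo≤ = Rigidity.rigid R branching ts! 1≤r tips j+j′ 1≤j j≤j′ j′≤1+j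
    (subst (λ k → k * r + 2 ≤ n) (sym len) fits) optimal
    where
    module D = DoubleTree n r j′ j 1≤r 1≤j′ 1≤j fits
    open RootedFin R using (N)
    j+j′ : j + j′ ≡ length ts
    j+j′ = trans (ℕ.+-comm j j′) (sym len)
    N≤ : ∀ s → 1 ≤ s → N s ≤ D.C.N s
    N≤ s 1≤s = D.N≥ j≤j′ s (N s) 1≤s
      (λ β β≤r β<s → subst (λ k → N s + β * k + 1 ≤ n) len (Bounds.Legs.leg-bound R ts! 1≤r tips β≤r β<s))
      (Bounds.heavy-bound R s)
      (Bounds.Legs.spine-bound R ts! 1≤r tips j j′ j+j′ j≤j′ j′≤1+j)
    optimal : ∀ s X → 1 ≤ s → (∀ β → β ≤ r → β < s → X + β * length ts + 1 ≤ n) →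
      (0 < X → X + 2 * s ≤ suc n) → (r < s → 0 < X → X + j′ * r + s ≤ n) → X ≤ N s
    optimal s zero      1≤s legs both spine = z≤n
    optimal s X@(suc x) 1≤s legs both spine = ℕ.≤-trans
      (D.N≥ j≤j′ s X 1≤s (λ β β≤r β<s → subst (λ k → X + β * k + 1 ≤ n) len (legs β β≤r β<s)) both spine)
      (N-tight R D.rooted Mo≤ N≤ s 1≤s (ℕ.≤-trans (ℕ.m≤m+n s (s + 0)) (ℕ.≤-trans (ℕ.m≤n+m (2 * s) x) (s≤s⁻¹ (both z<s)))))

theorem5p2 : (n k r : ℕ) → 1 ≤ n → 1 ≤ k → 1 ≤ r →
    (T : Graph (Fin n)) → HasMinimumMo n k r T →
    (k ≡ 1 → 2 ≤ r → r + 3 ≤ n → T ≅ A n 1 1 2) ×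
    (k ≡ 2 → 1 ≤ r → r + 2 ≤ n → T ≅ P n) ×
    (3 ≤ k → 1 ≤ r → k * r + 2 ≤ n → T ≅ A n r ⌈ k /2⌉ ⌊ k /2⌋)
theorem5p2 n k r 1≤n 1≤k 1≤r T min = fork , path n T min , double
  where
  open HasMinimumMo min
  open IsTreeWithPendentPaths member

  not-pathLike : k ≢ 2 → r + 2 ≤ n → ∃ λ ρ → 3 ≤ degree T ρ
  not-pathLike k≢2 r+2≤n with branch? T
  ... | inj₁ ρ        = ρ
  ... | inj₂ degree≤2 = contradiction (hasExactly-unique pendent (PathLike.two-pendents isTree degree≤2 1≤r r+2≤n)) k≢2

  fork : k ≡ 1 → 2 ≤ r → r + 3 ≤ n → T ≅ A n 1 1 2
  fork refl 2≤r r+3≤n = from (not-pathLike (λ ()) (ℕ.≤-trans (ℕ.+-monoʳ-≤ r (ℕ.n≤1+n 2)) r+3≤n))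
    where
    from-tips : ∀ {ρ} → 3 ≤ degree T ρ → (∃ λ ts → UniqueList ts × length ts ≡ 3 × (∀ {u} → u ∈ ts → Tip (rootAt isTree ρ) 1 u)) →
      T ≅ A n 1 2 1
    from-tips {ρ} branching (ts , ts! , len , tips) =
      extremal (s≤s z≤n) (s≤s z≤n) (s≤s z≤n) (ForkTips.fits n r 2≤r r+3≤n) (s≤s z≤n) ℕ.≤-refl (rootAt isTree ρ) branching ts! len tips
        -- Minimality is among trees with one pendent path of length r ≥ 2. The fork is one of them,
        -- although `extremal` is applied to legs of length 1.
        (minimum (ForkTips.copy n r 2≤r r+3≤n) (ForkTips.member n r 2≤r r+3≤n))
    from : (∃ λ ρ → 3 ≤ degree T ρ) → T ≅ A n 1 1 2
    from (ρ , branching) = ≅-trans {G = T} {H = A n 1 2 1} {K = A n 1 1 2}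
      (from-tips branching (ThreeTips.three-tips (rootAt isTree ρ) branching)) (double-swap n 1 2 1)

  path : ∀ n (T : Graph (Fin n)) → HasMinimumMo n k r T → k ≡ 2 → 1 ≤ r → r + 2 ≤ n → T ≅ P n
  path zero    T min refl _ r+2≤n = contradiction r+2≤n (ℕ.<⇒≱ (ℕ.≤-trans (s≤s z≤n) (ℕ.m≤n+m 2 r)))
  path (suc m) T min refl _ r+2≤n with branch? T
  ... | inj₂ degree≤2 = pathLike-≅ (IsTreeWithPendentPaths.isTree (HasMinimumMo.member min)) degree≤2
  ... | inj₁ (ρ , branching) = strict (ThreeTips.three-tips R branching)
    where
    R : Rooted T
    R = rootAt (IsTreeWithPendentPaths.isTree (HasMinimumMo.member min)) ρ
    S : Rooted (P (suc m))
    S = PathTree.rooted m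
    open RootedFin R using (N)
    N≤ : ∀ s → 1 ≤ s → N s ≤ RootedFin.N S s
    N≤ s 1≤s = when-positive (N s) λ N>0 → PathTree.N≥ m s 1≤s (Bounds.heavy-bound R s N>0)
      where
      when-positive : ∀ x {y} → (0 < x → x ≤ y) → x ≤ y
      when-positive zero    x≤y = z≤n
      when-positive (suc x) x≤y = x≤y z<s
    -- The threshold 2 detects leaves, since the edge at a leaf has a side of size 1. The path is an
    -- admissible competitor and attains `heavy-bound`, so minimality forces equality.
    tight : RootedFin.N S 2 ≤ N 2
    tight = N-tight R S (HasMinimumMo.minimum min (P (suc m)) (record
      { isTree  = P-tree m
      ; pendent = PathLike.two-pendents (P-tree m) P-degree≤2 1≤r r+2≤n
      })) N≤ 2 (s≤s z≤n) (ℕ.≤-trans (ℕ.m≤n+m 2 r) r+2≤n)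
    -- Three end vertices exclude three edges from N 2, one more than for the path.
    strict : (∃ λ ts → UniqueList ts × length ts ≡ 3 × (∀ {u} → u ∈ ts → Tip R 1 u)) → T ≅ P (suc m)
    strict (ts , ts! , len , tips) = contradiction
      (ℕ.≤-trans (PathTree.N≥ m 2 {suc (N 2)} (s≤s z≤n) fewer) tight) (ℕ.<-irrefl refl)
      where
      fewer : suc (N 2) + 2 * 2 ≤ suc (suc m)
      fewer = by≤ 0 (subst (λ k → N 2 + 1 * k + 1 ≤ suc m) len
        (Bounds.Legs.leg-bound R ts! (s≤s z≤n) tips (s≤s z≤n) (s≤s (s≤s z≤n)))) (arith (N 2) m)
        where
        arith : ∀ a m → suc a + 2 * 2 + suc m + 0 ≡ suc (suc m) + (a + 1 * 3 + 1)
        arith = solve-∀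

  double : 3 ≤ k → 1 ≤ r → k * r + 2 ≤ n → T ≅ A n r ⌈ k /2⌉ ⌊ k /2⌋
  double 3≤k _ kr+2≤n with not-pathLike (λ where refl → ℕ.<-irrefl refl 3≤k)
    (ℕ.≤-trans (ℕ.+-monoˡ-≤ 2 (ℕ.≤-trans (ℕ.≤-reflexive (sym (ℕ.*-identityˡ r))) (ℕ.*-monoˡ-≤ r 1≤k))) kr+2≤n)
  ... | ρ , branching with Chains.pendents⇒tips (rootAt isTree ρ) 1≤r branching pendent
  -- The last two arguments on this line place ⌈k/2⌉ between ⌊k/2⌋ and ⌊k/2⌋ + 1; the second is ⌊(k
  -- + 1)/2⌋ ≤ ⌊(k + 2)/2⌋ up to computation.
  ...   | ts , ts! , len , tips = extremal 1≤r (ℕ.<⇒≤ 2≤⌈k/2⌉) 1≤⌊k/2⌋ fits (ℕ.⌊n/2⌋≤⌈n/2⌉ k) (ℕ.⌊n/2⌋-mono (ℕ.n≤1+n (suc k)))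
    (rootAt isTree ρ) branching ts! (trans len (sym halves)) tips
    (minimum target (subst (λ k′ → IsTreeWithPendentPaths n k′ r target) halves
      (DoubleTips.member n r ⌈ k /2⌉ ⌊ k /2⌋ 1≤r 2≤⌈k/2⌉ 1≤⌊k/2⌋ fits)))
    where
    halves : ⌈ k /2⌉ + ⌊ k /2⌋ ≡ k
    halves = trans (ℕ.+-comm ⌈ k /2⌉ ⌊ k /2⌋) (ℕ.⌊n/2⌋+⌈n/2⌉≡n k)
    2≤⌈k/2⌉ : 2 ≤ ⌈ k /2⌉
    2≤⌈k/2⌉ = ℕ.⌈n/2⌉-mono 3≤k
    1≤⌊k/2⌋ : 1 ≤ ⌊ k /2⌋
    1≤⌊k/2⌋ = ℕ.⌊n/2⌋-mono 3≤k
    fits : (⌈ k /2⌉ + ⌊ k /2⌋) * r + 2 ≤ n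
    fits = subst (λ k → k * r + 2 ≤ n) (sym halves) kr+2≤n
    target : Graph (Fin n)
    target = DoubleTree.copy n r ⌈ k /2⌉ ⌊ k /2⌋ 1≤r (ℕ.<⇒≤ 2≤⌈k/2⌉) 1≤⌊k/2⌋ fits
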